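{- Let $X=\{a_1<\cdots<a_n\}$ be a finite nonempty set of positive integers. There is a bijection $\zeta:\mathrm{RAT}^+(X)\to \mathrm{AS}(X)$ such that if $\zeta(R)=\tau$, then \begin{align*} \mathrm{diag}(R)&=\mathrm{neg}(\tau), & \mathrm{tile}(R)&=\mathrm{sinv}(\tau), & \mathrm{row}(R)&=\mathrm{wex}(\tau),\\ \mathrm{topup}(R)&=\mathrm{RLmin}^*(\tau), & \mathrm{frow}(R)&=\mathrm{LRmax}^*(\tau), & \mathrm{fcell}(R)&=\mathrm{cro}(\tau). \end{align*} In particular, for $X=[n+1]$ this gives a bijection $\mathrm{RAT}^+(n+1,r+1)\to \mathrm{AS}(n+1,r+1)$ with these properties.
   Context: Rhombic diagrams. For a word $w=w_1\cdots w_m\in\{0,1,2\}^m$, the rhombic diagram $\Gamma_w$ is the region bounded by two lattice paths from a common starting point $P$: the southeast border, obtained by reading $w$ from left to right and taking a unit step south for each $2$, a step southwest (vector $(-1,-1)$) for each $1$, and a step west for each $0$; and the northwest border, consisting of (number of $0$'s) steps west, then (number of $1$'s) steps southwest, then (number of $2$'s) steps south. The region is tiled by unit squares, tall rhombi (two vertical and two diagonal sides) and short rhombi (two horizontal and two diagonal sides) via the maximal tiling: if there is no $i$ with $w_i>w_{i+1}$ there is nothing to tile; otherwise take the smallest $i$ with $w_i>w_{i+1}$, tile the region for the word $w'$ obtained by swapping $w_i,w_{i+1}$, and fill the remaining tile by a tall rhombus, a square, or a short rhombus according as $(w_i,w_{i+1})=(2,1),(2,0),(1,0)$. Each tile $\tau$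 has a north side, south side, east side and west side (for a square the obvious ones; for a short rhombus N and S are its horizontal sides and W,E its diagonal sides; for a tall rhombus N and S are its diagonal sides and W,E its vertical sides). Strips and labels. If the southeast border edges are labeled $x_1<\cdots<x_m$ from northeast to southwest, a strip is a maximal sequence of tiles connected through parallel edges; each southeast border edge starts a strip (possibly with no tiles) ending on the northwest border, and the strip gets that edge's label. Strips starting at vertical edges are rows (squares and tall rhombi), at horizontal edges columns (squares and short rhombi), at diagonal edges diagonal strips (short and tall rhombi). Every tile lies in exactly two strips; for labels $i<j$, the cell $(i,j)$ is the tile in strips $i$ and $j$ (if it exists). RAT. A rhombic alternative tableau (RAT) of shape $w$ is a filling of some tiles of $\Gamma_w$ with up-arrows and left-arrows, where up-arrows lie only in tiles belonging to a column and left-arrows only in tiles belonging to a row; a left-arrow points to all other cells of its row lying between it and the northwest border (to its west), an up-arrow to all other cells of its column between it and the northwest border (to its north); no arrow may lie in a cell pointed to by another arrow. A free cell is an empty cell to which no arrow points; a free row is a row with no left-arrow. $\mathrm{RAT}^+(X)$ is the set of RAT whose southeast border edges are labeled by $a_1,\dots,a_n$ (northeast to southwest), whose first southeast border step is diagonal, and in which every column contains an up-arrow (extended RAT). $\mathrm{RAT}^+(n+1,r+1)$ is $\mathrm{RAT}^+([n+1])$ restricted to $r+1$ diagonal steps. For $R\in\mathrm{RAT}^+(X)$: $\mathrm{diag}(R)$ is the set of labels of diagonal strips; $\mathrm{tile}(R)$ the number of tiles; $\mathrm{row}(R)$ the number of rows; $\mathrm{frow}(R)$ the number of free rows; $\mathrm{fcell}(R)$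 the number of free cells; $\mathrm{topup}(R)$ the number of up-arrows in the diagonal strip labeled $a_1$. Signed permutations. A signed permutation on $X$ is a bijection $\tau$ of $X\cup(-X)$ with $\tau(-i)=-\tau(i)$; write $\mathrm{neg}(\tau)=\{i\in X:\tau(i)<0\}$. $\mathrm{AS}(X)$ is the set of signed permutations $\tau$ on $X$ with $a_1\in\mathrm{neg}(\tau)$ and, writing $\mathrm{neg}(\tau)=\{d_1<\cdots<d_r\}$, $|\tau(d_1)|<\cdots<|\tau(d_r)|$. (These are in natural bijection with assemblées on $X$, i.e. sets of permutations of the blocks of a set partition of $X$: order blocks by increasing first element, concatenate, and negate each block's first element.) $\mathrm{AS}(n+1,r+1)$ is the set of $\tau\in\mathrm{AS}([n+1])$ with $|\mathrm{neg}(\tau)|=r+1$. Statistics. The shape of $\tau$ is $w_1\cdots w_n$ with $w_i=2$ if $\tau(a_i)\ge a_i$, $w_i=1$ if $\tau(a_i)<0$, $w_i=0$ if $0<\tau(a_i)<a_i$; $\mathrm{sinv}(\tau)$ is the number of pairs $i<j$ with $w_i>w_j$; $\mathrm{wex}(\tau)$ is the number of $a_i$ with $\tau(a_i)\ge a_i$. $\tau(a_i)$ is a special LR-maximum if $\tau(a_i)>|\tau(k)|$ for all $k\in\{a_1,\dots,a_{i-1}\}\cup\mathrm{neg}(\tau)$, and a special RL-minimum if $0<\tau(a_i)<|\tau(k)|$ for all $k\in\{a_{i+1},\dots,a_n\}\cup\mathrm{neg}(\tau)$; $\mathrm{LRmax}^*(\tau)$, $\mathrm{RLmin}^*(\tau)$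 count them. Crossings. Define a total order $<_\tau$ on $\mathrm{neg}(\tau)$: $i<_\tau j$ iff $\min(i,|\tau(i)|)<\min(j,|\tau(j)|)$, or $\min(i,|\tau(i)|)=i=|\tau(j)|=\min(j,|\tau(j)|)$. Write $\mathrm{neg}(\tau)=\{e_1<_\tau\cdots<_\tau e_r\}$. The arc diagram has points $-r<\cdots<-1<a_1<\cdots<a_n$ on the real line, and for each $i\in X$: if $\tau(i)\ge i$ an upper arc $(i,\tau(i))$; if $0<\tau(i)<i$ a lower arc $(\tau(i),i)$; if $i=e_j$ a lower arc $(-j,i)$ and an upper arc $(-j,|\tau(i)|)$. An upper crossing is a pair of upper arcs $(a,b),(c,d)$ with $a<c\le b<d$; a lower crossing a pair of lower arcs $(a,b),(c,d)$ with $a<c<b<d$. $\mathrm{cro}(\tau)$ is the total number of crossings. -}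

module Defs where

open import Data.Nat as ℕ using (ℕ; zero; suc; _+_; _*_)
open import Data.Bool using (Bool; true; false; _∧_; _∨_; not; if_then_else_; T)
open import Data.Fin as Fin using (Fin; toℕ)
open import Data.Fin.Subset using (Subset)
open import Data.Fin.Properties using (_≟_)
open import Data.Vec as Vec using (Vec; lookup; tabulate; head)
open import Data.List as List using (List; []; _∷_; length)
open import Data.Maybe using (Maybe; just; nothing)
open import Data.Product using (Σ; _×_; _,_; proj₁; proj₂; ∃)
open import Data.Integer as ℤ using (ℤ; +_)
open import Relation.Nullary.Decidable using (⌊_⌋)
open import Relation.Binary.PropositionalEquality using (_≡_)
open import Function.Definitions using (Bijective)

fins : (n : ℕ) → List (Fin n)
fins n = Vec.toList (Vec.allFin n)

countL : ∀ {A : Set} → (A → Bool) → List A → ℕ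
countL p [] = 0
countL p (x ∷ xs) = if p x then suc (countL p xs) else countL p xs

allL : ∀ {A : Set} → (A → Bool) → List A → Bool
allL p [] = true
allL p (x ∷ xs) = p x ∧ allL p xs

anyL : ∀ {A : Set} → (A → Bool) → List A → Bool
anyL p [] = false
anyL p (x ∷ xs) = p x ∨ anyL p xs

countF : ∀ {n} → (Fin n → Bool) → ℕ
countF {n} p = countL p (fins n)

sumF : ∀ {n} → (Fin n → ℕ) → ℕ
sumF {n} f = sumL (List.map f (fins n))
  where
  sumL : List ℕ → ℕ
  sumL [] = 0
  sumL (x ∷ xs) = x + sumL xs

-- Letters of a shape word: l0 = west step, l1 = southwest, l2 = south

data Letter : Set where
  l0 l1 l2 : Letter

lval : Letter → ℕ
lval l0 = 0
lval l1 = 1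
lval l2 = 2

isL0 isL1 isL2 : Letter → Bool
isL0 l0 = true
isL0 _ = false
isL1 l1 = true
isL1 _ = false
isL2 l2 = true
isL2 _ = false

_>L_ : Letter → Letter → Bool
x >L y = ⌊ lval y ℕ.<? lval x ⌋

-- Maximal tiling of the rhombic diagram Γ_w.
--
-- The southeast border edges are labelled (northeast to southwest) by
-- the strip labels 0,1,..,n-1 (label k stands for a_{k+1}).  We track,
-- along the border path, each edge's letter together with the label of
-- the strip it carries.  One step of the maximal tiling swaps the
-- first descent w_i > w_{i+1}; the tile filled in has as its southeast
-- sides the two swapped edges, so it lies in the two strips carried by
-- them, and the strips continue through the opposite (parallel) sides,
-- i.e. the labels travel with the swapped edges.

record Tile (n : ℕ) : Set where
  constructor tile
  field
    letter₁ : Letter   -- letter w_i   (the larger one)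
    label₁  : Fin n    -- strip through the edge w_i
    letter₂ : Letter   -- letter w_{i+1}
    label₂  : Fin n    -- strip through the edge w_{i+1}
open Tile public

-- tile type: (2,1) tall rhombus, (2,0) square, (1,0) short rhombus.
-- The tile belongs to a row iff letter₁ = l2 (that row is label₁),
-- and to a column iff letter₂ = l0 (that column is label₂).

firstSwapFrom : ∀ {n} → Letter × Fin n → List (Letter × Fin n) →
                Maybe (Tile n × List (Letter × Fin n))
firstSwapFrom x [] = nothing
firstSwapFrom (a , p) ((b , q) ∷ rest) with a >L b
... | true = just (tile a p b q , (b , q) ∷ (a , p) ∷ rest)
... | false with firstSwapFrom (b , q) rest
...   | nothing = nothing
...   | just (t , u) = just (t , (a , p) ∷ u)

firstSwap : ∀ {n} → List (Letter × Fin n) → Maybe (Tile n × List (Letter × Fin n))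
firstSwap [] = nothing
firstSwap (x ∷ xs) = firstSwapFrom x xs

tilesFuel : ∀ {n} → ℕ → List (Letter × Fin n) → List (Tile n)
tilesFuel zero u = []
tilesFuel (suc k) u with firstSwap u
... | nothing = []
... | just (t , u') = t ∷ tilesFuel k u'

-- The tiles of Γ_w in the order in which the maximal tiling creates
-- them (from the southeast border towards the northwest border).  Along
-- every strip, this order is the order of its tiles from the southeast
-- border to the northwest border.  (n*n exceeds the number of
-- inversions of w, so the fuel never runs out.)
tiling : ∀ {n} → Vec Letter n → List (Tile n)
tiling {n} w = tilesFuel (n * n) (Vec.toList (Vec.zip w (Vec.allFin n)))

inStrip : ∀ {n} → Fin n → Tile n → Bool
inStrip ℓ t = ⌊ label₁ t ≟ ℓ ⌋ ∨ ⌊ label₂ t ≟ ℓ ⌋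

data Content : Set where
  empty up left : Content

isEmpty isUp isLeft : Content → Bool
isEmpty empty = true
isEmpty _ = false
isUp up = true
isUp _ = false
isLeft left = true
isLeft _ = false

record RATData (n : ℕ) : Set where
  constructor rat
  field
    word : Vec Letter n
    fill : Vec Content (length (tiling word))
open RATData public

module _ {n : ℕ} (R : RATData n) where

  TileIx : Set
  TileIx = Fin (length (tiling (word R)))

  tileAt : TileIx → Tile n
  tileAt k = List.lookup (tiling (word R)) k

  contentAt : TileIx → Content
  contentAt k = lookup (fill R) k

  tileIxs : List TileIx
  tileIxs = fins _

  pointsTo : TileIx → TileIx → Bool
  pointsTo k k' =
    ⌊ k Fin.<? k' ⌋ ∧
      ((isLeft (contentAt k) ∧ inStrip (label₁ (tileAt k)) (tileAt k'))
       ∨ (isUp (contentAt k) ∧ inStrip (label₂ (tileAt k)) (tileAt k')))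

  record IsRAT : Set where
    field
      upInColumn   : ∀ k → contentAt k ≡ up → letter₂ (tileAt k) ≡ l0
      leftInRow    : ∀ k → contentAt k ≡ left → letter₁ (tileAt k) ≡ l2
      notPointedAt : ∀ k k' → T (pointsTo k k') → contentAt k' ≡ empty

  record IsRATPlus : Set where
    field
      isRAT     : IsRAT
      firstDiag : (z : 0 ℕ.< n) → lookup (word R) (Fin.fromℕ< z) ≡ l1
      colsUp    : ∀ (ℓ : Fin n) → lookup (word R) ℓ ≡ l0 →
                    ∃ λ k → contentAt k ≡ up × T (inStrip ℓ (tileAt k))

  -- statistics (labels are indexed by Fin n: label k ↔ a_{k+1})
  diag : Subset n
  diag = tabulate (λ ℓ → isL1 (lookup (word R) ℓ))

  tileStat : ℕ
  tileStat = length (tiling (word R))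

  rowStat : ℕ
  rowStat = countF (λ ℓ → isL2 (lookup (word R) ℓ))

  frowStat : ℕ
  frowStat = countF (λ ℓ → isL2 (lookup (word R) ℓ) ∧
               not (anyL (λ k → isLeft (contentAt k) ∧ inStrip ℓ (tileAt k)) tileIxs))

  fcellStat : ℕ
  fcellStat = countL (λ k' → isEmpty (contentAt k') ∧
                not (anyL (λ k → pointsTo k k') tileIxs)) tileIxs

  topupStat : (z : 0 ℕ.< n) → ℕ
  topupStat z = countL (λ k → isUp (contentAt k) ∧ inStrip (Fin.fromℕ< z) (tileAt k)) tileIxs

record IsLabelSet {n : ℕ} (X : Vec ℕ n) : Set where
  field
    positive   : ∀ i → 0 ℕ.< lookup X i
    increasing : ∀ i j → i Fin.< j → lookup X i ℕ.< lookup X j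

-- Signed permutations on X.  τ(a_i) = a_j if entry i is (false , j)
-- and τ(a_i) = - a_j if entry i is (true , j); τ(-a_i) = -τ(a_i).

SPData : ℕ → Set
SPData n = Vec (Bool × Fin n) n

module _ {n : ℕ} (X : Vec ℕ n) (τ : SPData n) where

  perm : Fin n → Fin n
  perm i = proj₂ (lookup τ i)

  negB : Fin n → Bool
  negB i = proj₁ (lookup τ i)

  aval : Fin n → ℕ
  aval i = lookup X i

  absτ : Fin n → ℕ
  absτ i = lookup X (perm i)

  τval : Fin n → ℤ
  τval i = if negB i then ℤ.- (+ absτ i) else + absτ i

  -- a bijection of X ∪ -X commuting with negation
  IsSignedPerm : Set
  IsSignedPerm = Bijective _≡_ _≡_ perm

  record IsAS : Set where
    field
      signedPerm : IsSignedPerm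
      firstNeg   : (z : 0 ℕ.< n) → negB (Fin.fromℕ< z) ≡ true
      negIncr    : ∀ i j → negB i ≡ true → negB j ≡ true →
                     aval i ℕ.< aval j → absτ i ℕ.< absτ j

  neg : Subset n
  neg = tabulate negB

  shapeOf : Fin n → Letter
  shapeOf i with negB i
  ... | true = l1
  ... | false = if ⌊ aval i ℕ.≤? absτ i ⌋ then l2 else l0

  sinv : ℕ
  sinv = sumF (λ i → countF (λ j → ⌊ i Fin.<? j ⌋ ∧ (shapeOf i >L shapeOf j)))

  wex : ℕ
  wex = countF (λ i → ⌊ + aval i ℤ.≤? τval i ⌋)

  LRmax* : ℕ
  LRmax* = countF (λ i → allL (λ k → not (⌊ k Fin.<? i ⌋ ∨ negB k) ∨
                                      ⌊ + absτ k ℤ.<? τval i ⌋) (fins n))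

  RLmin* : ℕ
  RLmin* = countF (λ i → ⌊ + 0 ℤ.<? τval i ⌋ ∧
                         allL (λ k → not (⌊ i Fin.<? k ⌋ ∨ negB k) ∨
                                      ⌊ τval i ℤ.<? + absτ k ⌋) (fins n))

  minτ : Fin n → ℕ
  minτ i = aval i ℕ.⊓ absτ i

  ltτ : Fin n → Fin n → Bool
  ltτ i j = ⌊ minτ i ℕ.<? minτ j ⌋ ∨
            (⌊ minτ i ℕ.≟ aval i ⌋ ∧ ⌊ aval i ℕ.≟ absτ j ⌋ ∧ ⌊ absτ j ℕ.≟ minτ j ⌋)

  -- e_j has index j = 1 + #{f ∈ neg : f <_τ e}; its point is -j
  negPoint : Fin n → ℤ
  negPoint e = ℤ.- (+ suc (countF (λ f → negB f ∧ ltτ f e)))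

  upperArc : Fin n → Maybe (ℤ × ℤ)
  upperArc i with negB i
  ... | true = just (negPoint i , + absτ i)
  ... | false = if ⌊ aval i ℕ.≤? absτ i ⌋ then just (+ aval i , + absτ i) else nothing

  lowerArc : Fin n → Maybe (ℤ × ℤ)
  lowerArc i with negB i
  ... | true = just (negPoint i , + aval i)
  ... | false = if ⌊ aval i ℕ.≤? absτ i ⌋ then nothing else just (+ absτ i , + aval i)

  upperCross : Maybe (ℤ × ℤ) → Maybe (ℤ × ℤ) → Bool
  upperCross (just (a , b)) (just (c , d)) =
    ⌊ a ℤ.<? c ⌋ ∧ ⌊ c ℤ.≤? b ⌋ ∧ ⌊ b ℤ.<? d ⌋
  upperCross _ _ = false

  lowerCross : Maybe (ℤ × ℤ) → Maybe (ℤ × ℤ) → Bool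
  lowerCross (just (a , b)) (just (c , d)) =
    ⌊ a ℤ.<? c ⌋ ∧ ⌊ c ℤ.<? b ⌋ ∧ ⌊ b ℤ.<? d ⌋
  lowerCross _ _ = false

  cro : ℕ
  cro = sumF (λ i → countF (λ j → upperCross (upperArc i) (upperArc j)))
      + sumF (λ i → countF (λ j → lowerCross (lowerArc i) (lowerArc j)))

{-# OPTIONS --safe #-}
module Submission where

-- Read the tiles in the order of the maximal tiling.  The tile of strips p and q exchanges the
-- neighbouring places i and i + 1 of the border path, and the signed permutation is carried along:
-- a free or an up-arrow tile keeps the values and exchanges the sources i and i + 1, whereas a
-- left-arrow or pointed-to tile conjugates by the transposition of i and i + 1.  After the last tile
-- the permutation is the identity.  A left-arrow is recognised by the row p being a fixed point, an
-- up-arrow by the column q being sent to the place of p; from then on that strip is dead, i.e. a fixed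
-- point ignored by all statistics.  Hence the filling and the permutation determine each other, and
-- each tile changes the statistics locally: a free tile creates exactly one crossing (the
-- bijective form of DE = qED + D + E, DA = qAD + A, AE = qEA + A for the open arcs), an up-arrow in
-- the strip a₁ creates a special RL-minimum, and nothing else happens.

open import Defs
open import Data.Nat using (ℕ; zero; suc; _+_; _*_; _<_; _≤_; z≤n; s≤s; s≤s⁻¹; _<ᵇ_; _<?_; _≤?_)
open import Data.Nat.Properties
open import Data.Bool using (Bool; true; false; _∧_; _∨_; not; if_then_else_; T)
open import Data.Bool.Properties using (∧-zeroʳ; ∨-zeroʳ; ∧-identityʳ; ∨-identityʳ)
open import Data.Fin as Fin using (Fin; zero; suc; toℕ; fromℕ<)
open import Data.Fin.Properties using (toℕ<n; toℕ-injective; toℕ-fromℕ<; fromℕ<-injective; pigeonhole; any?) renaming (_≟_ to _≟F_)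
open import Data.List as List using (List; []; _∷_; length)
open import Data.Vec as Vec using (Vec; []; _∷_; lookup; tabulate)
open import Data.Vec.Properties using (tabulate-cong; tabulate∘lookup; lookup∘tabulate)
open import Data.Maybe using (Maybe; just; nothing)
open import Data.Product using (Σ; _×_; _,_; proj₁; proj₂; ∃)
open import Data.Sum using (_⊎_; inj₁; inj₂; [_,_])
open import Data.Unit using (⊤; tt)
open import Data.Empty using (⊥; ⊥-elim)
open import Function using (_∘_; id; case_of_)
open import Relation.Nullary using (Dec; yes; no; ¬_)
open import Relation.Nullary.Decidable using (⌊_⌋; _×-dec_)
open import Relation.Binary.Definitions using (Tri; tri<; tri≈; tri>)
open import Relation.Binary.PropositionalEquality hiding ([_])
open import Algebra.Properties.CommutativeMonoid.Sum +-0-commutativeMonoid using (sum; sum-cong-≗; ∑-distrib-+)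

-- Why conjugation is harmless: exchanging two neighbouring places is monotone away from either one
-- of them, and a dead strip occupies one of the two, both as source and as value. Live strips
-- therefore never notice the exchange. Why the arrows are forced: a row satisfies `src` ≤ `val`, a
-- live column `val` < `src`. Exchanging the sources puts p at i + 1 and q at i, and this respects
-- the inequalities unless a row p has value i or a column q has value i. These are the two arrow
-- cases, and they exclude each other because `val` is injective. Statistics are carried from the
-- last tile back to the first, while a permutation is decoded from the first tile on. The obstacle
-- is the crossing made by a free tile: it need not be between p and q, so sums over all ordered
-- pairs of strips are compared. The diagonal first strip matters for special RL-minima: everything
-- in front of it on the path is a dead column, so nothing live has a value smaller than its place.
-- The order on negative entries enters only to show that their arcs never cross one another.

T⇒≡true : ∀ {b} → T b → b ≡ true
T⇒≡true {true} _ = refl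

≡true⇒T : ∀ {b} → b ≡ true → T b
≡true⇒T refl = tt

¬T⇒≡false : ∀ {b} → ¬ T b → b ≡ false
¬T⇒≡false {true} h = ⊥-elim (h tt)
¬T⇒≡false {false} h = refl

bool-ext : ∀ {x y} → (T x → T y) → (T y → T x) → x ≡ y
bool-ext {true} {true} f g = refl
bool-ext {true} {false} f g = ⊥-elim (f tt)
bool-ext {false} {true} f g = ⊥-elim (g tt)
bool-ext {false} {false} f g = refl

true≢false : ∀ {b} {A : Set} → b ≡ true → b ≡ false → A
true≢false refl ()

∧-intro : ∀ {x y} → T x → T y → T (x ∧ y)
∧-intro {true} _ h = h

∧-elimˡ : ∀ {x y} → T (x ∧ y) → T x
∧-elimˡ {true} _ = tt

∧-elimʳ : ∀ {x y} → T (x ∧ y) → T y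
∧-elimʳ {true} h = h

∧-falseʳ : ∀ x {y} → y ≡ false → x ∧ y ≡ false
∧-falseʳ true e = e
∧-falseʳ false e = refl

⌊⌋-true : ∀ {A : Set} {d : Dec A} → A → ⌊ d ⌋ ≡ true
⌊⌋-true {d = yes _} a = refl
⌊⌋-true {d = no ¬a} a = ⊥-elim (¬a a)

⌊⌋-false : ∀ {A : Set} {d : Dec A} → ¬ A → ⌊ d ⌋ ≡ false
⌊⌋-false {d = yes a} ¬a = ⊥-elim (¬a a)
⌊⌋-false {d = no _} ¬a = refl

⌊⌋-elim : ∀ {A : Set} {d : Dec A} → T ⌊ d ⌋ → A
⌊⌋-elim {d = yes a} _ = a

⌊⌋-ext : ∀ {A B : Set} {d : Dec A} {e : Dec B} → (A → B) → (B → A) → ⌊ d ⌋ ≡ ⌊ e ⌋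
⌊⌋-ext {d = yes a} f g = sym (⌊⌋-true (f a))
⌊⌋-ext {d = no ¬a} f g = sym (⌊⌋-false (¬a ∘ g))

<ᵇ-true : ∀ {m n} → m < n → (m <ᵇ n) ≡ true
<ᵇ-true h = T⇒≡true (<⇒<ᵇ h)

<ᵇ-false : ∀ {m n} → n ≤ m → (m <ᵇ n) ≡ false
<ᵇ-false {m} {n} h = ¬T⇒≡false (λ t → <⇒≱ (<ᵇ⇒< m n t) h)

⌊⌋≡<ᵇ : ∀ {A : Set} {d : Dec A} {m n} → (A → m < n) → (m < n → A) → ⌊ d ⌋ ≡ (m <ᵇ n)
⌊⌋≡<ᵇ {d = yes a} f g = sym (<ᵇ-true (f a))
⌊⌋≡<ᵇ {d = no ¬a} f g = sym (¬T⇒≡false (λ t → ¬a (g (<ᵇ⇒< _ _ t))))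

-- Counting as finite sums

b2n : Bool → ℕ
b2n b = if b then 1 else 0

count-∷ : ∀ {A : Set} (p : A → Bool) x xs → countL p (x ∷ xs) ≡ b2n (p x) + countL p xs
count-∷ p x xs with p x
... | true = refl
... | false = refl

countL-tabulate : ∀ {A : Set} {n} (p : A → Bool) (g : Fin n → A) →
  countL p (Vec.toList (tabulate g)) ≡ sum (b2n ∘ p ∘ g)
countL-tabulate {n = zero} p g = refl
countL-tabulate {n = suc n} p g =
  trans (count-∷ p (g zero) (Vec.toList (tabulate (g ∘ suc)))) (cong (b2n (p (g zero)) +_) (countL-tabulate p (g ∘ suc)))

countF≡sum : ∀ {n} (p : Fin n → Bool) → countF p ≡ sum (b2n ∘ p)
countF≡sum p = countL-tabulate p id

countF-cong : ∀ {n} {p q : Fin n → Bool} → (∀ i → p i ≡ q i) → countF p ≡ countF q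
countF-cong {p = p} {q} h =
  trans (countF≡sum p) (trans (sum-cong-≗ (λ i → cong b2n (h i))) (sym (countF≡sum q)))

-- The summation of a list local to sumF has no name of its own; unification recovers it as listSum.
mutual
  listSum : ∀ {n} → (Fin n → ℕ) → List ℕ → ℕ
  listSum = _

  sumF-listSum : ∀ {n} (f : Fin n → ℕ) → sumF f ≡ listSum f (List.map f (fins n))
  sumF-listSum {n} f with List.map f (fins n)
  ... | xs = listSum-refl f xs

  listSum-refl : ∀ {n} (f : Fin n → ℕ) xs → listSum f xs ≡ listSum f xs
  listSum-refl f xs = refl

listSum-tabulate : ∀ {m n} (h : Fin m → ℕ) (f : Fin n → ℕ) {k} (g : Fin k → Fin n) →
  listSum h (List.map f (Vec.toList (tabulate g))) ≡ sum (f ∘ g)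
listSum-tabulate h f {zero} g = refl
listSum-tabulate h f {suc k} g = cong (f (g zero) +_) (listSum-tabulate h f (g ∘ suc))

sumF≡sum : ∀ {n} (f : Fin n → ℕ) → sumF f ≡ sum f
sumF≡sum f = trans (sumF-listSum f) (listSum-tabulate f f id)

allL-tabulate⁻ : ∀ {A : Set} {n} {p : A → Bool} (g : Fin n → A) →
  T (allL p (Vec.toList (tabulate g))) → ∀ i → T (p (g i))
allL-tabulate⁻ g h zero = ∧-elimˡ h
allL-tabulate⁻ g h (suc i) = allL-tabulate⁻ (g ∘ suc) (∧-elimʳ h) i

allL-tabulate⁺ : ∀ {A : Set} {n} {p : A → Bool} (g : Fin n → A) →
  (∀ i → T (p (g i))) → T (allL p (Vec.toList (tabulate g)))
allL-tabulate⁺ {n = zero} g h = tt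
allL-tabulate⁺ {n = suc n} g h = ∧-intro (h zero) (allL-tabulate⁺ (g ∘ suc) (h ∘ suc))

allF⁻ : ∀ {n} {p : Fin n → Bool} → T (allL p (fins n)) → ∀ i → T (p i)
allF⁻ = allL-tabulate⁻ id

allF⁺ : ∀ {n} {p : Fin n → Bool} → (∀ i → T (p i)) → T (allL p (fins n))
allF⁺ = allL-tabulate⁺ id

anyL-tabulate : ∀ {A : Set} {n} (p : A → Bool) (g : Fin n → A) →
  anyL p (Vec.toList (tabulate g)) ≡ anyL (p ∘ g) (fins n)
anyL-tabulate {n = zero} p g = refl
anyL-tabulate {n = suc n} p g =
  cong (p (g zero) ∨_) (trans (anyL-tabulate p (g ∘ suc)) (sym (anyL-tabulate (p ∘ g) suc)))

anyF-suc : ∀ {n} (p : Fin (suc n) → Bool) → anyL p (fins (suc n)) ≡ p zero ∨ anyL (p ∘ suc) (fins n)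
anyF-suc p = cong (p zero ∨_) (anyL-tabulate p suc)

anyL-cong : ∀ {A : Set} {p q : A → Bool} → (∀ x → p x ≡ q x) → ∀ xs → anyL p xs ≡ anyL q xs
anyL-cong h [] = refl
anyL-cong h (x ∷ xs) = cong₂ _∨_ (h x) (anyL-cong h xs)


δ : ∀ {n} → Fin n → Fin n → ℕ
δ x a = b2n ⌊ a ≟F x ⌋

δ₂ : ∀ {n} → Fin n → Fin n → Fin n → Fin n → ℕ
δ₂ x y a b = b2n (⌊ a ≟F x ⌋ ∧ ⌊ b ≟F y ⌋)

sum-zero : ∀ {n} (f : Fin n → ℕ) → (∀ i → f i ≡ 0) → sum f ≡ 0
sum-zero {zero} f h = refl
sum-zero {suc n} f h = cong₂ _+_ (h zero) (sum-zero (f ∘ suc) (h ∘ suc))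

sum-single : ∀ {n} (x : Fin n) (f : Fin n → ℕ) → (∀ i → i ≢ x → f i ≡ 0) → sum f ≡ f x
sum-single zero f h = trans (cong (f zero +_) (sum-zero (f ∘ suc) (λ i → h (suc i) (λ ())))) (+-identityʳ _)
sum-single (suc x) f h =
  cong₂ _+_ (h zero (λ ())) (sum-single x (f ∘ suc) (λ i i≢x → h (suc i) (λ { refl → i≢x refl })))

sum-δ : ∀ {n} (x : Fin n) → sum (δ x) ≡ 1
sum-δ x = trans (sum-single x (δ x) (λ i i≢x → cong b2n (⌊⌋-false i≢x))) (cong b2n (⌊⌋-true refl))

sum₂ : ∀ {n} → (Fin n → Fin n → ℕ) → ℕ
sum₂ f = sum (λ a → sum (f a))

sum₂-cong : ∀ {n} {f g : Fin n → Fin n → ℕ} → (∀ a b → f a b ≡ g a b) → sum₂ f ≡ sum₂ g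
sum₂-cong h = sum-cong-≗ (λ a → sum-cong-≗ (h a))

sum₂-+ : ∀ {n} (f g : Fin n → Fin n → ℕ) → sum₂ (λ a b → f a b + g a b) ≡ sum₂ f + sum₂ g
sum₂-+ f g = trans (sum-cong-≗ (λ a → ∑-distrib-+ (f a) (g a))) (∑-distrib-+ (sum ∘ f) (sum ∘ g))

sum₂-zero : ∀ {n} (f : Fin n → Fin n → ℕ) → (∀ a b → f a b ≡ 0) → sum₂ f ≡ 0
sum₂-zero f h = sum-zero _ (λ a → sum-zero _ (h a))

sum₂-δ₂ : ∀ {n} (x y : Fin n) → sum₂ (δ₂ x y) ≡ 1
sum₂-δ₂ x y = trans
  (sum-single x (λ a → sum (δ₂ x y a)) (λ a a≢x → sum-zero (δ₂ x y a) (λ b → cong (λ t → b2n (t ∧ ⌊ b ≟F y ⌋)) (⌊⌋-false a≢x))))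
  (trans (sum-cong-≗ {_} {δ₂ x y x} {δ y} (λ b → cong (λ t → b2n (t ∧ ⌊ b ≟F y ⌋)) (⌊⌋-true refl))) (sum-δ y))

sum₂-≡0 : ∀ {n} (f : Fin n → Fin n → ℕ) → sum₂ f ≡ 0 → ∀ a b → f a b ≡ 0
sum₂-≡0 f h a b = sum-≡0 (f a) (sum-≡0 (sum ∘ f) h a) b
  where
  sum-≡0 : ∀ {n} (f : Fin n → ℕ) → sum f ≡ 0 → ∀ i → f i ≡ 0
  sum-≡0 f h zero = m+n≡0⇒m≡0 (f zero) h
  sum-≡0 f h (suc i) = sum-≡0 (f ∘ suc) (m+n≡0⇒n≡0 (f zero) h) i

sum-≤ : ∀ {n} (f : Fin n → ℕ) k → (∀ i → f i ≤ k) → sum f ≤ n * k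
sum-≤ {zero} f k h = z≤n
sum-≤ {suc n} f k h = +-mono-≤ (h zero) (sum-≤ (f ∘ suc) k (h ∘ suc))

sumF-countF : ∀ {n} (p : Fin n → Fin n → Bool) → sumF (λ i → countF (p i)) ≡ sum₂ (λ i j → b2n (p i j))
sumF-countF p = trans (sumF≡sum (λ i → countF (p i))) (sum-cong-≗ (λ i → countF≡sum (p i)))

-- Exchanging two neighbouring places

swp : ℕ → ℕ → ℕ
swp zero zero = 1
swp zero (suc zero) = 0
swp zero (suc (suc k)) = suc (suc k)
swp (suc i) zero = zero
swp (suc i) (suc k) = suc (swp i k)

swp-left : ∀ i → swp i i ≡ suc i
swp-left zero = refl
swp-left (suc i) = cong suc (swp-left i)

swp-right : ∀ i → swp i (suc i) ≡ i
swp-right zero = refl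
swp-right (suc i) = cong suc (swp-right i)

swp-other : ∀ i k → k ≢ i → k ≢ suc i → swp i k ≡ k
swp-other zero zero h₀ h₁ = ⊥-elim (h₀ refl)
swp-other zero (suc zero) h₀ h₁ = ⊥-elim (h₁ refl)
swp-other zero (suc (suc k)) h₀ h₁ = refl
swp-other (suc i) zero h₀ h₁ = refl
swp-other (suc i) (suc k) h₀ h₁ = cong suc (swp-other i k (h₀ ∘ cong suc) (h₁ ∘ cong suc))

swp-involutive : ∀ i k → swp i (swp i k) ≡ k
swp-involutive zero zero = refl
swp-involutive zero (suc zero) = refl
swp-involutive zero (suc (suc k)) = refl
swp-involutive (suc i) zero = refl
swp-involutive (suc i) (suc k) = cong suc (swp-involutive i k)

swp-injective : ∀ i {x y} → swp i x ≡ swp i y → x ≡ y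
swp-injective i {x} {y} e = trans (sym (swp-involutive i x)) (trans (cong (swp i) e) (swp-involutive i y))

swp-< : ∀ {n} i k → suc i < n → k < n → swp i k < n
swp-< zero zero h h′ = h
swp-< zero (suc zero) h h′ = <-trans (s≤s z≤n) h
swp-< zero (suc (suc k)) h h′ = h′
swp-< (suc i) zero h h′ = h′
swp-< {suc n} (suc i) (suc k) (s≤s h) (s≤s h′) = s≤s (swp-< i k h h′)

-- With the place `i` left out, `swp i` only moves `suc i` down into the gap, so it is monotone on
-- what remains.
swp-<ᵇ-avoidˡ : ∀ i x y → x ≢ i → y ≢ i → (swp i x <ᵇ swp i y) ≡ (x <ᵇ y)
swp-<ᵇ-avoidˡ zero zero y hx hy = ⊥-elim (hx refl)
swp-<ᵇ-avoidˡ zero (suc x) zero hx hy = ⊥-elim (hy refl)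
swp-<ᵇ-avoidˡ zero (suc zero) (suc zero) hx hy = refl
swp-<ᵇ-avoidˡ zero (suc zero) (suc (suc y)) hx hy = refl
swp-<ᵇ-avoidˡ zero (suc (suc x)) (suc zero) hx hy = refl
swp-<ᵇ-avoidˡ zero (suc (suc x)) (suc (suc y)) hx hy = refl
swp-<ᵇ-avoidˡ (suc i) zero zero hx hy = refl
swp-<ᵇ-avoidˡ (suc i) zero (suc y) hx hy = refl
swp-<ᵇ-avoidˡ (suc i) (suc x) zero hx hy = refl
swp-<ᵇ-avoidˡ (suc i) (suc x) (suc y) hx hy = swp-<ᵇ-avoidˡ i x y (hx ∘ cong suc) (hy ∘ cong suc)

swp-<ᵇ-avoidʳ : ∀ i x y → x ≢ suc i → y ≢ suc i → (swp i x <ᵇ swp i y) ≡ (x <ᵇ y)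
swp-<ᵇ-avoidʳ zero zero zero hx hy = refl
swp-<ᵇ-avoidʳ zero zero (suc zero) hx hy = ⊥-elim (hy refl)
swp-<ᵇ-avoidʳ zero zero (suc (suc y)) hx hy = refl
swp-<ᵇ-avoidʳ zero (suc zero) y hx hy = ⊥-elim (hx refl)
swp-<ᵇ-avoidʳ zero (suc (suc x)) zero hx hy = refl
swp-<ᵇ-avoidʳ zero (suc (suc x)) (suc zero) hx hy = ⊥-elim (hy refl)
swp-<ᵇ-avoidʳ zero (suc (suc x)) (suc (suc y)) hx hy = refl
swp-<ᵇ-avoidʳ (suc i) zero zero hx hy = refl
swp-<ᵇ-avoidʳ (suc i) zero (suc y) hx hy = refl
swp-<ᵇ-avoidʳ (suc i) (suc x) zero hx hy = refl
swp-<ᵇ-avoidʳ (suc i) (suc x) (suc y) hx hy = swp-<ᵇ-avoidʳ i x y (hx ∘ cong suc) (hy ∘ cong suc)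

-- The test against `x` tells `i` and `suc i` apart only when `x` is `i` itself.
swp-<ᵇ-fix : ∀ i x y → x ≢ i → (x <ᵇ swp i y) ≡ (x <ᵇ y)
swp-<ᵇ-fix zero zero y hx = ⊥-elim (hx refl)
swp-<ᵇ-fix zero (suc x) zero hx = refl
swp-<ᵇ-fix zero (suc x) (suc zero) hx = refl
swp-<ᵇ-fix zero (suc x) (suc (suc y)) hx = refl
swp-<ᵇ-fix (suc i) x zero hx = refl
swp-<ᵇ-fix (suc i) zero (suc y) hx = refl
swp-<ᵇ-fix (suc i) (suc x) (suc y) hx = swp-<ᵇ-fix i x y (hx ∘ cong suc)

swp-<ᵇ : ∀ i x y → ¬ (x ≡ i × y ≡ suc i) → ¬ (x ≡ suc i × y ≡ i) → (swp i x <ᵇ swp i y) ≡ (x <ᵇ y)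
swp-<ᵇ i x y h₁ h₂ with x ≟ i | y ≟ i
... | yes refl | yes refl = trans (<ᵇ-false {swp i i} ≤-refl) (sym (<ᵇ-false {i} ≤-refl))
... | yes refl | no y≢i = swp-<ᵇ-avoidʳ i x y (λ e → 1+n≢n (sym e)) (λ e → h₁ (refl , e))
... | no x≢i | yes refl = swp-<ᵇ-avoidʳ i x y (λ e → h₂ (e , refl)) (λ e → 1+n≢n (sym e))
... | no x≢i | no y≢i = swp-<ᵇ-avoidˡ i x y x≢i y≢i

-- Here `e` will be the place of a dead strip: it is one of the two exchanged places, and leaving
-- out either one makes the exchange monotone.
swp-<ᵇ-avoid : ∀ i e x y → e ≡ i ⊎ e ≡ suc i → x ≢ e → y ≢ e → (swp i x <ᵇ swp i y) ≡ (x <ᵇ y)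
swp-<ᵇ-avoid i e x y (inj₁ refl) = swp-<ᵇ-avoidˡ i x y
swp-<ᵇ-avoid i e x y (inj₂ refl) = swp-<ᵇ-avoidʳ i x y

<-via-<ᵇ : ∀ {x y x′ y′} → (x <ᵇ y) ≡ (x′ <ᵇ y′) → x < y → x′ < y′
<-via-<ᵇ {x} {y} {x′} {y′} e h = <ᵇ⇒< x′ y′ (subst T e (<⇒<ᵇ h))

-- Bijections onto places

record Bij {n} (f : Fin n → ℕ) : Set where
  field
    bound : ∀ a → f a < n
    inj   : ∀ {a b} → f a ≡ f b → a ≡ b
    surj  : ∀ {x} → x < n → ∃ λ a → f a ≡ x

toℕ-Bij : ∀ {n} → Bij (toℕ {n})
toℕ-Bij = record { bound = toℕ<n ; inj = toℕ-injective ; surj = λ h → fromℕ< h , toℕ-fromℕ< h }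

swp-Bij : ∀ {n} {f g : Fin n → ℕ} i → suc i < n → (∀ a → g a ≡ swp i (f a)) → Bij f → Bij g
swp-Bij {n} {f} {g} i i<n h bf = record
  { bound = λ a → subst (_< n) (sym (h a)) (swp-< i (f a) i<n (bound a))
  ; inj   = λ {a} {b} e → inj (swp-injective i (trans (sym (h a)) (trans e (h b))))
  ; surj  = λ {x} x<n → let (a , e) = surj (swp-< i x i<n x<n) in
              a , trans (h a) (trans (cong (swp i) e) (swp-involutive i x))
  }
  where open Bij bf

-- As many labels cross the threshold t upwards as downwards.
threshold : ∀ {n} {f g : Fin n → ℕ} → Bij f → Bij g → ∀ t a → t ≤ f a → g a < t →
  ∃ λ b → f b < t × t ≤ g b
threshold {n} {f} {g} bf bg t a t≤fa ga<t with any? (λ b → (f b <? t) ×-dec (t ≤? g b))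
... | yes w = w
-- Otherwise `a` and the `t` labels that `f` puts below `t` would be `t + 1` labels that `g` all
-- puts below `t`.
... | no ¬w = ⊥-elim (clash (pigeonhole (n<1+n t) (λ x → fromℕ< (h<t x))))
  where
  open Bij
  pre : (x : Fin t) → ∃ λ b → f b ≡ toℕ x
  pre x = surj bf (<-trans (<-≤-trans (toℕ<n x) t≤fa) (bound bf a))
  label : Fin (suc t) → Fin n
  label zero = a
  label (suc x) = proj₁ (pre x)
  h<t : ∀ x → g (label x) < t
  h<t zero = ga<t
  h<t (suc x) = ≰⇒> (λ t≤g → ¬w (proj₁ (pre x) , subst (_< t) (sym (proj₂ (pre x))) (toℕ<n x) , t≤g))
  label-inj : ∀ x y → x Fin.< y → label x ≢ label y
  label-inj zero (suc y) _ e = <⇒≱ (toℕ<n y) (subst (t ≤_) (trans (cong f e) (proj₂ (pre y))) t≤fa)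
  label-inj (suc x) (suc y) (s≤s x<y) e =
    <⇒≢ x<y (trans (sym (proj₂ (pre x))) (trans (cong f e) (proj₂ (pre y))))
  clash : ¬ (∃ λ x → ∃ λ y → x Fin.< y × fromℕ< (h<t x) ≡ fromℕ< (h<t y))
  clash (x , y , x<y , e) = label-inj x y x<y (inj bg (fromℕ<-injective _ _ (h<t x) (h<t y) e))

kill : ∀ {n} → Fin n → (Fin n → Bool) → Fin n → Bool
kill x live a = not ⌊ a ≟F x ⌋ ∧ live a

kill-self : ∀ {n} (x : Fin n) live → kill x live x ≡ false
kill-self x live = cong (λ t → not t ∧ live x) (⌊⌋-true refl)

kill-other : ∀ {n} (x : Fin n) live {a} → a ≢ x → kill x live a ≡ live a
kill-other x live {a} a≢x = cong (λ t → not t ∧ live a) (⌊⌋-false a≢x)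

kill-live : ∀ {n} (x : Fin n) live {a} → kill x live a ≡ true → a ≢ x × live a ≡ true
kill-live x live {a} h with a ≟F x
... | no a≢x = a≢x , h

kill-mono : ∀ {n} (x : Fin n) live {a} → live a ≡ false → kill x live a ≡ false
kill-mono x live {a} h = ∧-falseʳ (not ⌊ a ≟F x ⌋) h

l2≢l1 : ∀ {l} {A : Set} → l ≡ l2 → l ≡ l1 → A
l2≢l1 refl ()

l2≢l0 : ∀ {l} {A : Set} → l ≡ l2 → l ≡ l0 → A
l2≢l0 refl ()

l1≢l0 : ∀ {l} {A : Set} → l ≡ l1 → l ≡ l0 → A
l1≢l0 refl ()

-- Border paths, permutation states and the exchange of two strips

module _ {m : ℕ} (L : Fin (suc m) → Letter) where

  private
    N : ℕ
    N = suc m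

  -- `before` reflects that strip zero starts in front and, being diagonal, can only be overtaken by
  -- columns. `oneLive` holds because arrows point along rows and columns, never along diagonal
  -- strips.
  record Path (src : Fin N → ℕ) (live : Fin N → Bool) : Set where
    field
      bij     : Bij src
      first   : L zero ≡ l1
      before  : ∀ {k} → src k < src zero → L k ≡ l0
      oneLive : ∀ {a} → L a ≡ l1 → live a ≡ true

  -- src a is the current place of the strip a on the border and val a the place of its image;
  -- strips that have been pointed along are dead and sit on fixed points.
  record Vals (src val : Fin N → ℕ) (live : Fin N → Bool) : Set where
    field
      bij    : Bij val
      dead   : ∀ {a} → live a ≡ false → val a ≡ src a
      two    : ∀ {a} → L a ≡ l2 → src a ≤ val a
      zeros  : ∀ {a} → L a ≡ l0 → live a ≡ true → val a < src a
      oneInc : ∀ {a b} → L a ≡ l1 → L b ≡ l1 → src a < src b → val a < val b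

  oneLive-kill : ∀ {src live p} → L p ≡ l2 → Path src live → ∀ {a} → L a ≡ l1 → kill p live a ≡ true
  oneLive-kill {live = live} {p} ep P ea = trans (kill-other p live (λ { refl → l2≢l1 ep ea })) (Path.oneLive P ea)

  record Adj (src : Fin N → ℕ) (p q : Fin N) : Set where
    field
      next : src q ≡ suc (src p)
      desc : lval (L q) < lval (L p)

  data Descent (p q : Fin N) : Set where
    d20 : L p ≡ l2 → L q ≡ l0 → Descent p q
    d21 : L p ≡ l2 → L q ≡ l1 → Descent p q
    d10 : L p ≡ l1 → L q ≡ l0 → Descent p q

  descent : ∀ {p q} → lval (L q) < lval (L p) → Descent p q
  descent {p} {q} h with L p in ep | L q in eq
  ... | l2 | l0 = d20 ep eq
  ... | l2 | l1 = d21 ep eq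
  ... | l1 | l0 = d10 ep eq
  ... | l2 | l2 = ⊥-elim (<-irrefl refl h)
  ... | l1 | l1 = ⊥-elim (<-irrefl refl h)
  ... | l1 | l2 = ⊥-elim (<-asym h (n<1+n 1))
  descent () | l0 | _

  avoid-src : ∀ {src : Fin N → ℕ} {live : Fin N → Bool} {a x} → Bij src → live x ≡ false → live a ≡ true → src a ≢ src x
  avoid-src bs xd l e with Bij.inj bs e
  ... | refl = true≢false l xd

  avoid-val : ∀ {src val live a x} → Vals src val live → live x ≡ false → live a ≡ true → val a ≢ src x
  avoid-val V xd l e with Bij.inj (Vals.bij V) (trans e (sym (Vals.dead V xd)))
  ... | refl = true≢false l xd

  -- The dead strip `x` is a fixed point, so by injectivity live strips avoid its place both as
  -- source and as value. Away from that place `swp i` is monotone, so all strict inequalities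
  -- between live data survive; fixed points stay fixed points.
  conj-Vals : ∀ {src src′ val val′ live} i → suc i < N →
    (∀ a → src′ a ≡ swp i (src a)) → (∀ a → val′ a ≡ swp i (val a)) →
    Bij src → (∀ {a} → L a ≡ l1 → live a ≡ true) →
    ∀ x → live x ≡ false → src x ≡ i ⊎ src x ≡ suc i → Vals src val live → Vals src′ val′ live
  conj-Vals {src} {src′} {val} {val′} {live} i i<N hs hv bs ol x xd xi V = record
    { bij = swp-Bij i i<N hv V.bij
    ; dead = λ {a} d → trans (hv a) (trans (cong (swp i) (V.dead d)) (sym (hs a)))
    ; two = λ {a} e → two′ a (V.two e)
    ; zeros = λ {a} e l → subst₂ _<_ (sym (hv a)) (sym (hs a)) (mono (avoidV l) (avoidS l) (V.zeros e l))
    ; oneInc = λ {a} {b} ea eb h → subst₂ _<_ (sym (hv a)) (sym (hv b)) (mono (avoidV (ol ea)) (avoidV (ol eb))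
        (V.oneInc ea eb (<-via-<ᵇ (trans (cong₂ _<ᵇ_ (hs a) (hs b))
           (swp-<ᵇ-avoid i (src x) (src a) (src b) xi (avoidS (ol ea)) (avoidS (ol eb)))) h)))
    }
    where
    module V = Vals V
    avoidS : ∀ {a} → live a ≡ true → src a ≢ src x
    avoidS = avoid-src {live = live} bs xd
    avoidV : ∀ {a} → live a ≡ true → val a ≢ src x
    avoidV = avoid-val V xd
    mono : ∀ {y z} → y ≢ src x → z ≢ src x → y < z → swp i y < swp i z
    mono {y} {z} ha hb = <-via-<ᵇ (sym (swp-<ᵇ-avoid i (src x) y z xi ha hb))
    two′ : ∀ a → src a ≤ val a → src′ a ≤ val′ a
    two′ a h with live a in l
    ... | false = ≤-reflexive (trans (hs a) (trans (cong (swp i) (sym (V.dead l))) (sym (hv a))))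
    ... | true with m≤n⇒m<n∨m≡n h
    ...   | inj₁ lt = <⇒≤ (subst₂ _<_ (sym (hs a)) (sym (hv a)) (mono (avoidS l) (avoidV l) lt))
    ...   | inj₂ eq = ≤-reflexive (trans (hs a) (trans (cong (swp i) eq) (sym (hv a))))

  kill-Vals : ∀ {src val live p} → L p ≡ l2 → val p ≡ src p → Vals src val live → Vals src val (kill p live)
  kill-Vals {src} {val} {live} {p} ep e V = record
    { bij = V.bij ; dead = dead′ ; two = V.two
    ; zeros = λ ea l → V.zeros ea (proj₂ (kill-live p live l)) ; oneInc = V.oneInc }
    where
    module V = Vals V
    dead′ : ∀ {a} → kill p live a ≡ false → val a ≡ src a
    dead′ {a} h with a ≟F p
    ... | yes refl = e
    ... | no _ = V.dead h

  unkill-Vals : ∀ {src val live p} → L p ≡ l2 → Vals src val (kill p live) → Vals src val live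
  unkill-Vals {src} {val} {live} {p} ep V = record
    { bij = V.bij ; dead = λ h → V.dead (kill-mono p live h) ; two = V.two
    ; zeros = λ ea l → V.zeros ea (trans (kill-other p live (λ { refl → l2≢l0 ep ea })) l) ; oneInc = V.oneInc }
    where module V = Vals V

  module Swap {src : Fin N → ℕ} {p q : Fin N} (bs : Bij src) (adj : Adj src p q) where
    open Adj adj public
    open Bij bs

    i : ℕ
    i = src p

    src′ : Fin N → ℕ
    src′ = swp i ∘ src

    desc-view : Descent p q
    desc-view = descent desc

    i<N : suc i < N
    i<N = subst (_< N) next (bound q)

    p≢q : p ≢ q
    p≢q e = 1+n≢n (trans (sym next) (cong src (sym e)))

    Lq≢2 : L q ≢ l2
    Lq≢2 e with descent desc
    ... | d20 _ e′ = l2≢l0 e e′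
    ... | d21 _ e′ = l2≢l1 e e′
    ... | d10 _ e′ = l2≢l0 e e′

    Lp≢0 : L p ≢ l0
    Lp≢0 e with descent desc
    ... | d20 e′ _ = l2≢l0 e′ e
    ... | d21 e′ _ = l2≢l0 e′ e
    ... | d10 e′ _ = l1≢l0 e′ e

    src′-p : src′ p ≡ suc i
    src′-p = swp-left i

    src′-q : src′ q ≡ i
    src′-q = trans (cong (swp i) next) (swp-right i)

    src-q≡ : ∀ {a} → src a ≡ suc i → a ≡ q
    src-q≡ e = inj (trans e (sym next))

    src′-o : ∀ {a} → a ≢ p → a ≢ q → src′ a ≡ src a
    src′-o {a} a≢p a≢q = swp-other i (src a) (λ e → a≢p (inj e)) (λ e → a≢q (src-q≡ e))

    src′-<ᵇ : ∀ a b → ¬ (a ≡ p × b ≡ q) → ¬ (a ≡ q × b ≡ p) → (src′ a <ᵇ src′ b) ≡ (src a <ᵇ src b)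
    src′-<ᵇ a b h₁ h₂ = swp-<ᵇ i (src a) (src b)
      (λ { (e , e′) → h₁ (inj e , src-q≡ e′) }) (λ { (e , e′) → h₂ (src-q≡ e , inj e′) })

    bij′ : Bij src′
    bij′ = swp-Bij i i<N (λ _ → refl) bs

    path : ∀ {live live′} → (∀ {a} → L a ≡ l1 → live a ≡ true → live′ a ≡ true) →
      Path src live → Path src′ live′
    path h P = record
      { bij = bij′ ; first = first ; before = λ {k} → before′ k
      ; oneLive = λ e → h e (oneLive e) }
      where
      open Path P hiding (bij)
      before′ : ∀ k → src′ k < src′ zero → L k ≡ l0
      -- A strip can newly get in front of strip zero only as `q` with `p` equal to zero, and below
      -- the letter of a diagonal strip there are only columns.
      before′ k lt with k ≟F q | zero ≟F p
      ... | yes refl | yes refl with descent desc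
      ...   | d20 _ e = e
      ...   | d21 e _ = l2≢l1 e first
      ...   | d10 _ e = e
      before′ k lt | no k≢q | _ with k ≟F p | zero ≟F q
      ... | yes refl | yes refl = ⊥-elim (<-asym (subst₂ _<_ src′-p src′-q lt) (n<1+n i))
      ... | no k≢p | _ = before (<-via-<ᵇ (src′-<ᵇ k zero (k≢p ∘ proj₁) (k≢q ∘ proj₁)) lt)
      ... | yes _ | no z≢q = before (<-via-<ᵇ (src′-<ᵇ k zero (z≢q ∘ proj₂) (k≢q ∘ proj₁)) lt)
      before′ k lt | yes refl | no z≢p =
        before (<-via-<ᵇ (src′-<ᵇ k zero (λ { (e , _) → p≢q (sym e) }) (z≢p ∘ proj₂)) lt)

    not-pq : ∀ {a b} → L a ≡ l1 → L b ≡ l1 → ¬ (a ≡ p × b ≡ q)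
    not-pq ea eb (refl , refl) with descent desc
    ... | d20 e _ = l2≢l1 e ea
    ... | d21 e _ = l2≢l1 e ea
    ... | d10 _ e = l1≢l0 eb e

    oneInc⇒ : ∀ {val : Fin N → ℕ} → (∀ {a b} → L a ≡ l1 → L b ≡ l1 → src a < src b → val a < val b) →
      ∀ {a b} → L a ≡ l1 → L b ≡ l1 → src′ a < src′ b → val a < val b
    oneInc⇒ h {a} {b} ea eb lt = h ea eb (<-via-<ᵇ (src′-<ᵇ a b (not-pq ea eb) (λ { (x , y) → not-pq eb ea (y , x) })) lt)

    oneInc⇐ : ∀ {val : Fin N → ℕ} → (∀ {a b} → L a ≡ l1 → L b ≡ l1 → src′ a < src′ b → val a < val b) →
      ∀ {a b} → L a ≡ l1 → L b ≡ l1 → src a < src b → val a < val b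
    oneInc⇐ h {a} {b} ea eb lt = h ea eb (<-via-<ᵇ (sym (src′-<ᵇ a b (not-pq ea eb) (λ { (x , y) → not-pq eb ea (y , x) }))) lt)

    -- The exchange raises the source of `p` to `suc i` and lowers that of `q` to `i`. The weak
    -- inequality of a row `p` is lost only if its value is `i`, and the strict inequality of a
    -- column `q`, whose value is at most `i`, likewise.
    free-Vals⇒ : ∀ {val live} → live p ≡ true → live q ≡ true →
      (L p ≡ l2 → val p ≢ i) → (L q ≡ l0 → val q ≢ i) → Vals src val live → Vals src′ val live
    free-Vals⇒ {val} {live} lp lq hp hq V = record
      { bij = V.bij
      ; dead = λ d → trans (V.dead d) (sym (src′-o (λ { refl → true≢false lp d }) (λ { refl → true≢false lq d })))
      ; two = λ {a} → two′ a ; zeros = λ {a} → zeros′ a ; oneInc = oneInc⇒ V.oneInc }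
      where
      module V = Vals V
      two′ : ∀ a → L a ≡ l2 → src′ a ≤ val a
      two′ a e with a ≟F p | a ≟F q
      ... | yes refl | _ = subst (_≤ val p) (sym src′-p) (≤∧≢⇒< (V.two e) (λ x → hp e (sym x)))
      ... | no _ | yes refl = ⊥-elim (Lq≢2 e)
      ... | no a≢p | no a≢q = subst (_≤ val a) (sym (src′-o a≢p a≢q)) (V.two e)
      zeros′ : ∀ a → L a ≡ l0 → live a ≡ true → val a < src′ a
      zeros′ a e l with a ≟F p | a ≟F q
      ... | yes refl | _ = ⊥-elim (Lp≢0 e)
      ... | no _ | yes refl = subst (val q <_) (sym src′-q)
              (≤∧≢⇒< (m<1+n⇒m≤n (subst (val q <_) next (V.zeros e l))) (hq e))
      ... | no a≢p | no a≢q = subst (val a <_) (sym (src′-o a≢p a≢q)) (V.zeros e l)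

    two⇐ : ∀ {val live} → Vals src′ val live → ∀ a → L a ≡ l2 → src a ≤ val a
    two⇐ {val} V a e with a ≟F p | a ≟F q
    ... | yes refl | _ = <⇒≤ (subst (_≤ val p) src′-p (Vals.two V e))
    ... | no _ | yes refl = ⊥-elim (Lq≢2 e)
    ... | no a≢p | no a≢q = subst (_≤ val a) (src′-o a≢p a≢q) (Vals.two V e)

    free-Vals⇐ : ∀ {val live} → live p ≡ true → live q ≡ true → Vals src′ val live → Vals src val live
    free-Vals⇐ {val} {live} lp lq V = record
      { bij = V.bij
      ; dead = λ d → trans (V.dead d) (src′-o (λ { refl → true≢false lp d }) (λ { refl → true≢false lq d }))
      ; two = λ {a} → two⇐ V a ; zeros = λ {a} → zeros′ a ; oneInc = oneInc⇐ V.oneInc }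
      where
      module V = Vals V
      zeros′ : ∀ a → L a ≡ l0 → live a ≡ true → val a < src a
      zeros′ a e l with a ≟F p | a ≟F q
      ... | yes refl | _ = ⊥-elim (Lp≢0 e)
      ... | no _ | yes refl = subst (val q <_) (sym next) (m<n⇒m<1+n (subst (val q <_) src′-q (V.zeros e l)))
      ... | no a≢p | no a≢q = subst (val a <_) (src′-o a≢p a≢q) (V.zeros e l)

    free-p : ∀ {val live} → L p ≡ l2 → Vals src′ val live → val p ≢ i
    free-p e V e′ = <-irrefl (sym e′) (subst (_≤ _) src′-p (Vals.two V e))

    free-q : ∀ {val live} → live q ≡ true → L q ≡ l0 → Vals src′ val live → val q ≢ i
    free-q l e V e′ = <-irrefl e′ (subst (_ <_) src′-q (Vals.zeros V e l))

    -- The value `i` of `q` is exactly its place after the exchange, so `q` becomes a fixed point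
    -- and may die. A row `p` is safe because `q` already takes the value `i`.
    up-Vals⇒ : ∀ {val live} → live p ≡ true → live q ≡ true → L q ≡ l0 → val q ≡ i →
      Vals src val live → Vals src′ val (kill q live)
    up-Vals⇒ {val} {live} lp lq eq eqi V = record
      { bij = V.bij ; dead = λ {a} → dead′ a ; two = λ {a} → two′ a
      ; zeros = λ {a} → zeros′ a ; oneInc = oneInc⇒ V.oneInc }
      where
      module V = Vals V
      dead′ : ∀ a → kill q live a ≡ false → val a ≡ src′ a
      dead′ a d with a ≟F q
      ... | yes refl = trans eqi (sym src′-q)
      ... | no a≢q = trans (V.dead d) (sym (src′-o (λ { refl → true≢false lp d }) a≢q))
      two′ : ∀ a → L a ≡ l2 → src′ a ≤ val a
      two′ a e with a ≟F p | a ≟F q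
      ... | yes refl | _ = subst (_≤ val p) (sym src′-p)
              (≤∧≢⇒< (V.two e) (λ x → p≢q (Bij.inj V.bij (trans (sym x) (sym eqi)))))
      ... | no _ | yes refl = ⊥-elim (Lq≢2 e)
      ... | no a≢p | no a≢q = subst (_≤ val a) (sym (src′-o a≢p a≢q)) (V.two e)
      zeros′ : ∀ a → L a ≡ l0 → kill q live a ≡ true → val a < src′ a
      zeros′ a e l with kill-live q live l
      ... | a≢q , la = subst (val a <_) (sym (src′-o (λ { refl → Lp≢0 e }) a≢q)) (V.zeros e la)

    up-q : ∀ {val live} → Vals src′ val (kill q live) → val q ≡ i
    up-q {live = live} V = trans (Vals.dead V (kill-self q live)) src′-q

    up-Vals⇐ : ∀ {val live} → live p ≡ true → live q ≡ true → Vals src′ val (kill q live) → Vals src val live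
    up-Vals⇐ {val} {live} lp lq V = record
      { bij = V.bij
      ; dead = λ d → trans (V.dead (kill-mono q live d))
                      (src′-o (λ { refl → true≢false lp d }) (λ { refl → true≢false lq d }))
      ; two = λ {a} → two⇐ V a ; zeros = λ {a} → zeros′ a ; oneInc = oneInc⇐ V.oneInc }
      where
      module V = Vals V
      zeros′ : ∀ a → L a ≡ l0 → live a ≡ true → val a < src a
      zeros′ a e l with a ≟F p | a ≟F q
      ... | yes refl | _ = ⊥-elim (Lp≢0 e)
      ... | no _ | yes refl = subst₂ _<_ (sym (up-q V)) (sym next) (n<1+n i)
      ... | no a≢p | no a≢q = subst (val a <_) (src′-o a≢p a≢q) (V.zeros e (trans (kill-other q live a≢q) l))

-- The statistics of a state

δ₂-hit : ∀ {n} (x y : Fin n) → δ₂ x y x y ≡ 1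
δ₂-hit x y = cong b2n (cong₂ _∧_ (⌊⌋-true {d = x ≟F x} refl) (⌊⌋-true {d = y ≟F y} refl))

δ₂-miss : ∀ {n} {x y a b : Fin n} → ¬ (a ≡ x × b ≡ y) → δ₂ x y a b ≡ 0
δ₂-miss {x = x} {y} {a} {b} h with a ≟F x | b ≟F y
... | yes e | yes e′ = ⊥-elim (h (e , e′))
... | yes e | no _ = refl
... | no _ | _ = refl

∧-gate : ∀ x {y y′} → (x ≡ true → y ≡ y′) → x ∧ y ≡ x ∧ y′
∧-gate true h = h refl
∧-gate false h = refl

not-∧-false : ∀ x → not x ∧ x ≡ false
not-∧-false true = refl
not-∧-false false = refl

isL0⇒ : ∀ {l} → isL0 l ≡ true → l ≡ l0
isL0⇒ {l0} _ = refl

isL1⇒ : ∀ {l} → isL1 l ≡ true → l ≡ l1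
isL1⇒ {l1} _ = refl

isL2⇒ : ∀ {l} → isL2 l ≡ true → l ≡ l2
isL2⇒ {l2} _ = refl

allL-cong : ∀ {A : Set} {p q : A → Bool} → (∀ x → p x ≡ q x) → ∀ xs → allL p xs ≡ allL q xs
allL-cong h [] = refl
allL-cong h (x ∷ xs) = cong₂ _∧_ (h x) (allL-cong h xs)

-- Whether the arcs of two strips with letters la and lb cross, from the truth values of
-- src a < src b, val a < src b, val a < val b and val b < src a.  The left arc's letter matters only
-- through its sign, because l0 means val a < src a and l2 means src a ≤ val a.
crB : Letter → Letter → Bool → Bool → Bool → Bool → Bool
crB la l2 ss vs vv ws = (isL1 la ∨ ss) ∧ (not vs ∧ vv)
crB la l0 ss vs vv ws = (isL1 la ∨ vv) ∧ (ws ∧ ss)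
crB la l1 ss vs vv ws = false

module _ {m : ℕ} (L : Fin (suc m) → Letter) where

  private
    N : ℕ
    N = suc m

  crS : (src val : Fin N → ℕ) → Fin N → Fin N → Bool
  crS src val a b = crB (L a) (L b) (src a <ᵇ src b) (val a <ᵇ src b) (val a <ᵇ val b) (val b <ᵇ src a)

  CR : (src val : Fin N → ℕ) (live : Fin N → Bool) → Fin N → Fin N → Bool
  CR src val live a b = live a ∧ (live b ∧ crS src val a b)

  lrBody rlBody : (src val : Fin N → ℕ) (live : Fin N → Bool) → Fin N → Fin N → Bool
  lrBody src val live a k = not (live k ∧ ((src k <ᵇ src a) ∨ isL1 (L k))) ∨ (val k <ᵇ val a)
  rlBody src val live a k = not (live k ∧ ((src a <ᵇ src k) ∨ isL1 (L k))) ∨ (val a <ᵇ val k)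

  -- The letter is imposed here although the statistics on signed permutations do not mention it;
  -- `LRmax-stat` and `RLmin-stat` show that they force it.
  LR RL : (src val : Fin N → ℕ) (live : Fin N → Bool) → Fin N → Bool
  LR src val live a = isL2 (L a) ∧ (live a ∧ allL (lrBody src val live a) (fins N))
  RL src val live a = isL0 (L a) ∧ (live a ∧ allL (rlBody src val live a) (fins N))

  crossings : (src val : Fin N → ℕ) (live : Fin N → Bool) → ℕ
  crossings src val live = sum₂ (λ a b → b2n (CR src val live a b))

  crS-eval : ∀ src val a b {la lb x y z w} → L a ≡ la → L b ≡ lb →
    (src a <ᵇ src b) ≡ x → (val a <ᵇ src b) ≡ y → (val a <ᵇ val b) ≡ z → (val b <ᵇ src a) ≡ w →
    crS src val a b ≡ crB la lb x y z w
  crS-eval src val a b refl refl refl refl refl refl = refl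

  CR-live : ∀ {src val live a b} → live a ≡ true → live b ≡ true → CR src val live a b ≡ crS src val a b
  CR-live {src} {val} {live} {a} {b} ha hb = cong₂ (λ x y → x ∧ (y ∧ crS src val a b)) ha hb

  CR-false : ∀ src val live a b → (live a ≡ true → live b ≡ true → crS src val a b ≡ false) →
    CR src val live a b ≡ false
  CR-false src val live a b h with live a in ea | live b in eb
  ... | true | true = h refl refl
  ... | true | false = refl
  ... | false | _ = refl

  module Conj {src src′ val val′ : Fin N → ℕ} {live : Fin N → Bool} (i : ℕ)
    (hs : ∀ a → src′ a ≡ swp i (src a)) (hv : ∀ a → val′ a ≡ swp i (val a))
    (bs : Bij src) (x : Fin N) (xd : live x ≡ false) (xi : src x ≡ i ⊎ src x ≡ suc i)
    (V : Vals L src val live) where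

    ord : ∀ {y z y′ z′} → y ≢ src x → z ≢ src x → y′ ≡ swp i y → z′ ≡ swp i z → (y <ᵇ z) ≡ (y′ <ᵇ z′)
    ord {y} {z} hy hz refl refl = sym (swp-<ᵇ-avoid i (src x) y z xi hy hz)

    aS : ∀ {a} → live a ≡ true → src a ≢ src x
    aS = avoid-src L {live = live} bs xd
    aV : ∀ {a} → live a ≡ true → val a ≢ src x
    aV = avoid-val L V xd

    -- All four comparisons behind a crossing are between places of live strips, and these avoid the
    -- place of `x`.
    conj-CR : ∀ a b → CR src val live a b ≡ CR src′ val′ live a b
    conj-CR a b = ∧-gate (live a) λ la → ∧-gate (live b) λ lb →
      crS-eval src val a b refl refl (ord (aS la) (aS lb) (hs a) (hs b)) (ord (aV la) (aS lb) (hv a) (hs b))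
        (ord (aV la) (aV lb) (hv a) (hv b)) (ord (aV lb) (aS la) (hv b) (hs a))

    conj-LR : ∀ a → LR src val live a ≡ LR src′ val′ live a
    conj-LR a = ∧-gate (isL2 (L a)) λ _ → ∧-gate (live a) λ la → allL-cong (λ k → body la k) (fins N)
      where
      body : live a ≡ true → ∀ k → lrBody src val live a k ≡ lrBody src′ val′ live a k
      body la k with live k in lk
      ... | false = refl
      ... | true = cong₂ (λ u v → not (u ∨ isL1 (L k)) ∨ v)
                     (ord (aS lk) (aS la) (hs k) (hs a)) (ord (aV lk) (aV la) (hv k) (hv a))

    conj-RL : ∀ a → RL src val live a ≡ RL src′ val′ live a
    conj-RL a = ∧-gate (isL0 (L a)) λ _ → ∧-gate (live a) λ la → allL-cong (λ k → body la k) (fins N)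
      where
      body : live a ≡ true → ∀ k → rlBody src val live a k ≡ rlBody src′ val′ live a k
      body la k with live k in lk
      ... | false = refl
      ... | true = cong₂ (λ u v → not (u ∨ isL1 (L k)) ∨ v)
                     (ord (aS la) (aS lk) (hs a) (hs k)) (ord (aV la) (aV lk) (hv a) (hv k))

  lrBody-intro : ∀ src val live a k →
    (live k ≡ true → src k < src a ⊎ L k ≡ l1 → val k < val a) → lrBody src val live a k ≡ true
  lrBody-intro src val live a k h with live k | src k <ᵇ src a in es | L k
  ... | false | _ | _ = refl
  ... | true | true | _ = <ᵇ-true (h refl (inj₁ (<ᵇ⇒< _ _ (≡true⇒T es))))
  ... | true | false | l1 = <ᵇ-true (h refl (inj₂ refl))
  ... | true | false | l0 = refl
  ... | true | false | l2 = refl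

  lrBody-elim : ∀ src val live a k → T (lrBody src val live a k) →
    live k ≡ true → src k < src a ⊎ L k ≡ l1 → val k < val a
  lrBody-elim src val live a k t lk (inj₁ lt) rewrite lk | <ᵇ-true lt = <ᵇ⇒< _ _ t
  lrBody-elim src val live a k t lk (inj₂ e) rewrite lk | e | ∨-zeroʳ (src k <ᵇ src a) = <ᵇ⇒< _ _ t

  rlBody-intro : ∀ src val live a k →
    (live k ≡ true → src a < src k ⊎ L k ≡ l1 → val a < val k) → rlBody src val live a k ≡ true
  rlBody-intro src val live a k h with live k | src a <ᵇ src k in es | L k
  ... | false | _ | _ = refl
  ... | true | true | _ = <ᵇ-true (h refl (inj₁ (<ᵇ⇒< _ _ (≡true⇒T es))))
  ... | true | false | l1 = <ᵇ-true (h refl (inj₂ refl))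
  ... | true | false | l0 = refl
  ... | true | false | l2 = refl

  rlBody-elim : ∀ src val live a k → T (rlBody src val live a k) →
    live k ≡ true → src a < src k ⊎ L k ≡ l1 → val a < val k
  rlBody-elim src val live a k t lk (inj₁ lt) rewrite lk | <ᵇ-true lt = <ᵇ⇒< _ _ t
  rlBody-elim src val live a k t lk (inj₂ e) rewrite lk | e | ∨-zeroʳ (src a <ᵇ src k) = <ᵇ⇒< _ _ t

  -- Induction on the place. A live column in front of strip zero would drop to the place of an
  -- earlier strip, which is dead by induction and hence already has that place as its own value.
  dead-before : ∀ {src val live} → Path L src live → Vals L src val live →
    ∀ k → src k < src zero → live k ≡ false
  dead-before {src} {val} {live} P V k = go (suc (src k)) k (n<1+n _)
    where
    module V = Vals V
    module P = Path P
    go : ∀ n k → src k < n → src k < src zero → live k ≡ false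
    go (suc n) k k<n k<0 with live k in lk
    ... | false = refl
    ... | true with V.zeros (P.before k<0) lk
    ...   | v<s with Bij.surj P.bij (<-trans v<s (Bij.bound P.bij k))
    ...     | b , e with Bij.inj V.bij (trans (V.dead (go n b (<-≤-trans (subst (_< src k) (sym e) v<s) (m<1+n⇒m≤n k<n))
                              (<-trans (subst (_< src k) (sym e) v<s) k<0))) e)
    ...       | refl = ⊥-elim (<-irrefl (sym e) v<s)

  -- A fixed point p of letter l2 followed by a smaller letter contributes to no statistic.
  module KillRow {src val : Fin N → ℕ} {live : Fin N → Bool} {p q : Fin N} (bs : Bij src) (adj : Adj L src p q)
    (lp : live p ≡ true) (lq : live q ≡ true) (ep : L p ≡ l2) (fp : val p ≡ src p) (V : Vals L src val live) where
    open Swap L bs adj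
    module V = Vals V

    -- The loop at `src p` leaves no room. As the right arc it would need `src p` ≤ `val a` <
    -- `val p`; as the left arc against a row, `src p` < `src b` ≤ `val p`; against a column the
    -- test would need `val p` < `val b` < `src p`.
    kill-CR : ∀ a b → CR src val live a b ≡ CR src val (kill p live) a b
    kill-CR a b with a ≟F p | b ≟F p
    ... | yes refl | _ = CR-false src val live p b λ _ _ → go (L b) refl
      where
      go : ∀ l → L b ≡ l → crS src val p b ≡ false
      go l1 e = crS-eval src val p b refl e refl refl refl refl
      go l2 e = trans (crS-eval src val p b ep e refl (cong (_<ᵇ src b) fp) refl refl)
                 (crS-x (src p <ᵇ src b))
        where
        crS-x : ∀ x → crB l2 l2 x x (val p <ᵇ val b) (val b <ᵇ src p) ≡ false
        crS-x true = refl
        crS-x false = refl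
      go l0 e with i <? val b
      ... | yes h = trans (crS-eval src val p b ep e refl refl (<ᵇ-true (subst (_< val b) (sym fp) h)) (<ᵇ-false (<⇒≤ h))) refl
      ... | no h = crS-eval src val p b ep e refl refl (<ᵇ-false (subst (val b ≤_) (sym fp) (≮⇒≥ h))) refl
    ... | no _ | yes refl = trans (CR-false src val live a p λ _ _ → trans (crS-eval src val a p refl ep refl refl (cong (val a <ᵇ_) fp) refl)
                 (trans (cong ((isL1 (L a) ∨ (src a <ᵇ src p)) ∧_) (not-∧-false (val a <ᵇ src p))) (∧-zeroʳ (isL1 (L a) ∨ (src a <ᵇ src p)))))
                 (sym (∧-zeroʳ (live a)))
    ... | no _ | no _ = refl

    -- This keeps the fixed point `p` from being a special LR-maximum. If `q`, placed after `p`, has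
    -- a value below `i`, then some earlier strip has a value at least `i`, and it is live since it
    -- is not fixed. Otherwise `q` cannot be a column, as its value would have to be `i`, the value
    -- of `p`; so `q` is negative and serves itself.
    witness : ∃ λ k → live k ≡ true × (src k < src p ⊎ L k ≡ l1) × val p ≤ val k
    witness with val q <? i
    ... | yes vq<i with threshold bs V.bij i q (subst (i ≤_) (sym next) (n≤1+n i)) vq<i
    ...   | b , sb<i , i≤vb = b , lb (live b) refl , inj₁ sb<i , subst (_≤ val b) (sym fp) i≤vb
      where
      lb : ∀ x → live b ≡ x → live b ≡ true
      lb true e = e
      lb false e = ⊥-elim (<⇒≱ sb<i (subst (i ≤_) (V.dead e) i≤vb))
    witness | no vq≮i = q , lq , inj₂ (Lq=1 desc-view) , subst (_≤ val q) (sym fp) (≮⇒≥ vq≮i)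
      where
      Lq=1 : Descent L p q → L q ≡ l1
      Lq=1 (d21 _ e) = e
      Lq=1 (d10 e _) = l2≢l1 ep e
      Lq=1 (d20 _ e) = ⊥-elim (p≢q (Bij.inj V.bij (trans fp (≤-antisym (≮⇒≥ vq≮i)
                         (m<1+n⇒m≤n (subst (val q <_) next (V.zeros e lq)))))))

    kill-LR : ∀ a → LR src val live a ≡ LR src val (kill p live) a
    kill-LR a with a ≟F p
    ... | yes refl = cong (isL2 (L p) ∧_) (trans (cong (_∧ allL (lrBody src val live p) (fins N)) lp) (¬T⇒≡false notmax))
      where
      notmax : ¬ T (allL (lrBody src val live p) (fins N))
      notmax t with witness
      ... | k , lk , c , h = <⇒≱ (lrBody-elim src val live p k (allF⁻ t k) lk c) h
    ... | no a≢p = ∧-gate (isL2 (L a)) λ e2 → ∧-gate (live a) λ la → allL-cong (body e2 la) (fins N)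
      where
      body : isL2 (L a) ≡ true → live a ≡ true → ∀ k → lrBody src val live a k ≡ lrBody src val (kill p live) a k
      body e2 la k with k ≟F p
      ... | yes refl = lrBody-intro src val live a p (λ { _ (inj₁ lt) → <-≤-trans (subst (_< src a) (sym fp) lt) (V.two (isL2⇒ e2))
                                        ; _ (inj₂ e) → l2≢l1 ep e })
      ... | no k≢p = refl

    kill-RL : ∀ a → RL src val live a ≡ RL src val (kill p live) a
    kill-RL a with a ≟F p
    ... | yes refl rewrite ep = refl
    ... | no a≢p = ∧-gate (isL0 (L a)) λ e0 → ∧-gate (live a) λ la → allL-cong (body e0 la) (fins N)
      where
      body : isL0 (L a) ≡ true → live a ≡ true → ∀ k → rlBody src val live a k ≡ rlBody src val (kill p live) a k
      body e0 la k with k ≟F p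
      ... | yes refl = rlBody-intro src val live a p (λ { _ (inj₁ lt) → subst (val a <_) (sym fp) (<-trans (V.zeros (isL0⇒ e0) la) lt)
                                        ; _ (inj₂ e) → l2≢l1 ep e })
      ... | no k≢p = refl

-- Change of the statistics under an exchange

module _ {m : ℕ} (L : Fin (suc m) → Letter) where

  private
    N : ℕ
    N = suc m

  module SwapStats {src val : Fin N → ℕ} {live : Fin N → Bool} {p q : Fin N} (bs : Bij src) (adj : Adj L src p q)
    (lp : live p ≡ true) (lq : live q ≡ true) (V : Vals L src val live) where
    open Swap L bs adj
    module V = Vals V

    val-q<p : L p ≡ l2 → L q ≡ l0 → val q < val p
    val-q<p ep eq = ≤∧≢⇒< (≤-trans (m<1+n⇒m≤n (subst (val q <_) next (V.zeros eq lq))) (V.two ep))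
                      (λ e → p≢q (sym (Bij.inj V.bij e)))

    -- Apart from the order of `p` and `q` themselves, the exchange can only affect comparisons of a
    -- value with a source, and by `swp-<ᵇ-fix` only when the value is `i` and the source is that of
    -- `p` or `q`. The last two hypotheses exclude this where the crossing test looks.
    crS-same : ∀ a b → ¬ (a ≡ p × b ≡ q) → ¬ (a ≡ q × b ≡ p) →
      (L b ≡ l2 → val a ≡ i → b ≢ p) → (L b ≡ l0 → val b ≡ i → a ≢ p × a ≢ q) →
      crS L src val a b ≡ crS L src′ val a b
    crS-same a b h₁ h₂ h₃ h₄ = go (L b) refl
      where
      ss = sym (src′-<ᵇ a b h₁ h₂)
      go : ∀ l → L b ≡ l → crS L src val a b ≡ crS L src′ val a b
      go l1 e = trans (crS-eval L src val a b refl e refl refl refl refl)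
                  (sym (crS-eval L src′ val a b refl e refl refl refl refl))
      go l2 e = trans (crS-eval L src val a b refl e ss vs refl refl)
                  (sym (crS-eval L src′ val a b refl e refl refl refl refl))
        where
        vs : (val a <ᵇ src b) ≡ (val a <ᵇ src′ b)
        vs with val a ≟ i
        ... | no va≢i = sym (swp-<ᵇ-fix i (val a) (src b) va≢i)
        ... | yes va≡i = cong (val a <ᵇ_) (sym (src′-o (h₃ e va≡i) (λ { refl → Lq≢2 e })))
      go l0 e = trans (crS-eval L src val a b refl e ss refl refl ws)
                  (sym (crS-eval L src′ val a b refl e refl refl refl refl))
        where
        ws : (val b <ᵇ src a) ≡ (val b <ᵇ src′ a)
        ws with val b ≟ i
        ... | no vb≢i = sym (swp-<ᵇ-fix i (val b) (src a) vb≢i)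
        ... | yes vb≡i = cong (val b <ᵇ_) (sym (src′-o (proj₁ (h₄ e vb≡i)) (proj₂ (h₄ e vb≡i))))

    -- Only the test of a row `p` against `q` could change, since `q` now lies in front of `p`. A
    -- diagonal `q` is tested wherever it lies, and a column `q` passes because its value is below
    -- that of `p`.
    free-LR : ∀ a → LR L src val live a ≡ LR L src′ val live a
    free-LR a = ∧-gate (isL2 (L a)) λ e2 → ∧-gate (live a) λ la → allL-cong (body (isL2⇒ e2)) (fins N)
      where
      body : L a ≡ l2 → ∀ k → lrBody L src val live a k ≡ lrBody L src′ val live a k
      body e k with k ≟F q | a ≟F p
      ... | no k≢q | _ = cong (λ x → not (live k ∧ (x ∨ isL1 (L k))) ∨ (val k <ᵇ val a))
                           (sym (src′-<ᵇ k a (λ { (_ , refl) → Lq≢2 e }) (k≢q ∘ proj₁)))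
      ... | yes _ | no a≢p = cong (λ x → not (live k ∧ (x ∨ isL1 (L k))) ∨ (val k <ᵇ val a))
                           (sym (src′-<ᵇ k a (λ { (_ , refl) → Lq≢2 e }) (a≢p ∘ proj₂)))
      ... | yes refl | yes refl with desc-view
      ...   | d20 ep eq = trans (lrBody-intro L src val live p q (λ _ _ → val-q<p ep eq))
                           (sym (lrBody-intro L src′ val live p q (λ _ _ → val-q<p ep eq)))
      ...   | d21 ep eq rewrite eq | ∨-zeroʳ (src q <ᵇ src p) | ∨-zeroʳ (src′ q <ᵇ src′ p) = refl
      ...   | d10 ep _ = l2≢l1 e ep

    free-RL : ∀ a → RL L src val live a ≡ RL L src′ val live a
    free-RL a = ∧-gate (isL0 (L a)) λ e0 → ∧-gate (live a) λ la → allL-cong (body (isL0⇒ e0)) (fins N)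
      where
      body : L a ≡ l0 → ∀ k → rlBody L src val live a k ≡ rlBody L src′ val live a k
      body e k with k ≟F p | a ≟F q
      ... | no k≢p | _ = cong (λ x → not (live k ∧ (x ∨ isL1 (L k))) ∨ (val a <ᵇ val k))
                           (sym (src′-<ᵇ a k (λ { (refl , _) → Lp≢0 e }) (k≢p ∘ proj₂)))
      ... | yes _ | no a≢q = cong (λ x → not (live k ∧ (x ∨ isL1 (L k))) ∨ (val a <ᵇ val k))
                           (sym (src′-<ᵇ a k (λ { (refl , _) → Lp≢0 e }) (a≢q ∘ proj₁)))
      ... | yes refl | yes refl with desc-view
      ...   | d20 ep eq = trans (rlBody-intro L src val live q p (λ _ _ → val-q<p ep eq))
                           (sym (rlBody-intro L src′ val live q p (λ _ _ → val-q<p ep eq)))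
      ...   | d21 _ eq = l1≢l0 eq e
      ...   | d10 ep _ rewrite ep | ∨-zeroʳ (src q <ᵇ src p) | ∨-zeroʳ (src′ q <ᵇ src′ p) = refl

    module Up (eq : L q ≡ l0) (vq : val q ≡ i) where

      -- The lower arc of `q` joins the neighbouring places `i` and `suc i`, and lower crossings
      -- need an endpoint strictly inside. So `q` crosses nothing before it dies.
      up-CR : ∀ a b → CR L src val live a b ≡ CR L src′ val (kill q live) a b
      up-CR a b with a ≟F q | b ≟F q
      ... | yes refl | _ = CR-false L src val live q b λ _ _ → go (L b) refl
        where
        go : ∀ l → L b ≡ l → crS L src val q b ≡ false
        go l1 e = crS-eval L src val q b refl e refl refl refl refl
        go l2 e with src q <? src b
        ... | yes h = trans (crS-eval L src val q b eq e refl
                        (<ᵇ-true (subst (_< src b) (sym vq) (<-trans (n<1+n i) (subst (_< src b) next h)))) refl refl)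
                        (∧-zeroʳ (src q <ᵇ src b))
        ... | no h = crS-eval L src val q b eq e (<ᵇ-false (≮⇒≥ h)) refl refl refl
        go l0 e with val q <? val b
        ... | yes h = trans (crS-eval L src val q b eq e refl refl refl
                        (<ᵇ-false (subst (_≤ val b) (trans (cong suc vq) (sym next)) h)))
                        (∧-zeroʳ (val q <ᵇ val b))
        ... | no h = crS-eval L src val q b eq e refl refl (<ᵇ-false (≮⇒≥ h)) refl
      ... | no _ | yes refl = trans (CR-false L src val live a q λ _ _ → go) (sym (∧-zeroʳ (live a)))
        where
        go : crS L src val a q ≡ false
        go with val q <? src a
        ... | yes h = trans (crS-eval L src val a q refl eq
                        (<ᵇ-false (subst (_≤ src a) (trans (cong suc vq) (sym next)) h)) refl refl refl)
                        (trans (cong ((isL1 (L a) ∨ (val a <ᵇ val q)) ∧_) (∧-zeroʳ (val q <ᵇ src a)))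
                          (∧-zeroʳ (isL1 (L a) ∨ (val a <ᵇ val q))))
        ... | no h = trans (crS-eval L src val a q refl eq refl refl refl (<ᵇ-false (≮⇒≥ h)))
                        (∧-zeroʳ (isL1 (L a) ∨ (val a <ᵇ val q)))
      ... | no a≢q | no b≢q = cong (λ x → live a ∧ (live b ∧ x))
              (crS-same a b (b≢q ∘ proj₂) (a≢q ∘ proj₁)
                (λ _ e → ⊥-elim (a≢q (Bij.inj V.bij (trans e (sym vq)))))
                (λ _ e → ⊥-elim (b≢q (Bij.inj V.bij (trans e (sym vq))))))

      -- The test against `q` that disappears was always passed: a row `a` behind `q` has `val q` =
      -- `i` < `src a` ≤ `val a`.
      up-LR : ∀ a → LR L src val live a ≡ LR L src′ val (kill q live) a
      up-LR a with a ≟F q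
      ... | yes refl rewrite eq = refl
      ... | no a≢q = ∧-gate (isL2 (L a)) λ e2 → ∧-gate (live a) λ la → allL-cong (body (isL2⇒ e2)) (fins N)
        where
        body : L a ≡ l2 → ∀ k → lrBody L src val live a k ≡ lrBody L src′ val (kill q live) a k
        body e k with k ≟F q
        ... | yes refl = lrBody-intro L src val live a q
                λ { _ (inj₁ lt) → subst (_< val a) (sym vq)
                       (<-≤-trans (<-trans (n<1+n i) (subst (_< src a) next lt)) (V.two e))
                  ; _ (inj₂ e′) → l1≢l0 e′ eq }
        ... | no k≢q = cong (λ x → not (live k ∧ (x ∨ isL1 (L k))) ∨ (val k <ᵇ val a))
                         (sym (src′-<ᵇ k a (a≢q ∘ proj₂) (k≢q ∘ proj₁)))

      up-RL-other : ∀ a → a ≢ q → RL L src val live a ≡ RL L src′ val (kill q live) a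
      up-RL-other a a≢q rewrite kill-other q live a≢q =
        ∧-gate (isL0 (L a)) λ e0 → ∧-gate (live a) λ la → allL-cong (body (isL0⇒ e0) la) (fins N)
        where
        body : L a ≡ l0 → live a ≡ true → ∀ k → rlBody L src val live a k ≡ rlBody L src′ val (kill q live) a k
        body e la k with k ≟F q
        ... | yes refl = rlBody-intro L src val live a q
                λ { _ (inj₁ lt) → subst (val a <_) (sym vq)
                       (<-≤-trans (V.zeros e la) (m<1+n⇒m≤n (subst (src a <_) next lt)))
                  ; _ (inj₂ e′) → l1≢l0 e′ eq }
        ... | no k≢q = cong (λ x → not (live k ∧ (x ∨ isL1 (L k))) ∨ (val a <ᵇ val k))
                         (sym (src′-<ᵇ a k (k≢q ∘ proj₂) (a≢q ∘ proj₁)))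

      up-RL-dead : RL L src′ val (kill q live) q ≡ false
      up-RL-dead = trans (cong (λ x → isL0 (L q) ∧ (x ∧ allL (rlBody L src′ val (kill q live) q) (fins N))) (kill-self q live))
                     (∧-zeroʳ (isL0 (L q)))

      -- Everything to the left of strip zero is dead, so a column ending there is minimal;
      -- for any other p, some live strip has a smaller value.
      up-RL-self : Path L src live → RL L src val live q ≡ ⌊ p ≟F zero ⌋
      up-RL-self P = trans (cong₂ (λ x y → isL0 x ∧ (y ∧ allL (rlBody L src val live q) (fins N))) eq lq) go
        where
        module P = Path P
        go : allL (rlBody L src val live q) (fins N) ≡ ⌊ p ≟F zero ⌋
        go with p ≟F zero
        ... | yes refl = T⇒≡true (allF⁺ λ k → ≡true⇒T (rlBody-intro L src val live q k (minimal k)))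
          where
          minimal : ∀ k → live k ≡ true → src q < src k ⊎ L k ≡ l1 → val q < val k
          minimal k lk c = subst (_< val k) (sym vq) (≤∧≢⇒< i≤v i≢v)
            where
            i≤v : i ≤ val k
            i≤v with val k <? i
            ... | no h = ≮⇒≥ h
            ... | yes h with Bij.surj bs (<-trans h (Bij.bound bs zero))
            ...   | b , e with Bij.inj V.bij (trans (V.dead (dead-before L P V b (subst (_< i) (sym e) h))) e)
            ...     | refl = true≢false lk (dead-before L P V b (subst (_< i) (sym e) h))
            i≢v : i ≢ val k
            i≢v e with Bij.inj V.bij (trans (sym e) (sym vq))
            ... | refl = [ <-irrefl refl , (λ e′ → l1≢l0 e′ eq) ] c
        ... | no p≢0 = ¬T⇒≡false λ t → let (k , lk , c , h) = wit in
                         <⇒≱ (rlBody-elim L src val live q k (allF⁻ t k) lk c) (subst (val k ≤_) (sym vq) h)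
          where
          s0<i : src zero < i
          s0<i with <-cmp (src zero) i
          ... | tri< h _ _ = h
          ... | tri≈ _ h _ = ⊥-elim (p≢0 (sym (Bij.inj bs h)))
          ... | tri> _ _ h = ⊥-elim (Lp≢0 (P.before h))
          wit : ∃ λ k → live k ≡ true × (src q < src k ⊎ L k ≡ l1) × val k ≤ i
          -- If strip zero does not serve itself, it lies before the place `i` but has a larger
          -- value, so some strip at `i` or later has a value below `i`. At the place `i` this strip
          -- is `p`, which must then be diagonal; it is not `q`, whose value is `i`.
          wit with val zero ≤? i
          ... | yes h = zero , P.oneLive P.first , inj₂ P.first , h
          ... | no h with threshold V.bij bs i zero (<⇒≤ (≰⇒> h)) s0<i
          ...   | b , vb<i , i≤sb = b , lb (live b) refl , side , <⇒≤ vb<i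
            where
            lb : ∀ x → live b ≡ x → live b ≡ true
            lb true e = e
            lb false e = ⊥-elim (<⇒≱ vb<i (subst (i ≤_) (sym (V.dead e)) i≤sb))
            side : src q < src b ⊎ L b ≡ l1
            side with m≤n⇒m<n∨m≡n i≤sb
            side | inj₂ e with Bij.inj bs e | desc-view
            ... | refl | d10 ep _ = inj₂ ep
            ... | refl | d20 ep _ = ⊥-elim (<⇒≱ vb<i (V.two ep))
            ... | refl | d21 ep _ = ⊥-elim (<⇒≱ vb<i (V.two ep))
            side | inj₁ lt with m≤n⇒m<n∨m≡n lt
            ... | inj₁ lt′ = inj₁ (subst (_< src b) (sym next) lt′)
            ... | inj₂ e with src-q≡ (sym e)
            ...   | refl = ⊥-elim (<-irrefl vq vb<i)

      up-RL : Path L src live →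
        sum (λ a → b2n (RL L src val live a)) ≡ b2n ⌊ p ≟F zero ⌋ + sum (λ a → b2n (RL L src′ val (kill q live) a))
      up-RL P = trans (sum-cong-≗ pointwise) (trans (∑-distrib-+ e (λ a → b2n (RL L src′ val (kill q live) a)))
                  (cong (_+ sum (λ a → b2n (RL L src′ val (kill q live) a))) (trans (sum-single q e off) on)))
        where
        e : Fin N → ℕ
        e a = if ⌊ a ≟F q ⌋ then b2n ⌊ p ≟F zero ⌋ else 0
        off : ∀ a → a ≢ q → e a ≡ 0
        off a h = cong (λ x → if x then b2n ⌊ p ≟F zero ⌋ else 0) (⌊⌋-false {d = a ≟F q} h)
        on : e q ≡ b2n ⌊ p ≟F zero ⌋
        on = cong (λ x → if x then b2n ⌊ p ≟F zero ⌋ else 0) (⌊⌋-true {d = q ≟F q} refl)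
        pointwise : ∀ a → b2n (RL L src val live a) ≡ e a + b2n (RL L src′ val (kill q live) a)
        pointwise a = case a ≟F q of λ
          { (yes refl) → trans (cong b2n (up-RL-self P))
              (sym (trans (cong₂ (λ y x → y + b2n x) on up-RL-dead) (+-identityʳ _)))
          ; (no a≢q) → trans (cong b2n (up-RL-other a a≢q))
              (cong (_+ b2n (RL L src′ val (kill q live) a)) (sym (off a a≢q))) }

    -- The strip c sent to the place i decides which crossing is new: that of c and p if c has an upper
    -- arc and L p ≡ l2, that of q and c if c has a lower arc, and that of p and q if L p ≡ l1 (then the
    -- crossings of p and q with a lower arc c merely trade places).
    module Free (hp : L p ≡ l2 → val p ≢ i) (hq : L q ≡ l0 → val q ≢ i) where

      private
        pre : ∃ λ c → val c ≡ i
        pre = Bij.surj V.bij (<-trans (n<1+n i) i<N)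

        c : Fin N
        c = proj₁ pre

        vc : val c ≡ i
        vc = proj₂ pre

        is-c : ∀ {a} → val a ≡ i → a ≡ c
        is-c e = Bij.inj V.bij (trans e (sym vc))

        -- A dead `c` would be a fixed point at the place `i`, hence equal to `p`, which is live.
        lc : live c ≡ true
        lc = go (live c) refl
          where
          go : ∀ x → live c ≡ x → live c ≡ true
          go true e = e
          go false e = subst (λ x → live x ≡ true) (Bij.inj bs (trans (sym vc) (V.dead e))) lp

        n₁ n₂ : Fin N → Fin N → ℕ
        n₁ a b = b2n (CR L src val live a b)
        n₂ a b = b2n (CR L src′ val live a b)

        same : ∀ {a b} → crS L src val a b ≡ crS L src′ val a b → n₁ a b ≡ n₂ a b
        same {a} {b} e = cong (λ x → b2n (live a ∧ (live b ∧ x))) e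

        one : ∀ {s : Fin N → ℕ} {a b} → live a ≡ true → live b ≡ true → crS L s val a b ≡ true → b2n (CR L s val live a b) ≡ 1
        one {s} {a} {b} la lb e = cong b2n (trans (CR-live L {s} {val} {live} {a} {b} la lb) e)

        nil : ∀ {s : Fin N → ℕ} {a b} → crS L s val a b ≡ false → b2n (CR L s val live a b) ≡ 0
        nil {s} {a} {b} e = cong b2n (CR-false L s val live a b (λ _ _ → e))

        pq-same : L p ≡ l2 → crS L src val p q ≡ crS L src′ val p q
        pq-same ep with desc-view
        ... | d20 _ eq = trans (crS-eval L src val p q ep eq refl refl vv refl)
                           (sym (crS-eval L src′ val p q ep eq refl refl vv refl))
          where
          vv : (val p <ᵇ val q) ≡ false
          vv = <ᵇ-false (<⇒≤ (val-q<p ep eq))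
        ... | d21 _ eq = trans (crS-eval L src val p q refl eq refl refl refl refl)
                           (sym (crS-eval L src′ val p q refl eq refl refl refl refl))
        ... | d10 e _ = l2≢l1 ep e

        vq<i : L q ≡ l0 → val q < i
        vq<i eq = ≤∧≢⇒< (m<1+n⇒m≤n (subst (val q <_) next (V.zeros eq lq))) (hq eq)

        i<vp : L p ≡ l2 → i < val p
        i<vp ep = ≤∧≢⇒< (V.two ep) (λ e → hp ep (sym e))

        qp-same : L p ≡ l2 → val q ≢ i → crS L src val q p ≡ crS L src′ val q p
        qp-same ep vq≢i with desc-view
        ... | d20 _ eq = trans
                (trans (crS-eval L src val q p eq ep refl (<ᵇ-true (vq<i eq)) refl refl) (∧-zeroʳ (src q <ᵇ src p)))
                (sym (trans (crS-eval L src′ val q p eq ep refl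
                  (<ᵇ-true (subst (val q <_) (sym src′-p) (m<n⇒m<1+n (vq<i eq)))) refl refl) (∧-zeroʳ (src′ q <ᵇ src′ p))))
        ... | d21 _ eq = trans
                (crS-eval L src val q p eq ep refl (sym (swp-<ᵇ-fix i (val q) (src p) vq≢i)) refl refl)
                (sym (crS-eval L src′ val q p eq ep refl refl refl refl))
        ... | d10 e _ = l2≢l1 ep e

        rest₂ : L p ≡ l2 → ∀ a b → ¬ (a ≡ c × b ≡ p) → (L c ≡ l0 → b ≡ c → a ≢ p × a ≢ q) → n₁ a b ≡ n₂ a b
        rest₂ ep a b h h′ with (a ≟F p) ×-dec (b ≟F q) | (a ≟F q) ×-dec (b ≟F p)
        ... | yes (refl , refl) | _ = same {p} {q} (pq-same ep)
        ... | no _ | yes (refl , refl) = same {q} {p} (qp-same ep (λ e → h (is-c e , refl)))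
        ... | no h₁ | no h₂ = same {a} {b} (crS-same a b h₁ h₂ (λ _ e e′ → h (is-c e , e′)) cond)
          where
          cond : L b ≡ l0 → val b ≡ i → a ≢ p × a ≢ q
          cond eb e with is-c e
          ... | refl = h′ eb refl

        rest₁ : L p ≡ l1 → ∀ a b → ¬ (a ≡ p × b ≡ q) → (L c ≡ l0 → b ≡ c → a ≢ p × a ≢ q) → n₁ a b ≡ n₂ a b
        rest₁ ep a b h₁ h′ with (a ≟F q) ×-dec (b ≟F p)
        ... | yes (refl , refl) = same {q} {p} (trans (crS-eval L src val q p refl ep refl refl refl refl)
                                    (sym (crS-eval L src′ val q p refl ep refl refl refl refl)))
        ... | no h₂ = same {a} {b} (crS-same a b h₁ h₂ (λ { eb _ refl → l2≢l1 eb ep }) cond)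
          where
          cond : L b ≡ l0 → val b ≡ i → a ≢ p × a ≢ q
          cond eb e with is-c e
          ... | refl = h′ eb refl

        i<ᵇ1+i : (i <ᵇ suc i) ≡ true
        i<ᵇ1+i = <ᵇ-true (n<1+n i)

        i≮ᵇi : (i <ᵇ i) ≡ false
        i≮ᵇi = <ᵇ-false {i} ≤-refl

        c≢q : L q ≡ l0 → c ≢ q
        c≢q eq e = hq eq (trans (cong val (sym e)) vc)

        -- The lower arc of `c` starts at `i` and reaches past both exchanged places: were its end
        -- `suc i`, then `c` would be `q`, whose value is not `i`.
        src-c> : L c ≡ l0 → suc i < src c
        src-c> ec = ≤∧≢⇒< (subst (_< src c) vc (V.zeros ec lc))
                      (λ e → c≢q (trans (sym (cong L (src-q≡ (sym e)))) ec) (src-q≡ (sym e)))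

        one-pair : ∀ x y → (∀ a b → n₁ a b ≡ n₂ a b + δ₂ x y a b) → sum₂ n₁ ≡ suc (sum₂ n₂)
        one-pair x y h = trans (sum₂-cong h) (trans (sum₂-+ n₂ (δ₂ x y))
                           (trans (cong (sum₂ n₂ +_) (sum₂-δ₂ x y)) (+-comm (sum₂ n₂) 1)))

        hit : ∀ x y → n₁ x y ≡ 1 → n₂ x y ≡ 0 → n₁ x y ≡ n₂ x y + δ₂ x y x y
        hit x y e₁ e₂ = trans e₁ (sym (cong₂ _+_ e₂ (δ₂-hit x y)))

        miss : ∀ {x y a b} → ¬ (a ≡ x × b ≡ y) → n₁ a b ≡ n₂ a b → n₁ a b ≡ n₂ a b + δ₂ x y a b
        miss {a = a} {b} h e = trans e (sym (trans (cong (n₂ a b +_) (δ₂-miss h)) (+-identityʳ _)))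

        caseA : L p ≡ l2 → L c ≢ l0 → sum₂ n₁ ≡ suc (sum₂ n₂)
        caseA ep ec = one-pair c p pt
          where
          up-arc : ∀ l → L c ≡ l → crS L src val c p ≡ true
          up-arc l0 e = ⊥-elim (ec e)
          up-arc l1 e = crS-eval L src val c p e ep refl (trans (cong (_<ᵇ i) vc) i≮ᵇi)
                          (<ᵇ-true (subst (_< val p) (sym vc) (i<vp ep))) refl
          up-arc l2 e = crS-eval L src val c p e ep
                          (<ᵇ-true (≤∧≢⇒< (subst (src c ≤_) vc (V.two e))
                             (λ e′ → hp ep (trans (cong val (sym (Bij.inj bs e′))) vc))))
                          (trans (cong (_<ᵇ i) vc) i≮ᵇi)
                          (<ᵇ-true (subst (_< val p) (sym vc) (i<vp ep))) refl
          pt : ∀ a b → n₁ a b ≡ n₂ a b + δ₂ c p a b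
          pt a b = case (a ≟F c) ×-dec (b ≟F p) of λ
            { (yes (refl , refl)) → hit c p (one {src} {c} {p} lc lp (up-arc (L c) refl))
                (nil {src′} {c} {p} (trans (crS-eval L src′ val c p refl ep refl
                  (trans (cong₂ _<ᵇ_ vc src′-p) i<ᵇ1+i) refl refl) (∧-zeroʳ (isL1 (L c) ∨ (src′ c <ᵇ src′ p)))))
            ; (no h) → miss h (rest₂ ep a b h (λ e → ⊥-elim (ec e))) }

        caseB : L p ≡ l2 → L c ≡ l0 → sum₂ n₁ ≡ suc (sum₂ n₂)
        caseB ep ec = one-pair q c pt
          where
          c≢p : c ≢ p
          c≢p e = l2≢l0 ep (trans (cong L (sym e)) ec)
          c≢q′ : c ≢ q
          c≢q′ e = c≢q (trans (cong L (sym e)) ec) e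
          src′-c : src′ c ≡ src c
          src′-c = src′-o c≢p c≢q′
          lowers : Descent L p q → crS L src val q c ≡ true
          lowers (d20 _ eq) = crS-eval L src val q c eq ec
            (<ᵇ-true (subst (_< src c) (sym next) (src-c> ec))) refl
            (<ᵇ-true (subst (val q <_) (sym vc) (vq<i eq)))
            (trans (cong₂ _<ᵇ_ vc next) i<ᵇ1+i)
          lowers (d21 _ eq) = crS-eval L src val q c eq ec
            (<ᵇ-true (subst (_< src c) (sym next) (src-c> ec))) refl refl
            (trans (cong₂ _<ᵇ_ vc next) i<ᵇ1+i)
          lowers (d10 e _) = l2≢l1 ep e
          pc-false : ∀ s → crS L s val p c ≡ false
          pc-false s = crS-eval L s val p c ep ec refl refl (<ᵇ-false (subst (_≤ val p) (sym vc) (<⇒≤ (i<vp ep)))) refl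
          cp-false : ∀ s → s p ≤ s c → crS L s val c p ≡ false
          cp-false s h = crS-eval L s val c p ec ep (<ᵇ-false h) refl refl refl
          pt : ∀ a b → n₁ a b ≡ n₂ a b + δ₂ q c a b
          pt a b = case (a ≟F q) ×-dec (b ≟F c) of λ
            { (yes (refl , refl)) → hit q c (one {src} {q} {c} lq lc (lowers desc-view))
                (nil {src′} {q} {c} (trans (crS-eval L src′ val q c refl ec refl refl refl
                  (trans (cong₂ _<ᵇ_ vc src′-q) i≮ᵇi)) (∧-zeroʳ (isL1 (L q) ∨ (val q <ᵇ val c)))))
            ; (no h) → miss h (case (a ≟F c) ×-dec (b ≟F p) of λ
                { (yes (refl , refl)) → same {c} {p} (trans (cp-false src (<⇒≤ (<-trans (n<1+n i) (src-c> ec))))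
                    (sym (cp-false src′ (subst₂ _≤_ (sym src′-p) (sym src′-c) (<⇒≤ (src-c> ec))))))
                ; (no h₂) → case (a ≟F p) ×-dec (b ≟F c) of λ
                    { (yes (refl , refl)) → same {p} {c} (trans (pc-false src) (sym (pc-false src′)))
                    ; (no h₃) → rest₂ ep a b h₂ (λ _ e → (λ e′ → h₃ (e′ , e)) , (λ e′ → h (e′ , e))) } }) }

        pq-one : L p ≡ l1 → L q ≡ l0 → n₁ p q ≡ 1
        pq-one ep eq = one {src} {p} {q} lp lq (crS-eval L src val p q ep eq
          (<ᵇ-true (subst (i <_) (sym next) (n<1+n i))) refl refl (<ᵇ-true (vq<i eq)))

        pq-zero : L p ≡ l1 → L q ≡ l0 → n₂ p q ≡ 0
        pq-zero ep eq = nil {src′} {p} {q} (trans (crS-eval L src′ val p q ep eq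
          (<ᵇ-false (subst₂ _≤_ (sym src′-q) (sym src′-p) (n≤1+n i))) refl refl refl) (∧-zeroʳ (val q <ᵇ src′ p)))

        caseC : L p ≡ l1 → L q ≡ l0 → L c ≢ l0 → sum₂ n₁ ≡ suc (sum₂ n₂)
        caseC ep eq ec = one-pair p q pt
          where
          pt : ∀ a b → n₁ a b ≡ n₂ a b + δ₂ p q a b
          pt a b = case (a ≟F p) ×-dec (b ≟F q) of λ
            { (yes (refl , refl)) → hit p q (pq-one ep eq) (pq-zero ep eq)
            ; (no h) → miss h (rest₁ ep a b h (λ e → ⊥-elim (ec e))) }

        caseD : L p ≡ l1 → L q ≡ l0 → L c ≡ l0 → sum₂ n₁ ≡ suc (sum₂ n₂)
        -- The pairs (p, q) and (q, c) stop crossing and (p, c) starts. Adding the indicator of (p,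
        -- c) to the left side avoids subtraction, and one of the two successors on the right
        -- cancels.
        caseD ep eq ec = suc-injective (begin
            suc (sum₂ n₁)                               ≡⟨ +-comm 1 (sum₂ n₁) ⟩
            sum₂ n₁ + 1                                 ≡⟨ cong (sum₂ n₁ +_) (sym (sum₂-δ₂ p c)) ⟩
            sum₂ n₁ + sum₂ (δ₂ p c)                     ≡⟨ sym (sum₂-+ n₁ (δ₂ p c)) ⟩
            sum₂ (λ a b → n₁ a b + δ₂ p c a b)          ≡⟨ sum₂-cong pt ⟩
            sum₂ (λ a b → n₂ a b + two a b)             ≡⟨ sum₂-+ n₂ two ⟩
            sum₂ n₂ + sum₂ two                          ≡⟨ cong (sum₂ n₂ +_) (trans (sum₂-+ (δ₂ p q) (δ₂ q c))
                                                             (cong₂ _+_ (sum₂-δ₂ p q) (sum₂-δ₂ q c))) ⟩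
            sum₂ n₂ + 2                                 ≡⟨ +-comm (sum₂ n₂) 2 ⟩
            suc (suc (sum₂ n₂))                         ∎)
          where
          open ≡-Reasoning
          two : Fin N → Fin N → ℕ
          two a b = δ₂ p q a b + δ₂ q c a b
          src′-c : src′ c ≡ src c
          src′-c = src′-o (λ e → l1≢l0 ep (trans (cong L (sym e)) ec)) (c≢q eq)
          s′-q<c : suc i < src′ c
          s′-q<c = subst (suc i <_) (sym src′-c) (src-c> ec)
          pc₁ : n₁ p c ≡ 0
          pc₁ = nil {src} {p} {c} (crS-eval L src val p c ep ec refl refl refl (trans (cong (_<ᵇ i) vc) i≮ᵇi))
          pc₂ : n₂ p c ≡ 1
          pc₂ = one {src′} {p} {c} lp lc (crS-eval L src′ val p c ep ec
                  (<ᵇ-true (subst (_< src′ c) (sym src′-p) s′-q<c)) refl refl (trans (cong₂ _<ᵇ_ vc src′-p) i<ᵇ1+i))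
          qc₁ : n₁ q c ≡ 1
          qc₁ = one {src} {q} {c} lq lc (crS-eval L src val q c eq ec
                  (<ᵇ-true (subst (_< src c) (sym next) (src-c> ec))) refl
                  (<ᵇ-true (subst (val q <_) (sym vc) (vq<i eq))) (trans (cong₂ _<ᵇ_ vc next) i<ᵇ1+i))
          qc₂ : n₂ q c ≡ 0
          qc₂ = nil {src′} {q} {c} (trans (crS-eval L src′ val q c eq ec refl refl refl
                  (trans (cong₂ _<ᵇ_ vc src′-q) i≮ᵇi)) (∧-zeroʳ (val q <ᵇ val c)))
          pt : ∀ a b → n₁ a b + δ₂ p c a b ≡ n₂ a b + two a b
          pt a b = case (a ≟F p) ×-dec (b ≟F q) of λ
            { (yes (refl , refl)) → trans (cong₂ _+_ (pq-one ep eq) (δ₂-miss {x = p} {c} (λ e → c≢q eq (sym (proj₂ e)))))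
                (sym (cong₂ _+_ (pq-zero ep eq) (cong₂ _+_ (δ₂-hit p q) (δ₂-miss {x = q} {c} (p≢q ∘ proj₁)))))
            ; (no h₁) → case (a ≟F p) ×-dec (b ≟F c) of λ
              { (yes (refl , refl)) → trans (cong₂ _+_ pc₁ (δ₂-hit p c))
                  (sym (cong₂ _+_ pc₂ (cong₂ _+_ (δ₂-miss {x = p} {q} h₁) (δ₂-miss {x = q} {c} (p≢q ∘ proj₁)))))
              ; (no h₂) → case (a ≟F q) ×-dec (b ≟F c) of λ
                { (yes (refl , refl)) → trans (cong₂ _+_ qc₁ (δ₂-miss {x = p} {c} h₂))
                    (sym (cong₂ _+_ qc₂ (cong₂ _+_ (δ₂-miss {x = p} {q} h₁) (δ₂-hit q c))))
                ; (no h₃) → cong₂ _+_ (rest₁ ep a b h₁ (λ _ e → (λ e′ → h₂ (e′ , e)) , (λ e′ → h₃ (e′ , e))))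
                    (trans (δ₂-miss h₂) (sym (cong₂ _+_ (δ₂-miss h₁) (δ₂-miss h₃)))) } } }

        is0? : ∀ l → l ≡ l0 ⊎ l ≢ l0
        is0? l0 = inj₁ refl
        is0? l1 = inj₂ λ ()
        is0? l2 = inj₂ λ ()

      free-crossings : crossings L src val live ≡ suc (crossings L src′ val live)
      free-crossings with desc-view | is0? (L c)
      ... | d20 ep _ | inj₂ ec = caseA ep ec
      ... | d21 ep _ | inj₂ ec = caseA ep ec
      ... | d20 ep _ | inj₁ ec = caseB ep ec
      ... | d21 ep _ | inj₁ ec = caseB ep ec
      ... | d10 ep eq | inj₂ ec = caseC ep eq ec
      ... | d10 ep eq | inj₁ ec = caseD ep eq ec

-- From fillings to states and back

killT : ∀ {n} → (Fin n → Bool) → Tile n → Content → Fin n → Bool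
killT live t empty = live
killT live t left = kill (label₁ t) live
killT live t up = kill (label₂ t) live

liveT : ∀ {n} → (Fin n → Bool) → Tile n → Bool
liveT live t = live (label₁ t) ∧ live (label₂ t)

-- Built from the northwest: `later` is the permutation after the tile, and for no tiles it is the
-- identity, where value and source agree. Sources are carried by `src` alone, so a conjugation
-- shows up only as `swp` on the values.
valOf : ∀ {n} → (Fin n → ℕ) → (Fin n → Bool) → (ts : List (Tile n)) → Vec Content (length ts) → Fin n → ℕ
valOf src live [] [] = src
valOf src live (t ∷ ts) (c ∷ cs) =
  if liveT live t ∧ not (isLeft c) then later else swp (src (label₁ t)) ∘ later
  where later = valOf (swp (src (label₁ t)) ∘ src) (killT live t c) ts cs

Ok : ∀ {n} → (Fin n → Bool) → Tile n → Content → Set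
Ok live t empty = ⊤
Ok live t left = letter₁ t ≡ l2 × live (label₁ t) ≡ true × live (label₂ t) ≡ true
Ok live t up = letter₂ t ≡ l0 × live (label₁ t) ≡ true × live (label₂ t) ≡ true

fcellR : ∀ {n} → (Fin n → Bool) → (ts : List (Tile n)) → Vec Content (length ts) → ℕ
fcellR live [] [] = 0
fcellR live (t ∷ ts) (c ∷ cs) = b2n (isEmpty c ∧ liveT live t) + fcellR (killT live t c) ts cs

topupR : ∀ {n} → (ts : List (Tile (suc n))) → Vec Content (length ts) → ℕ
topupR [] [] = 0
topupR (t ∷ ts) (c ∷ cs) = b2n (isUp c ∧ inStrip zero t) + topupR ts cs

data Kind {n} (live : Fin n → Bool) (p q : Fin n) : Content → Set where
  dead  : live p ∧ live q ≡ false → Kind live p q empty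
  free  : live p ≡ true → live q ≡ true → Kind live p q empty
  leftK : live p ≡ true → live q ≡ true → Kind live p q left
  upK   : live p ≡ true → live q ≡ true → Kind live p q up

emptyKind : ∀ {n} (live : Fin n → Bool) p q → Kind live p q empty
emptyKind live p q with live p in lp | live q in lq
... | true | true = free lp lq
... | true | false = dead (trans (cong (_∧ live q) lp) lq)
... | false | _ = dead (cong (_∧ live q) lp)

kind : ∀ {n} (live : Fin n → Bool) {l l′} p q c → Ok live (tile l p l′ q) c → Kind live p q c
kind live p q empty _ = emptyKind live p q
kind live p q left (_ , lp , lq) = leftK lp lq
kind live p q up (_ , lp , lq) = upK lp lq

deadStrip : ∀ {n} (live : Fin n → Bool) {p q} → live p ∧ live q ≡ false → ∃ λ x → live x ≡ false × (x ≡ p ⊎ x ≡ q)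
deadStrip live {p} {q} h with live p in lp
... | false = p , lp , inj₁ refl
... | true = q , h , inj₂ refl

module _ {m : ℕ} (L : Fin (suc m) → Letter) where

  private
    N : ℕ
    N = suc m

  -- Forgets which descent the maximal tiling picks: the induction uses only that descents are
  -- exchanged until the path is sorted.
  data Run : (Fin N → ℕ) → List (Tile N) → Set where
    done : ∀ {src} → (∀ a b → src a < src b → lval (L a) ≤ lval (L b)) → Run src []
    step : ∀ {src ts} p q → Adj L src p q → Run (swp (src p) ∘ src) ts → Run src (tile (L p) p (L q) q ∷ ts)

  -- Only an up-arrow kills a column, so the final clause, that no column stays live, expresses that
  -- every column contains an up-arrow.
  Valid : (Fin N → Bool) → (ts : List (Tile N)) → Vec Content (length ts) → Set
  Valid live [] [] = ∀ ℓ → L ℓ ≡ l0 → live ℓ ≡ false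
  Valid live (t ∷ ts) (c ∷ cs) = Ok live t c × Valid (killT live t c) ts cs

  frowR : (Fin N → Bool) → (ts : List (Tile N)) → Vec Content (length ts) → ℕ
  frowR live [] [] = sum (λ ℓ → b2n (isL2 (L ℓ) ∧ live ℓ))
  frowR live (t ∷ ts) (c ∷ cs) = frowR (killT live t c) ts cs

  -- `fr`, `tu` and `fc` are the counts of free rows, top up-arrows and free cells as seen from the
  -- remaining tiles and the strips still live.
  record Good (src val : Fin N → ℕ) (live : Fin N → Bool) (fr tu fc : ℕ) : Set where
    field
      vals : Vals L src val live
      lrOK : sum (λ a → b2n (LR L src val live a)) ≡ fr
      rlOK : sum (λ a → b2n (RL L src val live a)) ≡ tu
      crOK : crossings L src val live ≡ fc

  path-killT : ∀ {src live p q} (adj : Adj L src p q) c → Ok live (tile (L p) p (L q) q) c → Path L src live →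
    Path L (swp (src p) ∘ src) (killT live (tile (L p) p (L q) q) c)
  path-killT {live = live} {p} {q} adj c ok P = Swap.path L (Path.bij P) adj (keep c ok) P
    where
    keep : ∀ c → Ok live (tile (L p) p (L q) q) c → ∀ {a} → L a ≡ l1 → live a ≡ true →
      killT live (tile (L p) p (L q) q) c a ≡ true
    keep empty _ _ la = la
    keep left (e , _) ea la = trans (kill-other p live (λ { refl → l2≢l1 e ea })) la
    keep up (e , _) ea la = trans (kill-other q live (λ { refl → l1≢l0 ea e })) la

  -- In the identity on a sorted path every live row is a special LR-maximum, as the diagonal strips
  -- lie in front of it. There are no live columns and no crossings.
  good-done : ∀ {src live} → (∀ a b → src a < src b → lval (L a) ≤ lval (L b)) → Path L src live →
    (∀ ℓ → L ℓ ≡ l0 → live ℓ ≡ false) → Good src src live (sum (λ ℓ → b2n (isL2 (L ℓ) ∧ live ℓ))) 0 0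
  good-done {src} {live} sorted P zs = record
    { vals = record { bij = P.bij ; dead = λ _ → refl ; two = λ _ → ≤-refl
                    ; zeros = λ e l → true≢false l (zs _ e) ; oneInc = λ _ _ h → h }
    ; lrOK = sum-cong-≗ (λ a → cong b2n (lr a))
    ; rlOK = sum-zero _ (λ a → cong b2n (rl a))
    ; crOK = sum₂-zero _ (λ a b → cong b2n (CR-false L src src live a b (λ _ _ → cr a b (L b) refl)))
    }
    where
    module P = Path P
    lr : ∀ a → LR L src src live a ≡ isL2 (L a) ∧ live a
    lr a = ∧-gate (isL2 (L a)) λ e2 → trans (cong (live a ∧_)
      (T⇒≡true (allF⁺ λ k → ≡true⇒T (lrBody-intro L src src live a k
        λ { _ (inj₁ lt) → lt ; _ (inj₂ e) → below k (isL2⇒ e2) e })))) (∧-identityʳ (live a))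
      where
      below : ∀ k → L a ≡ l2 → L k ≡ l1 → src k < src a
      below k ea ek with <-cmp (src k) (src a)
      ... | tri< h _ _ = h
      ... | tri≈ _ h _ with Bij.inj P.bij h
      ...   | refl = l2≢l1 ea ek
      below k ea ek | tri> _ _ h = ⊥-elim (<⇒≱ (n<1+n 1) (subst₂ _≤_ (cong lval ea) (cong lval ek) (sorted a k h)))
    rl : ∀ a → RL L src src live a ≡ false
    rl a with isL0 (L a) in e
    ... | false = refl
    ... | true = cong (_∧ allL (rlBody L src src live a) (fins N)) (zs a (isL0⇒ e))
    cr : ∀ a b l → L b ≡ l → crS L src src a b ≡ false
    cr a b l1 e = crS-eval L src src a b refl e refl refl refl refl
    cr a b l2 e = trans (crS-eval L src src a b refl e refl refl refl refl)
      (trans (cong ((isL1 (L a) ∨ (src a <ᵇ src b)) ∧_) (not-∧-false (src a <ᵇ src b))) (∧-zeroʳ (isL1 (L a) ∨ (src a <ᵇ src b))))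
    cr a b l0 e with src a <? src b
    ... | yes h = trans (crS-eval L src src a b refl e refl refl refl (<ᵇ-false (<⇒≤ h))) (∧-zeroʳ (isL1 (L a) ∨ (src a <ᵇ src b)))
    ... | no h = trans (crS-eval L src src a b refl e (<ᵇ-false (≮⇒≥ h)) refl refl refl)
      (trans (cong ((isL1 (L a) ∨ (src a <ᵇ src b)) ∧_) (∧-zeroʳ (src b <ᵇ src a))) (∧-zeroʳ (isL1 (L a) ∨ (src a <ᵇ src b))))

  -- Stated for any `live′` in which one of the two strips is dead, so that it serves both
  -- pointed-to tiles, where nothing new dies, and left-arrows, where `p` does.
  good-conj : ∀ {src val live fr tu fc p q} (adj : Adj L src p q) → Path L src live →
    ∀ live′ → (∀ {a} → L a ≡ l1 → live′ a ≡ true) → ∀ x → live′ x ≡ false → x ≡ p ⊎ x ≡ q →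
    Good (swp (src p) ∘ src) val live′ fr tu fc → Good src (swp (src p) ∘ val) live′ fr tu fc
  good-conj {src} {val} {p = p} {q} adj P live′ ol x xd xpq G = record
    { vals = conj-Vals L i i<N hs (λ _ → refl) bij′ ol x xd (at xpq) G.vals
    ; lrOK = trans (sum-cong-≗ (λ a → cong b2n (sym (C.conj-LR a)))) G.lrOK
    ; rlOK = trans (sum-cong-≗ (λ a → cong b2n (sym (C.conj-RL a)))) G.rlOK
    ; crOK = trans (sum₂-cong (λ a b → cong b2n (sym (C.conj-CR a b)))) G.crOK
    }
    where
    module G = Good G
    open Swap L (Path.bij P) adj
    hs : ∀ a → src a ≡ swp i (src′ a)
    hs a = sym (swp-involutive i (src a))
    at : ∀ {x} → x ≡ p ⊎ x ≡ q → src′ x ≡ i ⊎ src′ x ≡ suc i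
    at (inj₁ refl) = inj₂ src′-p
    at (inj₂ refl) = inj₁ src′-q
    module C = Conj L {val = val} {live = live′} i hs (λ _ → refl) bij′ x xd (at xpq) G.vals

  -- The induction step runs from the state after the tile to the state before it; the two added
  -- terms are what this tile contributes to the top up-arrows and to the free cells.
  good-step : ∀ {src live r fr tu fc p q} (adj : Adj L src p q) → Path L src live →
    ∀ c → Ok live (tile (L p) p (L q) q) c →
    Good (swp (src p) ∘ src) r (killT live (tile (L p) p (L q) q) c) fr tu fc →
    Good src (if (live p ∧ live q) ∧ not (isLeft c) then r else swp (src p) ∘ r) live fr
      (b2n (isUp c ∧ inStrip zero (tile (L p) p (L q) q)) + tu) (b2n (isEmpty c ∧ (live p ∧ live q)) + fc)
  good-step {src} {live} {r} {fr} {tu} {fc} {p} {q} adj P c ok G with kind live {L p} {L q} p q c ok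
  ... | dead d with deadStrip live d
  ...   | x , xd , xpq rewrite d = good-conj {p = p} adj P live (Path.oneLive P) x xd xpq G
  good-step {src} {live} {r} {fr} {tu} {fc} {p} {q} adj P c ok G | free lp lq rewrite lp | lq = record
    { vals = V
    ; lrOK = trans (sum-cong-≗ (λ a → cong b2n (S.free-LR a))) G.lrOK
    ; rlOK = trans (sum-cong-≗ (λ a → cong b2n (S.free-RL a))) G.rlOK
    ; crOK = trans (S.Free.free-crossings (λ e → free-p e G.vals) (λ e → free-q lq e G.vals)) (cong suc G.crOK)
    }
    where
    module G = Good G
    open Swap L (Path.bij P) adj
    V = free-Vals⇐ lp lq G.vals
    module S = SwapStats L (Path.bij P) adj lp lq V
  -- Two moves: undo the conjugation with `p` still dead, which leaves `p` a fixed point at `i`,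
  -- then revive `p`, which changes no statistic.
  good-step {src} {live} {r} {fr} {tu} {fc} {p} {q} adj P c ok G | leftK lp lq rewrite lp | lq = record
    { vals = V
    ; lrOK = trans (sum-cong-≗ (λ a → cong b2n (K.kill-LR a))) C.lrOK
    ; rlOK = trans (sum-cong-≗ (λ a → cong b2n (K.kill-RL a))) C.rlOK
    ; crOK = trans (sum₂-cong (λ a b → cong b2n (K.kill-CR a b))) C.crOK
    }
    where
    ep = proj₁ ok
    module C = Good (good-conj {p = p} adj P (kill p live)
      (oneLive-kill L ep P) p (kill-self p live) (inj₁ refl) G)
    V = unkill-Vals L ep C.vals
    module K = KillRow L (Path.bij P) adj lp lq ep (Vals.dead C.vals (kill-self p live)) V
  good-step {src} {live} {r} {fr} {tu} {fc} {p} {q} adj P c ok G | upK lp lq rewrite lp | lq = record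
    { vals = V
    ; lrOK = trans (sum-cong-≗ (λ a → cong b2n (S.up-LR a))) G.lrOK
    ; rlOK = trans (S.up-RL P) (cong₂ (λ x y → b2n x + y) top G.rlOK)
    ; crOK = trans (sum₂-cong (λ a b → cong b2n (S.up-CR a b))) G.crOK
    }
    where
    module G = Good G
    open Swap L (Path.bij P) adj
    V = up-Vals⇐ lp lq G.vals
    module S where
      open SwapStats L (Path.bij P) adj lp lq V public
      open Up (proj₁ ok) (up-q G.vals) public
    -- `topupR` asks whether either strip of the tile is strip zero; the column `q` cannot be, since
    -- strip zero is diagonal.
    top : ⌊ p ≟F zero ⌋ ≡ ⌊ p ≟F zero ⌋ ∨ ⌊ q ≟F zero ⌋
    top = sym (trans (cong (⌊ p ≟F zero ⌋ ∨_) (⌊⌋-false {d = q ≟F zero}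
            (λ { refl → l1≢l0 (Path.first P) (proj₁ ok) }))) (∨-identityʳ _))

  good : ∀ {src live ts} cs → Run src ts → Path L src live → Valid live ts cs →
    Good src (valOf src live ts cs) live (frowR live ts cs) (topupR ts cs) (fcellR live ts cs)
  good [] (done sorted) P v = good-done sorted P v
  good (c ∷ cs) (step p q adj r) P (ok , v) = good-step adj P c ok (good cs r (path-killT adj c ok P) v)

-- Recovering the filling from the permutation

_≟l_ : (l l′ : Letter) → Dec (l ≡ l′)
l0 ≟l l0 = yes refl
l0 ≟l l1 = no λ ()
l0 ≟l l2 = no λ ()
l1 ≟l l0 = no λ ()
l1 ≟l l1 = yes refl
l1 ≟l l2 = no λ ()
l2 ≟l l0 = no λ ()
l2 ≟l l1 = no λ ()
l2 ≟l l2 = yes refl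

module _ {m : ℕ} (L : Fin (suc m) → Letter) where

  private
    N : ℕ
    N = suc m

  -- The content of a tile can be read off the state before it.
  Trace : (val : Fin N → ℕ) (live : Fin N → Bool) (i : ℕ) (p q : Fin N) → Content → Set
  Trace val live i p q empty = live p ≡ true → live q ≡ true → (L p ≡ l2 → val p ≢ i) × (L q ≡ l0 → val q ≢ i)
  Trace val live i p q left = val p ≡ i
  Trace val live i p q up = val q ≡ i

  trace-step : ∀ {src live r fr tu fc p q} (adj : Adj L src p q) → Path L src live →
    ∀ c → Ok live (tile (L p) p (L q) q) c →
    Good L (swp (src p) ∘ src) r (killT live (tile (L p) p (L q) q) c) fr tu fc →
    Trace (if (live p ∧ live q) ∧ not (isLeft c) then r else swp (src p) ∘ r) live (src p) p q c
  trace-step {p = p} {q} adj P empty ok G lp lq rewrite lp | lq =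
    (λ e → free-p e (Good.vals G)) , (λ e → free-q lq e (Good.vals G))
    where open Swap L (Path.bij P) adj
  trace-step {src} {live} {r} {p = p} {q} adj P left (_ , lp , lq) G rewrite lp | lq =
    trans (cong (swp i) (trans (Vals.dead (Good.vals G) (kill-self p live)) src′-p)) (swp-right i)
    where open Swap L (Path.bij P) adj
  trace-step {p = p} {q} adj P up (_ , lp , lq) G rewrite lp | lq = up-q (Good.vals G)
    where open Swap L (Path.bij P) adj

  trace : ∀ {src live ts p q} c cs (adj : Adj L src p q) → Run L (swp (src p) ∘ src) ts → Path L src live →
    Valid L live (tile (L p) p (L q) q ∷ ts) (c ∷ cs) →
    Trace (valOf src live (tile (L p) p (L q) q ∷ ts) (c ∷ cs)) live (src p) p q c
  trace c cs adj r P (ok , v) = trace-step adj P c ok (good L cs r (path-killT L adj c ok P) v)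

  -- Arrows need both strips live, and then the trace of an empty tile denies the trace of either
  -- arrow. A left-arrow and an up-arrow would give `p` and `q` the same value.
  trace-unique : ∀ {src val val′ live p q} c c′ → Adj L src p q → Vals L src val live → (∀ a → val a ≡ val′ a) →
    Ok live (tile (L p) p (L q) q) c → Ok live (tile (L p) p (L q) q) c′ →
    Trace val live (src p) p q c → Trace val′ live (src p) p q c′ → c ≡ c′
  trace-unique empty empty _ _ _ _ _ _ _ = refl
  trace-unique left left _ _ _ _ _ _ _ = refl
  trace-unique up up _ _ _ _ _ _ _ = refl
  trace-unique empty left _ _ h _ (e , lp , lq) t t′ = ⊥-elim (proj₁ (t lp lq) e (trans (h _) t′))
  trace-unique empty up _ _ h _ (e , lp , lq) t t′ = ⊥-elim (proj₂ (t lp lq) e (trans (h _) t′))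
  trace-unique left empty _ _ h (e , lp , lq) _ t t′ = ⊥-elim (proj₁ (t′ lp lq) e (trans (sym (h _)) t))
  trace-unique up empty _ _ h (e , lp , lq) _ t t′ = ⊥-elim (proj₂ (t′ lp lq) e (trans (sym (h _)) t))
  trace-unique left up adj V h _ _ t t′ with Bij.inj (Vals.bij V) (trans t (sym (trans (h _) t′)))
  ... | refl = ⊥-elim (1+n≢n (sym (Adj.next adj)))
  trace-unique up left adj V h _ _ t t′ with Bij.inj (Vals.bij V) (trans t (sym (trans (h _) t′)))
  ... | refl = ⊥-elim (1+n≢n (sym (Adj.next adj)))

  if-cancel : ∀ b i {f g : Fin N → ℕ} → (∀ a → (if b then f else swp i ∘ f) a ≡ (if b then g else swp i ∘ g) a) →
    ∀ a → f a ≡ g a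
  if-cancel true i h a = h a
  if-cancel false i h a = swp-injective i (h a)

  valOf-injective : ∀ {src live ts} cs cs′ → Run L src ts → Path L src live → Valid L live ts cs → Valid L live ts cs′ →
    (∀ a → valOf src live ts cs a ≡ valOf src live ts cs′ a) → cs ≡ cs′
  valOf-injective [] [] (done _) P v v′ h = refl
  valOf-injective {src} {live} (c ∷ cs) (c′ ∷ cs′) (step p q adj r) P v v′ h
    with trace-unique c c′ adj (Good.vals (good L (c ∷ cs) (step p q adj r) P v)) h (proj₁ v) (proj₁ v′)
           (trace c cs adj r P v) (trace c′ cs′ adj r P v′)
  ... | refl = cong (c ∷_) (valOf-injective cs cs′ r (path-killT L adj c (proj₁ v) P) (proj₂ v) (proj₂ v′)
                 (if-cancel (liveT live (tile (L p) p (L q) q) ∧ not (isLeft c)) (src p) h))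

  module _ {src val : Fin N → ℕ} {live : Fin N → Bool} (sorted : ∀ a b → src a < src b → lval (L a) ≤ lval (L b))
    (P : Path L src live) (V : Vals L src val live) where
    private
      module P = Path P
      module V = Vals V

    -- Columns in front of strip zero are dead by `dead-before`, and on a sorted path none lies
    -- behind it.
    sorted-zeros : ∀ ℓ → L ℓ ≡ l0 → live ℓ ≡ false
    sorted-zeros ℓ e with <-cmp (src ℓ) (src zero)
    ... | tri< h _ _ = dead-before L P V ℓ h
    ... | tri≈ _ h _ with Bij.inj P.bij h
    ...   | refl = l1≢l0 P.first e
    sorted-zeros ℓ e | tri> _ _ h = ⊥-elim (<⇒≱ (n<1+n 0) (subst₂ _≤_ (cong lval P.first) (cong lval e) (sorted zero ℓ h)))

    -- Rows end the sorted path, so induction runs from the far end, `d` bounding the distance to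
    -- it. A row with a value beyond its place would take the place of a later row, which is already
    -- fixed.
    sorted-twos : ∀ d a → N ≤ d + src a → L a ≡ l2 → val a ≡ src a
    sorted-twos zero a h e = ⊥-elim (<⇒≱ (Bij.bound P.bij a) h)
    sorted-twos (suc d) a h e with m≤n⇒m<n∨m≡n (V.two e)
    ... | inj₂ eq = sym eq
    ... | inj₁ lt with Bij.surj P.bij (Bij.bound V.bij a)
    ...   | b , sb = ⊥-elim (<-irrefl (trans (cong src (sym b≡a)) sb) lt)
      where
      src< : src a < src b
      src< = subst (src a <_) (sym sb) lt
      Lb : ∀ l → L b ≡ l → L b ≡ l2
      Lb l2 eb = eb
      Lb l1 eb = ⊥-elim (<⇒≱ (n<1+n 1) (subst₂ _≤_ (cong lval e) (cong lval eb) (sorted a b src<)))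
      Lb l0 eb = ⊥-elim (<⇒≱ (s≤s z≤n) (subst₂ _≤_ (cong lval e) (cong lval eb) (sorted a b src<)))
      vb : val b ≡ src b
      vb = sorted-twos d b (≤-trans h (≤-trans (≤-reflexive (sym (+-suc d (src a)))) (+-monoʳ-≤ d src<))) (Lb (L b) refl)
      b≡a : b ≡ a
      b≡a = Bij.inj V.bij (trans vb sb)

    -- Everything in front of `a` is fixed, so its value cannot be smaller than its place. Were it
    -- larger, the strip `c` with value `src a` would lie behind `a`: a diagonal `c` breaks
    -- `oneInc`, and a row `c` breaks `two`.
    sorted-ones : ∀ n a → src a < n → L a ≡ l1 → val a ≡ src a
    sorted-ones (suc n) a h e = go (<-cmp (val a) (src a))
      where
      lower : ∀ b → src b < src a → val b ≡ src b
      lower b lt = by (L b) refl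
        where
        by : ∀ l → L b ≡ l → val b ≡ src b
        by l0 eb = V.dead (sorted-zeros b eb)
        by l1 eb = sorted-ones n b (<-≤-trans lt (m<1+n⇒m≤n h)) eb
        by l2 eb = ⊥-elim (<⇒≱ (n<1+n 1) (subst₂ _≤_ (cong lval eb) (cong lval e) (sorted b a lt)))
      go : Tri (val a < src a) (val a ≡ src a) (src a < val a) → val a ≡ src a
      go (tri≈ _ eq _) = eq
      go (tri< lt _ _) with Bij.surj P.bij (<-trans lt (Bij.bound P.bij a))
      ... | b , sb with Bij.inj V.bij (trans (lower b (subst (_< src a) (sym sb) lt)) sb)
      ...   | refl = sym sb
      go (tri> _ _ gt) with Bij.surj V.bij (Bij.bound P.bij a)
      ... | c , vc with <-cmp (src c) (src a)
      ...   | tri< lt _ _ = ⊥-elim (<-irrefl (trans (sym (lower c lt)) vc) lt)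
      ...   | tri≈ _ eq _ = trans (cong val (sym (Bij.inj P.bij eq))) vc
      ...   | tri> _ _ lt = ⊥-elim (by (L c) refl)
        where
        by : ∀ l → L c ≡ l → ⊥
        by l0 ec = <⇒≱ (n<1+n 0) (subst₂ _≤_ (cong lval e) (cong lval ec) (sorted a c lt))
        by l1 ec = <-asym gt (subst (val a <_) vc (V.oneInc e ec lt))
        by l2 ec = <⇒≱ lt (subst (src c ≤_) vc (V.two ec))

    sorted-fixed : ∀ a → src a ≡ val a
    sorted-fixed a = by (L a) refl
      where
      by : ∀ l → L a ≡ l → src a ≡ val a
      by l0 e = sym (V.dead (sorted-zeros a e))
      by l1 e = sym (sorted-ones (suc (src a)) a (n<1+n _) e)
      by l2 e = sym (sorted-twos N a (m≤m+n N (src a)) e)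

  Filling : (Fin N → ℕ) → (Fin N → ℕ) → (Fin N → Bool) → List (Tile N) → Set
  Filling src val live ts = ∃ λ cs → Valid L live ts cs × (∀ a → valOf src live ts cs a ≡ val a)

  filling-∷ : ∀ {src val live ts p q} (val′ : Fin N → ℕ) c → Ok live (tile (L p) p (L q) q) c →
    (∀ {r : Fin N → ℕ} → (∀ a → r a ≡ val′ a) →
      ∀ a → (if (live p ∧ live q) ∧ not (isLeft c) then r else swp (src p) ∘ r) a ≡ val a) →
    Filling (swp (src p) ∘ src) val′ (killT live (tile (L p) p (L q) q) c) ts →
    Filling src val live (tile (L p) p (L q) q ∷ ts)
  filling-∷ val′ c ok h (cs , v , e) = c ∷ cs , (ok , v) , h e

  -- The decoder: a tile on a dead strip stays empty, otherwise the values of `p` and `q` are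
  -- compared with `i`. Testing for the left-arrow first loses nothing, since both tests cannot
  -- succeed.
  filling : ∀ {src val live ts} → Run L src ts → Path L src live → Vals L src val live → Filling src val live ts
  filling (done sorted) P V = [] , sorted-zeros sorted P V , sorted-fixed sorted P V
  filling {src} {val} {live} (step {ts = ts} p q adj r) P V with emptyKind live p q
  ... | dead d with deadStrip live d
  ...   | x , xd , xpq = filling-∷ {p = p} (swp i ∘ val) empty tt unconj
          (filling r (path-killT L adj empty tt P)
            (conj-Vals L i i<N (λ _ → refl) (λ _ → refl) (Path.bij P) (Path.oneLive P) x xd (at xpq) V))
    where
    open Swap L (Path.bij P) adj
    at : ∀ {x} → x ≡ p ⊎ x ≡ q → src x ≡ i ⊎ src x ≡ suc i
    at (inj₁ refl) = inj₁ refl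
    at (inj₂ refl) = inj₂ next
    unconj : ∀ {r : Fin N → ℕ} → (∀ a → r a ≡ swp i (val a)) →
      ∀ a → (if (live p ∧ live q) ∧ true then r else swp i ∘ r) a ≡ val a
    unconj h a rewrite d = trans (cong (swp i) (h a)) (swp-involutive i (val a))
  filling {src} {val} {live} (step {ts = ts} p q adj r) P V | free lp lq
    with (L p ≟l l2) ×-dec (val p ≟ src p) | (L q ≟l l0) ×-dec (val q ≟ src p)
  ... | yes (ep , vp) | _ = filling-∷ {p = p} (swp i ∘ val) left (ep , lp , lq) unconj
          (filling r (path-killT L adj left (ep , lp , lq) P)
            (conj-Vals L i i<N (λ _ → refl) (λ _ → refl) (Path.bij P)
              (oneLive-kill L ep P)
              p (kill-self p live) (inj₁ refl) (kill-Vals L ep vp V)))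
    where
    open Swap L (Path.bij P) adj
    unconj : ∀ {r : Fin N → ℕ} → (∀ a → r a ≡ swp i (val a)) →
      ∀ a → (if (live p ∧ live q) ∧ false then r else swp i ∘ r) a ≡ val a
    unconj h a rewrite ∧-zeroʳ (live p ∧ live q) = trans (cong (swp i) (h a)) (swp-involutive i (val a))
  ... | no _ | yes (eq , vq) = filling-∷ {p = p} val up (eq , lp , lq) keep
          (filling r (path-killT L adj up (eq , lp , lq) P) (up-Vals⇒ lp lq eq vq V))
    where
    open Swap L (Path.bij P) adj
    keep : ∀ {r : Fin N → ℕ} → (∀ a → r a ≡ val a) →
      ∀ a → (if (live p ∧ live q) ∧ true then r else swp i ∘ r) a ≡ val a
    keep h a rewrite lp | lq = h a
  ... | no hp | no hq = filling-∷ {p = p} val empty tt keep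
          (filling r (path-killT L adj empty tt P)
            (free-Vals⇒ lp lq (λ e e′ → hp (e , e′)) (λ e e′ → hq (e , e′)) V))
    where
    open Swap L (Path.bij P) adj
    keep : ∀ {r : Fin N → ℕ} → (∀ a → r a ≡ val a) →
      ∀ a → (if (live p ∧ live q) ∧ true then r else swp i ∘ r) a ≡ val a
    keep h a rewrite lp | lq = h a

-- Tilings as runs

data At {A : Set} : ℕ → List A → A → Set where
  here  : ∀ {x xs} → At 0 (x ∷ xs) x
  there : ∀ {k x y xs} → At k xs y → At (suc k) (x ∷ xs) y

data SwapAt {n : ℕ} : ℕ → Tile n → List (Letter × Fin n) → List (Letter × Fin n) → Set where
  here  : ∀ {a p b q ys} → lval b < lval a →
          SwapAt 0 (tile a p b q) ((a , p) ∷ (b , q) ∷ ys) ((b , q) ∷ (a , p) ∷ ys)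
  there : ∀ {i t x u u′} → SwapAt i t u u′ → SwapAt (suc i) t (x ∷ u) (x ∷ u′)

firstSwapFrom-just : ∀ {n} (x : Letter × Fin n) xs {t u} → firstSwapFrom x xs ≡ just (t , u) →
  ∃ λ i → SwapAt i t (x ∷ xs) u
firstSwapFrom-just (a , p) ((b , q) ∷ rest) e with a >L b in gt
firstSwapFrom-just (a , p) ((b , q) ∷ rest) refl | true = 0 , here (⌊⌋-elim (≡true⇒T gt))
firstSwapFrom-just (a , p) ((b , q) ∷ rest) e | false with firstSwapFrom (b , q) rest in eq
firstSwapFrom-just (a , p) ((b , q) ∷ rest) refl | false | just (t , u) with firstSwapFrom-just (b , q) rest eq
... | i , s = suc i , there s

>L-false : ∀ a b → (a >L b) ≡ false → lval a ≤ lval b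
>L-false a b e = ≮⇒≥ (λ h → true≢false (⌊⌋-true h) e)

firstSwapFrom-nothing : ∀ {n} (x : Letter × Fin n) xs → firstSwapFrom x xs ≡ nothing →
  ∀ {k z} → At k xs z → lval (proj₁ x) ≤ lval (proj₁ z)
firstSwapFrom-nothing (a , p) ((b , q) ∷ rest) e at with a >L b in gt
firstSwapFrom-nothing (a , p) ((b , q) ∷ rest) e at | false with firstSwapFrom (b , q) rest in eq
firstSwapFrom-nothing (a , p) ((b , q) ∷ rest) e here | false | nothing = >L-false a b gt
firstSwapFrom-nothing (a , p) ((b , q) ∷ rest) e (there at) | false | nothing =
  ≤-trans (>L-false a b gt) (firstSwapFrom-nothing (b , q) rest eq at)

firstSwapFrom-tail : ∀ {n} (x y : Letter × Fin n) xs → firstSwapFrom x (y ∷ xs) ≡ nothing → firstSwapFrom y xs ≡ nothing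
firstSwapFrom-tail (a , p) (b , q) rest e with a >L b
firstSwapFrom-tail (a , p) (b , q) rest e | false with firstSwapFrom (b , q) rest
... | nothing = refl

firstSwap-nothing : ∀ {n} (u : List (Letter × Fin n)) → firstSwap u ≡ nothing →
  ∀ {j k y z} → j < k → At j u y → At k u z → lval (proj₁ y) ≤ lval (proj₁ z)
firstSwap-nothing (x ∷ xs) e lt here (there at) = firstSwapFrom-nothing x xs e at
firstSwap-nothing (x ∷ y ∷ xs) e (s≤s lt) (there at) (there at′) =
  firstSwap-nothing (y ∷ xs) (firstSwapFrom-tail x y xs e) lt at at′

firstSwap-just : ∀ {n} (u : List (Letter × Fin n)) {t u′} → firstSwap u ≡ just (t , u′) → ∃ λ i → SwapAt i t u u′
firstSwap-just (x ∷ xs) e = firstSwapFrom-just x xs e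

SwapAt-At⇒ : ∀ {n i t u u′ k} {z : Letter × Fin n} → SwapAt i t u u′ → At k u z → At (swp i k) u′ z
SwapAt-At⇒ (here _) here = there here
SwapAt-At⇒ (here _) (there here) = here
SwapAt-At⇒ (here _) (there (there at)) = there (there at)
SwapAt-At⇒ (there s) here = here
SwapAt-At⇒ (there s) (there at) = there (SwapAt-At⇒ s at)

SwapAt-At⇐ : ∀ {n i t u u′ k} {z : Letter × Fin n} → SwapAt i t u u′ → At k u′ z → At (swp i k) u z
SwapAt-At⇐ (here _) here = there here
SwapAt-At⇐ (here _) (there here) = here
SwapAt-At⇐ (here _) (there (there at)) = there (there at)
SwapAt-At⇐ (there s) here = here
SwapAt-At⇐ (there s) (there at) = there (SwapAt-At⇐ s at)

SwapAt-tile : ∀ {n i t u u′} → SwapAt {n} i t u u′ →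
  At i u (letter₁ t , label₁ t) × At (suc i) u (letter₂ t , label₂ t) × lval (letter₂ t) < lval (letter₁ t)
SwapAt-tile (here h) = here , there here , h
SwapAt-tile (there s) with SwapAt-tile s
... | a , b , h = there a , there b , h

At-zip : ∀ {n} {A B : Set} (w : Vec A n) (f : Fin n → B) a →
  At (toℕ a) (Vec.toList (Vec.zip w (tabulate f))) (lookup w a , f a)
At-zip (x ∷ w) f zero = here
At-zip (x ∷ w) f (suc a) = there (At-zip w (f ∘ suc) a)

At-zip⁻ : ∀ {n} {A B : Set} (w : Vec A n) (f : Fin n → B) {k l b} →
  At k (Vec.toList (Vec.zip w (tabulate f))) (l , b) → ∃ λ a → k ≡ toℕ a × l ≡ lookup w a × b ≡ f a
At-zip⁻ (x ∷ w) f here = zero , refl , refl , refl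
At-zip⁻ (x ∷ w) f (there at) with At-zip⁻ w (f ∘ suc) at
... | a , refl , e , e′ = suc a , refl , e , e′

-- Pointing arrows in terms of live strips

anyF-false : ∀ {n} {p : Fin n → Bool} → (∀ k → p k ≡ false) → anyL p (fins n) ≡ false
anyF-false {n} h = trans (anyL-cong h (fins n)) (go (fins n))
  where
  go : ∀ {A : Set} (xs : List A) → anyL (λ _ → false) xs ≡ false
  go [] = refl
  go (x ∷ xs) = go xs

-- `pointsTo` for an arbitrary list of tiles, so that tiles can be peeled off one by one. For a
-- whole tiling the two agree by definition.
pts : ∀ {n} (ts : List (Tile n)) → Vec Content (length ts) → Fin (length ts) → Fin (length ts) → Bool
pts ts cs k k′ =
  ⌊ k Fin.<? k′ ⌋ ∧
    ((isLeft (lookup cs k) ∧ inStrip (label₁ (List.lookup ts k)) (List.lookup ts k′))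
     ∨ (isUp (lookup cs k) ∧ inStrip (label₂ (List.lookup ts k)) (List.lookup ts k′)))

pointed : ∀ {n} → Content → Tile n → Tile n → Bool
pointed c t t′ = (isLeft c ∧ inStrip (label₁ t) t′) ∨ (isUp c ∧ inStrip (label₂ t) t′)

pts-suc : ∀ {n} t (ts : List (Tile n)) c cs k k′ → pts (t ∷ ts) (c ∷ cs) (suc k) (suc k′) ≡ pts ts cs k k′
pts-suc t ts c cs k k′ = cong (_∧ pointed (lookup cs k) (List.lookup ts k) (List.lookup ts k′)) (⌊⌋-ext {d = suc k Fin.<? suc k′} {e = k Fin.<? k′} (λ { (s≤s h) → h }) s≤s)

liveT-kill : ∀ {n} x (live : Fin n → Bool) t → liveT (kill x live) t ≡ not (inStrip x t) ∧ liveT live t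
liveT-kill x live t = go ⌊ label₁ t ≟F x ⌋ ⌊ label₂ t ≟F x ⌋ (live (label₁ t)) (live (label₂ t))
  where
  go : ∀ a b l l′ → (not a ∧ l) ∧ (not b ∧ l′) ≡ not (a ∨ b) ∧ (l ∧ l′)
  go true b l l′ = refl
  go false true l l′ = ∧-zeroʳ l
  go false false l l′ = refl

-- The dictionary between arrows and liveness: the cells an arrow points at are those later tiles
-- that lie in the strip it kills.
liveT-killT : ∀ {n} (live : Fin n → Bool) t c t′ → liveT (killT live t c) t′ ≡ not (pointed c t t′) ∧ liveT live t′
liveT-killT live t empty t′ = refl
liveT-killT live t left t′ = trans (liveT-kill (label₁ t) live t′)
  (cong (λ x → not x ∧ liveT live t′) (sym (∨-identityʳ (inStrip (label₁ t) t′))))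
liveT-killT live t up t′ = liveT-kill (label₂ t) live t′

inStrip⇒ : ∀ {n} (ℓ : Fin n) t → T (inStrip ℓ t) → label₁ t ≡ ℓ ⊎ label₂ t ≡ ℓ
inStrip⇒ ℓ t h with label₁ t ≟F ℓ | label₂ t ≟F ℓ
... | yes e | _ = inj₁ e
... | no _ | yes e = inj₂ e

T-not-∧ : ∀ {x y} → (T x → ⊥) → T y → T (not x ∧ y)
T-not-∧ {true} h _ = h tt
T-not-∧ {false} _ h = h

-- Interpolates between `fcellStat` and `fcellR`: arrows already passed exclude cells through
-- `live`, arrows still to come through `pts`.
fcellG : ∀ {n} → (Fin n → Bool) → (ts : List (Tile n)) → Vec Content (length ts) → ℕ
fcellG live ts cs = sum (λ k′ → b2n (isEmpty (lookup cs k′) ∧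
  (not (anyL (λ k → pts ts cs k k′) (fins (length ts))) ∧ liveT live (List.lookup ts k′))))

fcellG≡fcellR : ∀ {n} live (ts : List (Tile n)) cs → fcellG live ts cs ≡ fcellR live ts cs
fcellG≡fcellR live [] [] = refl
fcellG≡fcellR live (t ∷ ts) (c ∷ cs) = cong₂ _+_
  (cong (λ x → b2n (isEmpty c ∧ (not x ∧ liveT live t))) (anyF-false none))
  (trans (sum-cong-≗ (λ j → cong (λ x → b2n (isEmpty (lookup cs j) ∧ x)) (later j)))
    (fcellG≡fcellR (killT live t c) ts cs))
  where
  none : ∀ k → pts (t ∷ ts) (c ∷ cs) k zero ≡ false
  none zero = refl
  none (suc k) = refl
  shuffle : ∀ a b l → not (a ∨ b) ∧ l ≡ not b ∧ (not a ∧ l)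
  shuffle true true l = refl
  shuffle true false l = refl
  shuffle false b l = refl
  later : ∀ j →
    not (anyL (λ k → pts (t ∷ ts) (c ∷ cs) k (suc j)) (fins (suc (length ts)))) ∧ liveT live (List.lookup ts j) ≡
    not (anyL (λ k → pts ts cs k j) (fins (length ts))) ∧ liveT (killT live t c) (List.lookup ts j)
  later j = trans
    (cong (λ x → not x ∧ liveT live (List.lookup ts j))
      (trans (anyF-suc (λ k → pts (t ∷ ts) (c ∷ cs) k (suc j)))
        (cong (pointed c t (List.lookup ts j) ∨_) (anyL-cong (λ k → pts-suc t ts c cs k j) (fins (length ts))))))
    (trans (shuffle (pointed c t (List.lookup ts j)) _ _)
      (cong (not (anyL (λ k → pts ts cs k j) (fins (length ts))) ∧_) (sym (liveT-killT live t c (List.lookup ts j)))))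

topup≡topupR : ∀ {n} (ts : List (Tile (suc n))) cs →
  sum (λ k → b2n (isUp (lookup cs k) ∧ inStrip zero (List.lookup ts k))) ≡ topupR ts cs
topup≡topupR [] [] = refl
topup≡topupR (t ∷ ts) (c ∷ cs) = cong (b2n (isUp c ∧ inStrip zero t) +_) (topup≡topupR ts cs)

module _ {m : ℕ} (L : Fin (suc m) → Letter) where

  private
    N : ℕ
    N = suc m

  inversion : (Fin N → ℕ) → Fin N → Fin N → Bool
  inversion src a b = (src a <ᵇ src b) ∧ (L a >L L b)

  inversions : (Fin N → ℕ) → ℕ
  inversions src = sum₂ (λ a b → b2n (inversion src a b))

  inversions-swap : ∀ {src p q} → Bij src → Adj L src p q → inversions src ≡ suc (inversions (swp (src p) ∘ src))
  inversions-swap {src} {p} {q} bs adj = trans (sum₂-cong pt) (trans (sum₂-+ n₂ (δ₂ p q))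
      (trans (cong (sum₂ n₂ +_) (sum₂-δ₂ p q)) (+-comm (sum₂ n₂) 1)))
    where
    open Swap L bs adj
    n₁ n₂ : Fin N → Fin N → ℕ
    n₁ a b = b2n (inversion src a b)
    n₂ a b = b2n (inversion src′ a b)
    plus0 : ∀ {a b} → ¬ (a ≡ p × b ≡ q) → n₁ a b ≡ n₂ a b → n₁ a b ≡ n₂ a b + δ₂ p q a b
    plus0 {a} {b} h e = trans e (sym (trans (cong (n₂ a b +_) (δ₂-miss h)) (+-identityʳ _)))
    pt : ∀ a b → n₁ a b ≡ n₂ a b + δ₂ p q a b
    pt a b = case (a ≟F p) ×-dec (b ≟F q) of λ
      { (yes (refl , refl)) → trans
          (cong b2n (cong₂ _∧_ (<ᵇ-true (subst (i <_) (sym next) (n<1+n i))) (⌊⌋-true {d = lval (L q) <? lval (L p)} desc)))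
          (sym (cong₂ _+_ (cong (λ x → b2n (x ∧ (L p >L L q))) (<ᵇ-false (subst₂ _≤_ (sym src′-q) (sym src′-p) (n≤1+n i))))
            (δ₂-hit p q)))
      ; (no h) → plus0 h (case (a ≟F q) ×-dec (b ≟F p) of λ
          { (yes (refl , refl)) → cong b2n (trans (∧-falseʳ (src q <ᵇ src p) notdesc) (sym (∧-falseʳ (src′ q <ᵇ src′ p) notdesc)))
          ; (no h₂) → cong (λ x → b2n (x ∧ (L a >L L b))) (sym (src′-<ᵇ a b h h₂)) }) }
      where
      notdesc : (L q >L L p) ≡ false
      notdesc = ⌊⌋-false (<-asym desc)

  inversions-bound : ∀ src → inversions src ≤ N * N
  inversions-bound src = sum-≤ _ N (λ a → ≤-trans (sum-≤ _ 1 (λ b → bit (inversion src a b))) (≤-reflexive (*-identityʳ N)))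
    where
    bit : ∀ x → b2n x ≤ 1
    bit true = ≤-refl
    bit false = z≤n

  -- Each tile removes exactly one inversion of the path, and a sorted path has none.
  run-length : ∀ {src ts} → Bij src → Run L src ts → length ts ≡ inversions src
  run-length {src} bs (done sorted) = sym (sum₂-zero _ (λ a b → cong b2n (zero′ a b)))
    where
    zero′ : ∀ a b → inversion src a b ≡ false
    zero′ a b with src a <? src b
    ... | yes h = ∧-falseʳ (src a <ᵇ src b) (⌊⌋-false (≤⇒≯ (sorted a b h)))
    ... | no h = cong (_∧ (L a >L L b)) (<ᵇ-false (≮⇒≥ h))
  run-length bs (step p q adj r) =
    trans (cong suc (run-length (Swap.bij′ L bs adj) r)) (sym (inversions-swap bs adj))

  record Located (u : List (Letter × Fin N)) (src : Fin N → ℕ) : Set where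
    field
      place  : ∀ a → At (src a) u (L a , a)
      unique : ∀ {k l a} → At k u (l , a) → k ≡ src a × l ≡ L a

  -- Fuel and inversions drop together, so the bound persists, and exhausted fuel means that the
  -- path is sorted. The fuel of `tiling` is enough by `inversions-bound`.
  run : ∀ k u src → Bij src → Located u src → inversions src ≤ k → Run L src (tilesFuel k u)
  run zero u src bs loc h = done sorted
    where
    sorted : ∀ a b → src a < src b → lval (L a) ≤ lval (L b)
    sorted a b lt = >L-false (L a) (L b) (b2n-zero (trans (cong (λ x → b2n (x ∧ (L a >L L b))) (sym (<ᵇ-true lt)))
                      (sum₂-≡0 (λ a b → b2n (inversion src a b)) (n≤0⇒n≡0 h) a b)))
      where
      b2n-zero : ∀ {x} → b2n x ≡ 0 → x ≡ false
      b2n-zero {false} _ = refl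
  run (suc k) u src bs loc h with firstSwap u in e
  ... | nothing = done (λ a b lt → firstSwap-nothing u e lt (Located.place loc a) (Located.place loc b))
  ... | just (t , u′) with firstSwap-just u e
  ...   | i , s with SwapAt-tile s
  ...     | at₁ , at₂ , lt with Located.unique loc at₁ | Located.unique loc at₂
  ...       | refl , refl | e₂ , refl = step (label₁ t) (label₂ t) adj
                (run k u′ _ (Swap.bij′ L bs adj) loc′
                  (s≤s⁻¹ (≤-trans (≤-reflexive (sym (inversions-swap bs adj))) h)))
    where
    adj : Adj L src (label₁ t) (label₂ t)
    adj = record { next = sym e₂ ; desc = lt }
    loc′ : Located u′ (swp (src (label₁ t)) ∘ src)
    loc′ = record
      { place = λ a → SwapAt-At⇒ s (Located.place loc a)
      ; unique = λ {k} {l} {a} at → let (ek , el) = Located.unique loc (SwapAt-At⇐ s at) in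
          trans (sym (swp-involutive _ k)) (cong (swp (src (label₁ t))) ek) , el }

  -- The conditions on an extended tableau for the tiles that remain. Earlier arrows survive only
  -- through `live`: `alive` forbids arrows in cells they point at, and `cols` asks only for columns
  -- that have no up-arrow yet.
  record RATG (live : Fin N → Bool) (ts : List (Tile N)) (cs : Vec Content (length ts)) : Set where
    field
      upC   : ∀ k → lookup cs k ≡ up → letter₂ (List.lookup ts k) ≡ l0
      leftR : ∀ k → lookup cs k ≡ left → letter₁ (List.lookup ts k) ≡ l2
      notP  : ∀ k k′ → T (pts ts cs k k′) → lookup cs k′ ≡ empty
      alive : ∀ k → lookup cs k ≢ empty → T (liveT live (List.lookup ts k))
      cols  : ∀ ℓ → L ℓ ≡ l0 → live ℓ ≡ true → ∃ λ k → lookup cs k ≡ up × T (inStrip ℓ (List.lookup ts k))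

  RATG⇒Valid : ∀ {src live ts} cs → Run L src ts → Bij src → RATG live ts cs → Valid L live ts cs
  RATG⇒Valid {live = live} [] (done _) bs R ℓ e with live ℓ in l
  ... | false = refl
  ... | true with RATG.cols R ℓ e l
  ...   | () , _
  RATG⇒Valid {live = live} (c ∷ cs) (step {ts = ts} p q adj r) bs R =
    ok c R.leftR R.upC R.alive , RATG⇒Valid cs r (Swap.bij′ L bs adj) tail
    where
    module R = RATG R
    t : Tile N
    t = tile (L p) p (L q) q
    open Swap L bs adj using (Lp≢0)
    ok : ∀ c → (∀ k → lookup (c ∷ cs) k ≡ left → letter₁ (List.lookup (t ∷ ts) k) ≡ l2) →
      (∀ k → lookup (c ∷ cs) k ≡ up → letter₂ (List.lookup (t ∷ ts) k) ≡ l0) →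
      (∀ k → lookup (c ∷ cs) k ≢ empty → T (liveT live (List.lookup (t ∷ ts) k))) → Ok live t c
    ok empty _ _ _ = tt
    ok left lr _ al = lr zero refl , T⇒≡true (∧-elimˡ (al zero λ ())) , T⇒≡true (∧-elimʳ {live p} (al zero λ ()))
    ok up _ uc al = uc zero refl , T⇒≡true (∧-elimˡ (al zero λ ())) , T⇒≡true (∧-elimʳ {live p} (al zero λ ()))
    cols′ : ∀ ℓ → L ℓ ≡ l0 → killT live t c ℓ ≡ true → live ℓ ≡ true × ¬ (c ≡ up × T (inStrip ℓ t))
    cols′ ℓ e l = split c l
      where
      split : ∀ c → killT live t c ℓ ≡ true → live ℓ ≡ true × ¬ (c ≡ up × T (inStrip ℓ t))
      split empty l = l , λ ()
      split left l = proj₂ (kill-live p live l) , λ ()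
      split up l = proj₂ (kill-live q live l) , λ { (_ , s) → case inStrip⇒ ℓ t s of λ
        { (inj₁ refl) → Lp≢0 e ; (inj₂ refl) → proj₁ (kill-live q live l) refl } }
    tail : RATG (killT live t c) ts cs
    tail = record
      { upC = R.upC ∘ suc ; leftR = R.leftR ∘ suc
      ; notP = λ k k′ h → R.notP (suc k) (suc k′) (subst T (sym (pts-suc t ts c cs k k′)) h)
      ; alive = λ k ne → subst T (sym (liveT-killT live t c (List.lookup ts k)))
                   (T-not-∧ (λ h → ne (R.notP zero (suc k) h)) (R.alive (suc k) ne))
      ; cols = λ ℓ e l → let (l′ , nz) = cols′ ℓ e l in case R.cols ℓ e l′ of λ
          { (zero , eu , s) → ⊥-elim (nz (eu , s)) ; (suc k , eu , s) → k , eu , s } }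

  Valid⇒RATG : ∀ {src live ts} cs → Run L src ts → Bij src → Valid L live ts cs → RATG live ts cs
  Valid⇒RATG {live = live} [] (done _) bs v = record
    { upC = λ () ; leftR = λ () ; notP = λ () ; alive = λ () ; cols = λ ℓ e l → true≢false l (v ℓ e) }
  Valid⇒RATG {live = live} (c ∷ cs) (step {ts = ts} p q adj r) bs (ok , v) = record
    { upC = λ { zero refl → proj₁ ok ; (suc k) e → R.upC k e }
    ; leftR = λ { zero refl → proj₁ ok ; (suc k) e → R.leftR k e }
    ; notP = notP ; alive = alive ; cols = λ ℓ e l → cols ℓ e l (killT live t c ℓ) refl }
    where
    module R = RATG (Valid⇒RATG cs r (Swap.bij′ L bs adj) v)
    t : Tile N
    t = tile (L p) p (L q) q
    empty? : ∀ c → c ≡ empty ⊎ c ≢ empty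
    empty? empty = inj₁ refl
    empty? up = inj₂ λ ()
    empty? left = inj₂ λ ()
    notP : ∀ k k′ → T (pts (t ∷ ts) (c ∷ cs) k k′) → lookup (c ∷ cs) k′ ≡ empty
    notP (suc k) (suc k′) h = R.notP k k′ (subst T (pts-suc t ts c cs k k′) h)
    notP zero (suc k′) h with empty? (lookup cs k′)
    ... | inj₁ e = e
    ... | inj₂ ne with subst T (liveT-killT live t c (List.lookup ts k′)) (R.alive k′ ne)
    ...   | h′ = ⊥-elim (clash h (∧-elimˡ h′))
      where
      clash : ∀ {x} → T x → T (not x) → ⊥
      clash {true} _ ()
    alive′ : ∀ c → Ok live t c → c ≢ empty → T (liveT live t)
    alive′ empty _ ne = ⊥-elim (ne refl)
    alive′ left (_ , lp , lq) _ = ∧-intro (≡true⇒T lp) (≡true⇒T lq)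
    alive′ up (_ , lp , lq) _ = ∧-intro (≡true⇒T lp) (≡true⇒T lq)
    alive : ∀ k → lookup (c ∷ cs) k ≢ empty → T (liveT live (List.lookup (t ∷ ts) k))
    alive zero ne = alive′ c ok ne
    alive (suc k) ne = ∧-elimʳ {not (pointed c t (List.lookup ts k))} (subst T (liveT-killT live t c (List.lookup ts k)) (R.alive k ne))
    -- A left-arrow kills a row, so a column that dies at this tile has received its up-arrow here.
    killed : ∀ c ℓ → Ok live t c → L ℓ ≡ l0 → live ℓ ≡ true → killT live t c ℓ ≡ false → c ≡ up × q ≡ ℓ
    killed empty ℓ _ e l k = true≢false l k
    killed left ℓ (ep , _) e l k with ℓ ≟F p
    ... | yes refl = l2≢l0 ep e
    ... | no _ = true≢false l k
    killed up ℓ _ e l k with ℓ ≟F q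
    ... | yes refl = refl , refl
    ... | no _ = true≢false l k
    cols : ∀ ℓ → L ℓ ≡ l0 → live ℓ ≡ true → ∀ x → killT live t c ℓ ≡ x →
      ∃ λ k → lookup (c ∷ cs) k ≡ up × T (inStrip ℓ (List.lookup (t ∷ ts) k))
    cols ℓ e l true k with R.cols ℓ e k
    ... | k′ , eu , s = suc k′ , eu , s
    cols ℓ e l false k with killed c ℓ ok e l k
    ... | eu , refl = zero , eu , subst T (sym (∨-zeroʳ′ (⌊ p ≟F q ⌋) (⌊⌋-true {d = q ≟F q} refl))) tt
      where
      ∨-zeroʳ′ : ∀ x {y} → y ≡ true → x ∨ y ≡ true
      ∨-zeroʳ′ x refl = ∨-zeroʳ x

  frowG : (Fin N → Bool) → (ts : List (Tile N)) → Vec Content (length ts) → Fin N → Bool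
  frowG live ts cs ℓ = isL2 (L ℓ) ∧
    (live ℓ ∧ not (anyL (λ k → isLeft (lookup cs k) ∧ inStrip ℓ (List.lookup ts k)) (fins (length ts))))

  frowG≡frowR : ∀ {src live ts} cs → Run L src ts → Bij src → sum (λ ℓ → b2n (frowG live ts cs ℓ)) ≡ frowR L live ts cs
  frowG≡frowR {live = live} [] (done _) bs =
    sum-cong-≗ (λ ℓ → cong (λ x → b2n (isL2 (L ℓ) ∧ x)) (∧-identityʳ (live ℓ)))
  frowG≡frowR {live = live} (c ∷ cs) (step {ts = ts} p q adj r) bs =
    trans (sum-cong-≗ (λ ℓ → cong b2n (∧-gate (isL2 (L ℓ)) (λ e → pt ℓ (isL2⇒ e)))))
      (frowG≡frowR {live = killT live t c} cs r (Swap.bij′ L bs adj))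
    where
    open Swap L bs adj using (Lq≢2)
    t : Tile N
    t = tile (L p) p (L q) q
    pt : ∀ ℓ → L ℓ ≡ l2 →
      live ℓ ∧ not (anyL (λ k → isLeft (lookup (c ∷ cs) k) ∧ inStrip ℓ (List.lookup (t ∷ ts) k)) (fins (suc (length ts)))) ≡
      killT live t c ℓ ∧ not (anyL (λ k → isLeft (lookup cs k) ∧ inStrip ℓ (List.lookup ts k)) (fins (length ts)))
    pt ℓ e = trans (cong (λ x → live ℓ ∧ not x)
               (anyF-suc (λ k → isLeft (lookup (c ∷ cs) k) ∧ inStrip ℓ (List.lookup (t ∷ ts) k)))) (go c)
      where
      A : Bool
      A = anyL (λ k → isLeft (lookup cs k) ∧ inStrip ℓ (List.lookup ts k)) (fins (length ts))
      go : ∀ c → live ℓ ∧ not ((isLeft c ∧ inStrip ℓ t) ∨ A) ≡ killT live t c ℓ ∧ not A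
      go empty = refl
      go up = cong (_∧ not A) (sym (kill-other q live (λ { refl → Lq≢2 e })))
      go left with p ≟F ℓ | q ≟F ℓ
      ... | _ | yes refl = ⊥-elim (Lq≢2 e)
      ... | yes refl | no _ = trans (∧-zeroʳ (live p)) (sym (cong (_∧ not A) (kill-self p live)))
      ... | no p≢ℓ | no _ = cong (_∧ not A) (sym (kill-other p live (λ x → p≢ℓ (sym x))))

-- Statistics of signed permutations

open import Data.Integer as ℤ using (ℤ; +_; -[1+_])
import Data.Integer.Properties as ℤP

sum-mono : ∀ {n} {f g : Fin n → ℕ} → (∀ i → f i ≤ g i) → sum f ≤ sum g
sum-mono {zero} h = z≤n
sum-mono {suc n} h = +-mono-≤ (h zero) (sum-mono (h ∘ suc))

b2n-mono : ∀ {x y} → (T x → T y) → b2n x ≤ b2n y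
b2n-mono {true} {true} h = ≤-refl
b2n-mono {true} {false} h = ⊥-elim (h tt)
b2n-mono {false} h = z≤n

countF-mono : ∀ {n} {p q : Fin n → Bool} → (∀ i → T (p i) → T (q i)) → countF p ≤ countF q
countF-mono {p = p} {q} h =
  subst₂ _≤_ (sym (countF≡sum p)) (sym (countF≡sum q)) (sum-mono (λ i → b2n-mono (h i)))

guard-intro : ∀ {A C : Set} (d : Dec A) b (e : Dec C) → (A ⊎ T b → C) → T (not (⌊ d ⌋ ∨ b) ∨ ⌊ e ⌋)
guard-intro (yes a) b e h = ≡true⇒T (⌊⌋-true {d = e} (h (inj₁ a)))
guard-intro (no _) true e h = ≡true⇒T (⌊⌋-true {d = e} (h (inj₂ tt)))
guard-intro (no _) false e h = tt

guard-elim : ∀ {A C : Set} (d : Dec A) b (e : Dec C) → T (not (⌊ d ⌋ ∨ b) ∨ ⌊ e ⌋) → A ⊎ T b → C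
guard-elim (yes _) b e t _ = ⌊⌋-elim {d = e} t
guard-elim (no ¬a) b e t (inj₁ a) = ⊥-elim (¬a a)
guard-elim (no _) true e t (inj₂ _) = ⌊⌋-elim {d = e} t

module Labelled {m : ℕ} (X : Vec ℕ (suc m)) (isX : IsLabelSet X) where

  private
    N : ℕ
    N = suc m

  open IsLabelSet isX

  X-mono : ∀ {i j : Fin N} → toℕ i < toℕ j → lookup X i < lookup X j
  X-mono {i} {j} h = increasing i j h

  X-cancel : ∀ {i j : Fin N} → lookup X i < lookup X j → toℕ i < toℕ j
  X-cancel {i} {j} h with <-cmp (toℕ i) (toℕ j)
  ... | tri< lt _ _ = lt
  ... | tri≈ _ e _ with toℕ-injective e
  ...   | refl = ⊥-elim (<-irrefl refl h)
  X-cancel {i} {j} h | tri> _ _ gt = ⊥-elim (<-asym h (X-mono gt))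

  X-mono-≤ : ∀ {i j : Fin N} → toℕ i ≤ toℕ j → lookup X i ≤ lookup X j
  X-mono-≤ h = ≮⇒≥ (λ lt → <⇒≱ (X-cancel lt) h)

  X-cancel-≤ : ∀ {i j : Fin N} → lookup X i ≤ lookup X j → toℕ i ≤ toℕ j
  X-cancel-≤ h = ≮⇒≥ (λ lt → <⇒≱ (X-mono lt) h)

  X-pos : ∀ i → ∃ λ k → lookup X i ≡ suc k
  X-pos i with lookup X i | positive i
  ... | suc k | _ = k , refl

  shapeOf-neg : ∀ τ a → negB X τ a ≡ true → shapeOf X τ a ≡ l1
  shapeOf-neg τ a e with negB X τ a
  shapeOf-neg τ a refl | .true = refl

  shapeOf-wex : ∀ τ a → negB X τ a ≡ false → aval X τ a ≤ absτ X τ a → shapeOf X τ a ≡ l2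
  shapeOf-wex τ a e h with negB X τ a
  shapeOf-wex τ a refl h | .false = cong (if_then l2 else l0) (⌊⌋-true {d = aval X τ a ≤? absτ X τ a} h)

  shapeOf-drop : ∀ τ a → negB X τ a ≡ false → absτ X τ a < aval X τ a → shapeOf X τ a ≡ l0
  shapeOf-drop τ a e h with negB X τ a
  shapeOf-drop τ a refl h | .false = cong (if_then l2 else l0) (⌊⌋-false {d = aval X τ a ≤? absτ X τ a} (<⇒≱ h))

  val : SPData N → Fin N → ℕ
  val τ a = toℕ (perm X τ a)

  module FromVals (τ : SPData N) (L : Fin N → Letter) (sign : ∀ a → negB X τ a ≡ isL1 (L a))
    (P : Path L toℕ (λ _ → true)) (V : Vals L toℕ (val τ) (λ _ → true)) where

    private
      module V = Vals V
      module P = Path P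
      v : Fin N → ℕ
      v = val τ

      pos : ∀ {a l} → L a ≡ l → isL1 l ≡ false → negB X τ a ≡ false
      pos {a} e h = trans (sign a) (trans (cong isL1 e) h)

      minus : ∀ {a} → L a ≡ l1 → negB X τ a ≡ true
      minus {a} e = trans (sign a) (cong isL1 e)

      minus⁻ : ∀ {a} → negB X τ a ≡ true → L a ≡ l1
      minus⁻ {a} e = isL1⇒ (trans (sym (sign a)) e)

    shape : ∀ a → shapeOf X τ a ≡ L a
    shape a = by (L a) refl
      where
      by : ∀ l → L a ≡ l → shapeOf X τ a ≡ l
      by l0 e = shapeOf-drop τ a (pos e refl) (X-mono (V.zeros e refl))
      by l1 e = shapeOf-neg τ a (minus e)
      by l2 e = shapeOf-wex τ a (pos e refl) (X-mono-≤ (V.two e))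

    isAS : IsAS X τ
    isAS = record
      { signedPerm = (λ e → Bij.inj V.bij (cong toℕ e)) ,
          (λ y → let (x , e) = Bij.surj V.bij (toℕ<n y) in x , λ { refl → toℕ-injective e })
      ; firstNeg = λ z → minus P.first
      ; negIncr = λ i j ei ej h → X-mono (V.oneInc (minus⁻ ei) (minus⁻ ej) (X-cancel h)) }

    neg-stat : tabulate (isL1 ∘ L) ≡ neg X τ
    neg-stat = tabulate-cong (λ a → sym (sign a))

    sinv-stat : inversions L toℕ ≡ sinv X τ
    sinv-stat = sym (trans (sumF-countF (λ i j → ⌊ i Fin.<? j ⌋ ∧ (shapeOf X τ i >L shapeOf X τ j))) (sum₂-cong (λ i j → cong b2n
      (cong₂ _∧_ (⌊⌋≡<ᵇ {d = i Fin.<? j} id id) (cong₂ _>L_ (shape i) (shape j))))))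

    τval-neg : ∀ {a} → L a ≡ l1 → ∃ λ k → τval X τ a ≡ -[1+ k ]
    τval-neg {a} e with X-pos (perm X τ a)
    ... | k , ek = k , trans (cong (if_then ℤ.- (+ absτ X τ a) else (+ absτ X τ a)) (minus e)) (cong (λ x → ℤ.- (+ x)) ek)

    τval-pos : ∀ {a l} → L a ≡ l → isL1 l ≡ false → τval X τ a ≡ + absτ X τ a
    τval-pos {a} e h = cong (if_then ℤ.- (+ absτ X τ a) else (+ absτ X τ a)) (pos e h)

    wex-stat : countF (isL2 ∘ L) ≡ wex X τ
    wex-stat = countF-cong (λ i → sym (by i (L i) refl))
      where
      by : ∀ i l → L i ≡ l → ⌊ + aval X τ i ℤ.≤? τval X τ i ⌋ ≡ isL2 (L i)
      by i l1 e with τval-neg e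
      ... | k , ek = trans (⌊⌋-false (λ h → case subst (+ aval X τ i ℤ.≤_) ek h of λ ())) (sym (cong isL2 e))
      by i l0 e = trans (⌊⌋-false (λ h → <⇒≱ (V.zeros e refl)
                    (X-cancel-≤ (ℤP.drop‿+≤+ (subst (+ aval X τ i ℤ.≤_) (τval-pos e refl) h))))) (sym (cong isL2 e))
      by i l2 e = trans (⌊⌋-true (subst (+ aval X τ i ℤ.≤_) (sym (τval-pos e refl)) (ℤ.+≤+ (X-mono-≤ (V.two e)))))
                    (sym (cong isL2 e))

    private
      T-neg : ∀ {k} → T (negB X τ k) → L k ≡ l1
      T-neg t = minus⁻ (T⇒≡true t)

      neg-T : ∀ {k} → L k ≡ l1 → T (negB X τ k)
      neg-T e = ≡true⇒T (minus e)

    LRmax-stat : sum (λ a → b2n (LR L toℕ v (λ _ → true) a)) ≡ LRmax* X τ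
    LRmax-stat = sym (trans (countF≡sum (λ i → allL (body i) (fins N))) (sum-cong-≗ (λ i → cong b2n (bool-ext (to i (L i) refl) (from i)))))
      where
      body : Fin N → Fin N → Bool
      body i k = not (⌊ k Fin.<? i ⌋ ∨ negB X τ k) ∨ ⌊ + absτ X τ k ℤ.<? τval X τ i ⌋
      use : ∀ {i k} → T (allL (body i) (fins N)) → toℕ k < toℕ i ⊎ T (negB X τ k) → + absτ X τ k ℤ.< τval X τ i
      use {i} {k} t = guard-elim (k Fin.<? i) (negB X τ k) (+ absτ X τ k ℤ.<? τval X τ i) (allF⁻ t k)
      use⁺ : ∀ {i k l} → L i ≡ l → isL1 l ≡ false → T (allL (body i) (fins N)) → toℕ k < toℕ i ⊎ T (negB X τ k) → v k < v i
      use⁺ e h t c = X-cancel (ℤP.drop‿+<+ (subst (_ ℤ.<_) (τval-pos e h) (use t c)))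
      to : ∀ i l → L i ≡ l → T (allL (body i) (fins N)) → T (LR L toℕ v (λ _ → true) i)
      to i l1 e t with τval-neg e
      ... | k , ek = case subst (+ absτ X τ i ℤ.<_) ek (use t (inj₂ (neg-T e))) of λ ()
      -- A column drops below its own place, so some earlier strip has a value at least `i` and
      -- spoils the maximum.
      to i l0 e t with threshold toℕ-Bij V.bij (toℕ i) i ≤-refl (V.zeros e refl)
      ... | b , b<i , i≤vb = ⊥-elim (<⇒≱ (<-trans (use⁺ e refl t (inj₁ b<i)) (V.zeros e refl)) i≤vb)
      to i l2 e t = ∧-intro (subst (T ∘ isL2) (sym e) tt) (allF⁺ λ k → ≡true⇒T (lrBody-intro L toℕ v (λ _ → true) i k
        λ { _ (inj₁ lt) → use⁺ e refl t (inj₁ lt) ; _ (inj₂ ek) → use⁺ e refl t (inj₂ (neg-T ek)) }))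
      from : ∀ i → T (LR L toℕ v (λ _ → true) i) → T (allL (body i) (fins N))
      from i t = allF⁺ λ k → guard-intro (k Fin.<? i) (negB X τ k) (+ absτ X τ k ℤ.<? τval X τ i)
          (λ c → subst (+ absτ X τ k ℤ.<_) (sym (τval-pos e refl)) (ℤ.+<+ (X-mono (lt k c))))
        where
        e : L i ≡ l2
        e = isL2⇒ (T⇒≡true (∧-elimˡ t))
        lt : ∀ k → toℕ k < toℕ i ⊎ T (negB X τ k) → v k < v i
        lt k (inj₁ h) = lrBody-elim L toℕ v (λ _ → true) i k (allF⁻ (∧-elimʳ {isL2 (L i)} t) k) refl (inj₁ h)
        lt k (inj₂ h) = lrBody-elim L toℕ v (λ _ → true) i k (allF⁻ (∧-elimʳ {isL2 (L i)} t) k) refl (inj₂ (T-neg h))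

    RLmin-stat : sum (λ a → b2n (RL L toℕ v (λ _ → true) a)) ≡ RLmin* X τ
    RLmin-stat = sym (trans (countF≡sum whole) (sum-cong-≗ (λ i → cong b2n (bool-ext (to i (L i) refl) (from i)))))
      where
      body : Fin N → Fin N → Bool
      body i k = not (⌊ i Fin.<? k ⌋ ∨ negB X τ k) ∨ ⌊ τval X τ i ℤ.<? + absτ X τ k ⌋
      whole : Fin N → Bool
      whole i = ⌊ + 0 ℤ.<? τval X τ i ⌋ ∧ allL (body i) (fins N)
      use : ∀ {i k l} → L i ≡ l → isL1 l ≡ false → T (whole i) → toℕ i < toℕ k ⊎ T (negB X τ k) → v i < v k
      use {i} {k} e h t c = X-cancel (ℤP.drop‿+<+ (subst (ℤ._< + absτ X τ k) (τval-pos e h)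
        (guard-elim (i Fin.<? k) (negB X τ k) (τval X τ i ℤ.<? + absτ X τ k) (allF⁻ (∧-elimʳ {⌊ + 0 ℤ.<? τval X τ i ⌋} t) k) c)))
      to : ∀ i l → L i ≡ l → T (whole i) → T (RL L toℕ v (λ _ → true) i)
      to i l1 e t with τval-neg e
      ... | k , ek = case subst (+ 0 ℤ.<_) ek (⌊⌋-elim {d = + 0 ℤ.<? τval X τ i} (∧-elimˡ t)) of λ ()
      -- The minimum also beats the negative strip zero, whose value is then beyond `i` although its
      -- place is before `i`. So some strip at `i` or later has a value below `i`; it is not the row
      -- `i` itself and spoils the minimum.
      to i l2 e t with threshold V.bij toℕ-Bij (toℕ i) zero
                         (≤-trans (V.two e) (<⇒≤ (use e refl t (inj₂ (neg-T P.first))))) (0<i i e)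
        where
        0<i : ∀ i → L i ≡ l2 → 0 < toℕ i
        0<i zero e = l2≢l1 e P.first
        0<i (suc i) e = s≤s z≤n
      ... | b , vb<i , i≤b = ⊥-elim (<-asym (<-≤-trans vb<i (V.two e)) (use e refl t (inj₁ (≤∧≢⇒< i≤b i≢b))))
        where
        i≢b : toℕ i ≢ toℕ b
        i≢b eq with toℕ-injective eq
        ... | refl = <⇒≱ vb<i (V.two e)
      to i l0 e t = ∧-intro (subst (T ∘ isL0) (sym e) tt) (allF⁺ λ k → ≡true⇒T (rlBody-intro L toℕ v (λ _ → true) i k
        λ { _ (inj₁ lt) → use e refl t (inj₁ lt) ; _ (inj₂ ek) → use e refl t (inj₂ (neg-T ek)) }))
      from : ∀ i → T (RL L toℕ v (λ _ → true) i) → T (whole i)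
      from i t = ∧-intro {⌊ + 0 ℤ.<? τval X τ i ⌋}
          (≡true⇒T (⌊⌋-true {d = + 0 ℤ.<? τval X τ i} (subst (+ 0 ℤ.<_) (sym (τval-pos e refl)) (ℤ.+<+ (positive (perm X τ i))))))
          (allF⁺ λ k → guard-intro (i Fin.<? k) (negB X τ k) (τval X τ i ℤ.<? + absτ X τ k)
            (λ c → subst (ℤ._< + absτ X τ k) (sym (τval-pos e refl)) (ℤ.+<+ (X-mono (lt k c)))))
        where
        e : L i ≡ l0
        e = isL0⇒ (T⇒≡true (∧-elimˡ t))
        lt : ∀ k → toℕ i < toℕ k ⊎ T (negB X τ k) → v i < v k
        lt k (inj₁ h) = rlBody-elim L toℕ v (λ _ → true) i k (allF⁻ (∧-elimʳ {isL0 (L i)} t) k) refl (inj₁ h)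
        lt k (inj₂ h) = rlBody-elim L toℕ v (λ _ → true) i k (allF⁻ (∧-elimʳ {isL0 (L i)} t) k) refl (inj₂ (T-neg h))

    -- Absolute values increase along the negative entries, so `minτ` strictly increases with the
    -- label. Whatever precedes `i` then precedes `j`, the tie clause included since it makes the
    -- two minima equal; hence the index of `j` is no smaller.
    negPoint-antitone : ∀ i j → L i ≡ l1 → L j ≡ l1 → toℕ i < toℕ j → ¬ (negPoint X τ i ℤ.< negPoint X τ j)
    negPoint-antitone i j ei ej lt (ℤ.-<- h) = <⇒≱ h (countF-mono (λ f t →
        ∧-intro (∧-elimˡ t) (mono f (∧-elimʳ {negB X τ f} t))))
      where
      min< : minτ X τ i < minτ X τ j
      min< = ⊓-mono-< (X-mono lt) (X-mono (V.oneInc ei ej lt))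
      mono : ∀ f → T (ltτ X τ f i) → T (ltτ X τ f j)
      mono f t = ≡true⇒T (cong (_∨ (A ∧ ⌊ aval X τ f ≟ absτ X τ j ⌋ ∧ ⌊ absτ X τ j ≟ minτ X τ j ⌋)) (⌊⌋-true {d = minτ X τ f <? minτ X τ j} (by (minτ X τ f <? minτ X τ i) t)))
        where
        A = ⌊ minτ X τ f ≟ aval X τ f ⌋
        B = ⌊ aval X τ f ≟ absτ X τ i ⌋
        by : (d : Dec (minτ X τ f < minτ X τ i)) →
          T (⌊ d ⌋ ∨ (A ∧ B ∧ ⌊ absτ X τ i ≟ minτ X τ i ⌋)) → minτ X τ f < minτ X τ j
        by (yes h) _ = <-trans h min<
        by (no _) t = subst (_< minτ X τ j) (sym (trans (⌊⌋-elim {d = minτ X τ f ≟ aval X τ f} (∧-elimˡ {A} t))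
          (trans (⌊⌋-elim {d = aval X τ f ≟ absτ X τ i} (∧-elimˡ {B} (∧-elimʳ {A} t)))
            (⌊⌋-elim {d = absτ X τ i ≟ minτ X τ i} (∧-elimʳ {B} (∧-elimʳ {A} t)))))) min<

    private
      upArc : Letter → Fin N → Maybe (ℤ × ℤ)
      upArc l0 i = nothing
      upArc l1 i = just (negPoint X τ i , + absτ X τ i)
      upArc l2 i = just (+ aval X τ i , + absτ X τ i)

      loArc : Letter → Fin N → Maybe (ℤ × ℤ)
      loArc l0 i = just (+ absτ X τ i , + aval X τ i)
      loArc l1 i = just (negPoint X τ i , + aval X τ i)
      loArc l2 i = nothing

      upper-neg : ∀ i → negB X τ i ≡ true → upperArc X τ i ≡ upArc l1 i
      upper-neg i e with negB X τ i
      upper-neg i refl | .true = refl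

      upper-pos : ∀ i → negB X τ i ≡ false → upperArc X τ i ≡ (if ⌊ aval X τ i ≤? absτ X τ i ⌋ then upArc l2 i else nothing)
      upper-pos i e with negB X τ i
      upper-pos i refl | .false = refl

      lower-neg : ∀ i → negB X τ i ≡ true → lowerArc X τ i ≡ loArc l1 i
      lower-neg i e with negB X τ i
      lower-neg i refl | .true = refl

      lower-pos : ∀ i → negB X τ i ≡ false → lowerArc X τ i ≡ (if ⌊ aval X τ i ≤? absτ X τ i ⌋ then nothing else loArc l0 i)
      lower-pos i e with negB X τ i
      lower-pos i refl | .false = refl

      wexB : ∀ {i l} → L i ≡ l → isL1 l ≡ false → ⌊ aval X τ i ≤? absτ X τ i ⌋ ≡ isL2 l
      wexB {i} {l0} e _ = ⌊⌋-false (<⇒≱ (X-mono (V.zeros e refl)))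
      wexB {i} {l2} e _ = ⌊⌋-true (X-mono-≤ (V.two e))

      upper≡ : ∀ {i} l → L i ≡ l → upperArc X τ i ≡ upArc l i
      upper≡ {i} l0 e = trans (upper-pos i (pos e refl)) (cong (if_then upArc l2 i else nothing) (wexB e refl))
      upper≡ {i} l1 e = upper-neg i (minus e)
      upper≡ {i} l2 e = trans (upper-pos i (pos e refl)) (cong (if_then upArc l2 i else nothing) (wexB e refl))

      lower≡ : ∀ {i} l → L i ≡ l → lowerArc X τ i ≡ loArc l i
      lower≡ {i} l0 e = trans (lower-pos i (pos e refl)) (cong (if_then nothing else loArc l0 i) (wexB e refl))
      lower≡ {i} l1 e = lower-neg i (minus e)
      lower≡ {i} l2 e = trans (lower-pos i (pos e refl)) (cong (if_then nothing else loArc l0 i) (wexB e refl))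

      lt≡ : ∀ {a b : Fin N} → ⌊ + lookup X a ℤ.<? + lookup X b ⌋ ≡ (toℕ a <ᵇ toℕ b)
      lt≡ {a} {b} = ⌊⌋≡<ᵇ {d = + lookup X a ℤ.<? + lookup X b} (λ h → X-cancel (ℤP.drop‿+<+ h)) (λ h → ℤ.+<+ (X-mono h))

      le≡ : ∀ {a b : Fin N} → ⌊ + lookup X a ℤ.≤? + lookup X b ⌋ ≡ not (toℕ b <ᵇ toℕ a)
      le≡ {a} {b} with toℕ b <? toℕ a
      ... | yes h = trans (⌊⌋-false (λ h′ → <⇒≱ h (X-cancel-≤ (ℤP.drop‿+≤+ h′)))) (sym (cong not (<ᵇ-true h)))
      ... | no h = trans (⌊⌋-true (ℤ.+≤+ (X-mono-≤ (≮⇒≥ h)))) (sym (cong not (<ᵇ-false (≮⇒≥ h))))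

      -- Arcs of negative strips are nested: the one ending further right starts no further right.
      -- This is why `crB` counts nothing when the right arc belongs to a negative strip.
      both-neg-upper : ∀ i j → L i ≡ l1 → L j ≡ l1 → upperCross X τ (upArc l1 i) (upArc l1 j) ≡ false
      both-neg-upper i j ei ej = ¬T⇒≡false λ t →
        let a<c = ⌊⌋-elim {d = negPoint X τ i ℤ.<? negPoint X τ j} (∧-elimˡ t)
            b<d = X-cancel (ℤP.drop‿+<+ (⌊⌋-elim {d = + absτ X τ i ℤ.<? + absτ X τ j}
                    (∧-elimʳ {⌊ negPoint X τ j ℤ.≤? + absτ X τ i ⌋} (∧-elimʳ {⌊ negPoint X τ i ℤ.<? negPoint X τ j ⌋} t))))
        in negPoint-antitone i j ei ej (order b<d) a<c
        where
        order : v i < v j → toℕ i < toℕ j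
        order h with <-cmp (toℕ i) (toℕ j)
        ... | tri< lt _ _ = lt
        ... | tri≈ _ e _ with toℕ-injective e
        ...   | refl = ⊥-elim (<-irrefl refl h)
        order h | tri> _ _ gt = ⊥-elim (<-asym h (V.oneInc ej ei gt))

      both-neg-lower : ∀ i j → L i ≡ l1 → L j ≡ l1 → lowerCross X τ (loArc l1 i) (loArc l1 j) ≡ false
      both-neg-lower i j ei ej = ¬T⇒≡false λ t →
        let a<c = ⌊⌋-elim {d = negPoint X τ i ℤ.<? negPoint X τ j} (∧-elimˡ t)
            b<d = X-cancel (ℤP.drop‿+<+ (⌊⌋-elim {d = + aval X τ i ℤ.<? + aval X τ j}
                    (∧-elimʳ {⌊ negPoint X τ j ℤ.<? + aval X τ i ⌋} (∧-elimʳ {⌊ negPoint X τ i ℤ.<? negPoint X τ j ⌋} t))))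
        in negPoint-antitone i j ei ej b<d a<c

      -- Comparisons of a negative point with a label compute, which settles the signs. At most one
      -- of the two crossings is possible, decided by the letter of `j`.
      cross : ∀ i j l l′ → L i ≡ l → L j ≡ l′ →
        b2n (upperCross X τ (upArc l i) (upArc l′ j)) + b2n (lowerCross X τ (loArc l i) (loArc l′ j)) ≡
        b2n (crB l l′ (toℕ i <ᵇ toℕ j) (v i <ᵇ toℕ j) (v i <ᵇ v j) (v j <ᵇ toℕ i))
      cross i j l0 l1 ei ej = refl
      cross i j l1 l1 ei ej = cong₂ (λ x y → b2n x + b2n y) (both-neg-upper i j ei ej) (both-neg-lower i j ei ej)
      cross i j l2 l1 ei ej = refl
      -- A column has no upper arc. The formula of `crB`, which does not separate the positive
      -- letters of the left arc, agrees because `val` of a column lies below its place.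
      cross i j l0 l2 ei ej = sym (cong b2n (no-cross (toℕ i <? toℕ j)))
        where
        no-cross : Dec (toℕ i < toℕ j) → (toℕ i <ᵇ toℕ j) ∧ (not (v i <ᵇ toℕ j) ∧ (v i <ᵇ v j)) ≡ false
        no-cross (yes h) = ∧-falseʳ (toℕ i <ᵇ toℕ j) (cong (λ x → not x ∧ (v i <ᵇ v j)) (<ᵇ-true (<-trans (V.zeros ei refl) h)))
        no-cross (no h) = cong (_∧ (not (v i <ᵇ toℕ j) ∧ (v i <ᵇ v j))) (<ᵇ-false (≮⇒≥ h))
      cross i j l1 l2 ei ej = trans (+-identityʳ _) (cong b2n (cong₂ _∧_ le≡ lt≡))
      cross i j l2 l2 ei ej = trans (+-identityʳ _) (cong b2n (cong₂ _∧_ lt≡ (cong₂ _∧_ le≡ lt≡)))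
      cross i j l0 l0 ei ej = cong b2n (cong₂ _∧_ lt≡ (cong₂ _∧_ lt≡ lt≡))
      cross i j l1 l0 ei ej = cong b2n (cong₂ _∧_ lt≡ lt≡)
      cross i j l2 l0 ei ej = sym (cong b2n (no-cross (v i <? v j)))
        where
        no-cross : Dec (v i < v j) → (v i <ᵇ v j) ∧ ((v j <ᵇ toℕ i) ∧ (toℕ i <ᵇ toℕ j)) ≡ false
        no-cross (yes h) = ∧-falseʳ (v i <ᵇ v j) (cong (_∧ (toℕ i <ᵇ toℕ j)) (<ᵇ-false (≤-trans (V.two ei) (<⇒≤ h))))
        no-cross (no h) = cong (_∧ ((v j <ᵇ toℕ i) ∧ (toℕ i <ᵇ toℕ j))) (<ᵇ-false (≮⇒≥ h))

    cro-stat : crossings L toℕ v (λ _ → true) ≡ cro X τ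
    cro-stat = sym (trans (cong₂ _+_ (sumF-countF U) (sumF-countF W))
      (trans (sym (sum₂-+ (λ i j → b2n (U i j)) (λ i j → b2n (W i j)))) (sum₂-cong pt)))
      where
      U W : Fin N → Fin N → Bool
      U i j = upperCross X τ (upperArc X τ i) (upperArc X τ j)
      W i j = lowerCross X τ (lowerArc X τ i) (lowerArc X τ j)
      pt : ∀ i j → b2n (U i j) + b2n (W i j) ≡ b2n (CR L toℕ v (λ _ → true) i j)
      pt i j = trans (cong₂ (λ x y → b2n x + b2n y)
        (cong₂ (upperCross X τ) (upper≡ (L i) refl) (upper≡ (L j) refl))
        (cong₂ (lowerCross X τ) (lower≡ (L i) refl) (lower≡ (L j) refl)))
        (cross i j (L i) (L j) refl refl)

-- The bijection

module _ {m : ℕ} (X : Vec ℕ (suc m)) (isX : IsLabelSet X) where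
  open Labelled X isX

  Vals-of-AS : ∀ τ (L : Fin (suc m) → Letter) → (∀ a → L a ≡ shapeOf X τ a) → IsAS X τ → Vals L toℕ (val τ) (λ _ → true)
  Vals-of-AS τ L hL A = record
    { bij = record
        { bound = λ a → toℕ<n (perm X τ a)
        ; inj = λ e → proj₁ signedPerm (toℕ-injective e)
        ; surj = λ {x} h → let (a , e) = proj₂ signedPerm (fromℕ< h) in a , trans (cong toℕ (e refl)) (toℕ-fromℕ< h) }
    ; dead = λ ()
    ; two = λ {a} e → two a (trans (sym (hL a)) e)
    ; zeros = λ {a} e _ → zeros a (trans (sym (hL a)) e)
    ; oneInc = λ {a} {b} ea eb h → X-cancel (negIncr a b (one a (trans (sym (hL a)) ea)) (one b (trans (sym (hL b)) eb)) (X-mono h)) }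
    where
    open IsAS A
    two : ∀ a → shapeOf X τ a ≡ l2 → toℕ a ≤ val τ a
    two a e with negB X τ a
    two a () | true
    two a e | false with aval X τ a ≤? absτ X τ a
    two a e | false | yes h = X-cancel-≤ h
    two a () | false | no _
    zeros : ∀ a → shapeOf X τ a ≡ l0 → val τ a < toℕ a
    zeros a e with negB X τ a
    zeros a () | true
    zeros a e | false with aval X τ a ≤? absτ X τ a
    zeros a () | false | yes _
    zeros a e | false | no h = X-cancel (≰⇒> h)
    one : ∀ a → shapeOf X τ a ≡ l1 → negB X τ a ≡ true
    one a e with negB X τ a
    one a e | true = refl
    one a e | false with aval X τ a ≤? absτ X τ a
    one a () | false | yes _
    one a () | false | no _

  negB-shape : ∀ τ a → isL1 (shapeOf X τ a) ≡ negB X τ a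
  negB-shape τ a with negB X τ a
  ... | true = refl
  ... | false with aval X τ a ≤? absτ X τ a
  ...   | yes _ = refl
  ...   | no _ = refl

-- `ζ` has to be defined on all fillings, while the bound on `valOf` is known only for valid ones.
-- The default `zero` is never reached on those.
clamp : ∀ {m} → ℕ → Fin (suc m)
clamp {m} x with x <? suc m
... | yes h = fromℕ< h
... | no _ = zero

toℕ-clamp : ∀ {m x} → x < suc m → toℕ (clamp {m} x) ≡ x
toℕ-clamp {m} {x} h with x <? suc m
... | yes h′ = toℕ-fromℕ< h′
... | no ¬h = ⊥-elim (¬h h)

ζ : ∀ {m} → RATData (suc m) → SPData (suc m)
ζ R = tabulate (λ a → isL1 (lookup (word R) a) , clamp (valOf toℕ (λ _ → true) (tiling (word R)) (fill R) a))

tiling-run : ∀ {m} (w : Vec Letter (suc m)) → Run (lookup w) toℕ (tiling w)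
tiling-run {m} w = run (lookup w) _ _ toℕ toℕ-Bij
  (record { place = At-zip w id
          ; unique = λ at → case At-zip⁻ w id at of λ { (a , ek , el , refl) → ek , el } })
  (inversions-bound (lookup w) toℕ)

start-path : ∀ {m} (w : Vec Letter (suc m)) → lookup w zero ≡ l1 → Path (lookup w) toℕ (λ _ → true)
start-path w e = record { bij = toℕ-Bij ; first = e ; before = λ () ; oneLive = λ _ → refl }

IsRATPlus⇒Valid : ∀ {m} {R : RATData (suc m)} → IsRATPlus R → Valid (lookup (word R)) (λ _ → true) (tiling (word R)) (fill R)
IsRATPlus⇒Valid {R = R} h = RATG⇒Valid (lookup (word R)) (fill R) (tiling-run (word R)) toℕ-Bij (record
  { upC = upInColumn ; leftR = leftInRow ; notP = notPointedAt ; alive = λ _ _ → tt ; cols = λ ℓ e _ → colsUp ℓ e })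
  where
  open IsRATPlus h
  open IsRAT isRAT

Valid⇒IsRATPlus : ∀ {m} (R : RATData (suc m)) → lookup (word R) zero ≡ l1 →
  Valid (lookup (word R)) (λ _ → true) (tiling (word R)) (fill R) → IsRATPlus R
Valid⇒IsRATPlus R e v = record
  { isRAT = record { upInColumn = upC ; leftInRow = leftR ; notPointedAt = notP }
  ; firstDiag = λ _ → e ; colsUp = λ ℓ el → cols ℓ el refl }
  where open RATG (Valid⇒RATG (lookup (word R)) (fill R) (tiling-run (word R)) toℕ-Bij v)

-- The values stored in `ζ R` agree with `valOf` only pointwise, so the properties of a state are
-- transported along pointwise equality.
module _ {m : ℕ} (L : Fin (suc m) → Letter) {src val val′ : Fin (suc m) → ℕ} {live : Fin (suc m) → Bool}
  (e : ∀ a → val a ≡ val′ a) where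

  Vals-resp : Vals L src val live → Vals L src val′ live
  Vals-resp V = record
    { bij = record
        { bound = λ a → subst (_< suc m) (e a) (Bij.bound V.bij a)
        ; inj = λ {a} {b} h → Bij.inj V.bij (trans (e a) (trans h (sym (e b))))
        ; surj = λ h → let (a , ea) = Bij.surj V.bij h in a , trans (sym (e a)) ea }
    ; dead = λ {a} d → trans (sym (e a)) (V.dead d)
    ; two = λ {a} h → subst (src a ≤_) (e a) (V.two h)
    ; zeros = λ {a} h l → subst (_< src a) (e a) (V.zeros h l)
    ; oneInc = λ {a} {b} ea eb h → subst₂ _<_ (e a) (e b) (V.oneInc ea eb h) }
    where module V = Vals V

  Good-resp : ∀ {fr tu fc} → Good L src val live fr tu fc → Good L src val′ live fr tu fc
  Good-resp G = record
    { vals = Vals-resp G.vals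
    ; lrOK = trans (sum-cong-≗ (λ a → cong (λ x → b2n (isL2 (L a) ∧ (live a ∧ x))) (allL-cong (λ k →
        cong₂ (λ u w → not (live k ∧ ((src k <ᵇ src a) ∨ isL1 (L k))) ∨ (u <ᵇ w)) (sym (e k)) (sym (e a))) (fins (suc m))))) G.lrOK
    ; rlOK = trans (sum-cong-≗ (λ a → cong (λ x → b2n (isL0 (L a) ∧ (live a ∧ x))) (allL-cong (λ k →
        cong₂ (λ u w → not (live k ∧ ((src a <ᵇ src k) ∨ isL1 (L k))) ∨ (u <ᵇ w)) (sym (e a)) (sym (e k))) (fins (suc m))))) G.rlOK
    ; crOK = trans (sum₂-cong (λ a b → cong (λ x → b2n (live a ∧ (live b ∧ x))) (crS-eval L src val′ a b refl refl refl
        (cong (_<ᵇ src b) (sym (e a))) (cong₂ _<ᵇ_ (sym (e a)) (sym (e b))) (cong (_<ᵇ src a) (sym (e b)))))) G.crOK }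
    where module G = Good G

-- The image of a tableau and its statistics

module Image {m : ℕ} (X : Vec ℕ (suc m)) (isX : IsLabelSet X) (R : RATData (suc m)) (h : IsRATPlus R) where
  open Labelled X isX using (val; module FromVals)

  L : Fin (suc m) → Letter
  L = lookup (word R)

  live : Fin (suc m) → Bool
  live _ = true

  v₀ : Fin (suc m) → ℕ
  v₀ = valOf toℕ live (tiling (word R)) (fill R)

  r : Run L toℕ (tiling (word R))
  r = tiling-run (word R)

  P : Path L toℕ live
  P = start-path (word R) (IsRATPlus.firstDiag h (s≤s z≤n))

  v : Valid L live (tiling (word R)) (fill R)
  v = IsRATPlus⇒Valid h

  good₀ : Good L toℕ v₀ live (frowR L live (tiling (word R)) (fill R)) (topupR (tiling (word R)) (fill R))
    (fcellR live (tiling (word R)) (fill R))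
  good₀ = good L (fill R) r P v

  entry : ∀ a → lookup (ζ R) a ≡ (isL1 (L a) , clamp (v₀ a))
  entry a = lookup∘tabulate (λ a → isL1 (L a) , clamp (v₀ a)) a

  val≡ : ∀ a → val (ζ R) a ≡ v₀ a
  val≡ a = trans (cong (toℕ ∘ proj₂) (entry a)) (toℕ-clamp (Bij.bound (Vals.bij (Good.vals good₀)) a))

  module G = Good (Good-resp L {live = live} (λ a → sym (val≡ a)) good₀)

  open FromVals (ζ R) L (λ a → cong proj₁ (entry a)) P G.vals public

  tile≡sinv : tileStat R ≡ sinv X (ζ R)
  tile≡sinv = trans (run-length L toℕ-Bij r) sinv-stat

  topup≡RLmin : topupStat R (s≤s z≤n) ≡ RLmin* X (ζ R)
  topup≡RLmin = trans (countF≡sum (λ k → isUp (contentAt R k) ∧ inStrip zero (tileAt R k)))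
    (trans (topup≡topupR (tiling (word R)) (fill R)) (trans (sym G.rlOK) RLmin-stat))

  frow≡LRmax : frowStat R ≡ LRmax* X (ζ R)
  frow≡LRmax = trans (countF≡sum (frowG L live (tiling (word R)) (fill R)))
    (trans (frowG≡frowR L {live = live} (fill R) r toℕ-Bij) (trans (sym G.lrOK) LRmax-stat))

  fcell≡cro : fcellStat R ≡ cro X (ζ R)
  fcell≡cro = trans (countF≡sum (λ k′ → isEmpty (contentAt R k′) ∧ not (anyL (λ k → pointsTo R k k′) (tileIxs R))))
    (trans (sum-cong-≗ (λ k′ → cong (λ x → b2n (isEmpty (contentAt R k′) ∧ x)) (sym (∧-identityʳ _))))
      (trans (fcellG≡fcellR live (tiling (word R)) (fill R)) (trans (sym G.crOK) cro-stat)))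

lookup-ext : ∀ {A : Set} {n} {u w : Vec A n} → (∀ i → lookup u i ≡ lookup w i) → u ≡ w
lookup-ext {u = u} {w} h = trans (sym (tabulate∘lookup u)) (trans (tabulate-cong h) (tabulate∘lookup w))

module _ {m : ℕ} (X : Vec ℕ (suc m)) (isX : IsLabelSet X) where

  ζ-injective : ∀ R R′ → IsRATPlus R → IsRATPlus R′ → ζ R ≡ ζ R′ → R ≡ R′
  -- The word is recovered as the shape of the image. Only once the words are identified do both
  -- fillings live on the same tiling and become comparable.
  ζ-injective R R′ h h′ e with lookup-ext {u = word R} {word R′} (λ a →
    trans (sym (Image.shape X isX R h a)) (trans (cong (λ τ → shapeOf X τ a) e) (Image.shape X isX R′ h′ a)))
  ζ-injective (rat w f) (rat .w f′) h h′ e | refl = cong (rat w)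
    (valOf-injective (lookup w) f f′ I.r I.P I.v I′.v
      (λ a → trans (sym (I.val≡ a)) (trans (cong (λ τ → Labelled.val X isX τ a) e) (I′.val≡ a))))
    where
    module I = Image X isX (rat w f) h
    module I′ = Image X isX (rat w f′) h′

  ζ-surjective : ∀ τ → IsAS X τ → Σ (RATData (suc m)) λ R → IsRATPlus R × ζ R ≡ τ
  ζ-surjective τ A = rat w cs , Valid⇒IsRATPlus (rat w cs) first v ,
      trans (tabulate-cong entry) (tabulate∘lookup τ)
    where
    w : Vec Letter (suc m)
    w = tabulate (shapeOf X τ)
    L≡ : ∀ a → lookup w a ≡ shapeOf X τ a
    L≡ = lookup∘tabulate (shapeOf X τ)
    first : lookup w zero ≡ l1
    first = trans (L≡ zero) (Labelled.shapeOf-neg X isX τ zero (IsAS.firstNeg A (s≤s z≤n)))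
    F : Filling (lookup w) toℕ (Labelled.val X isX τ) (λ _ → true) (tiling w)
    F = filling (lookup w) (tiling-run w) (start-path w first) (Vals-of-AS X isX τ (lookup w) L≡ A)
    cs : Vec Content (length (tiling w))
    cs = proj₁ F
    v : Valid (lookup w) (λ _ → true) (tiling w) cs
    v = proj₁ (proj₂ F)
    entry : ∀ a → (isL1 (lookup w a) , clamp (valOf toℕ (λ _ → true) (tiling w) cs a)) ≡ lookup τ a
    entry a = cong₂ _,_ (trans (cong isL1 (L≡ a)) (negB-shape X isX τ a))
      (toℕ-injective (trans (cong (toℕ ∘ clamp {m}) (proj₂ (proj₂ F) a)) (toℕ-clamp (toℕ<n (perm X τ a)))))

theorem5p12 : (m : ℕ) (X : Vec ℕ (suc m)) → IsLabelSet X →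
    Σ (RATData (suc m) → SPData (suc m)) λ ζ →
    (∀ R → IsRATPlus R → IsAS X (ζ R)) ×
    (∀ R R' → IsRATPlus R → IsRATPlus R' → ζ R ≡ ζ R' → R ≡ R') ×
    (∀ τ → IsAS X τ → Σ (RATData (suc m)) λ R → IsRATPlus R × ζ R ≡ τ) ×
    (∀ R → IsRATPlus R →
    (diag R ≡ neg X (ζ R)) ×
    (tileStat R ≡ sinv X (ζ R)) ×
    (rowStat R ≡ wex X (ζ R)) ×
    (topupStat R (s≤s z≤n) ≡ RLmin* X (ζ R)) ×
    (frowStat R ≡ LRmax* X (ζ R)) ×
    (fcellStat R ≡ cro X (ζ R)))
theorem5p12 m X isX = ζ , (λ R h → Image.isAS X isX R h) , ζ-injective X isX , ζ-surjective X isX , λ R h →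
  let open Image X isX R h in neg-stat , tile≡sinv , wex-stat , topup≡RLmin , frow≡LRmax , fcell≡cro
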